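{- There is an absolute constant $L$ such that the following holds for every $n$. Let $q\in[0,1]$, let $H$ be a $q$-sparse graph on $n$ vertices, and let $p=Lq$. If $F$ is a clique $K_r$ or a cycle $C_k$ (of any size, possibly depending on $n$), then \[ N(H,F) < \mathbb{E}_pX_F. \]
   Context: All graphs are simple. A copy of a graph $J$ in a graph $G$ is an unlabeled subgraph of $G$ isomorphic to $J$, and $N(G,J)$ denotes the number of copies of $J$ in $G$. $G_{n,p}$ is the Erdős–Rényi random graph on $n$ vertices, and $\mathbb{E}_pX_J:=\mathbb{E}\,N(G_{n,p},J)=N(K_n,J)p^{e_J}$, where $e_J$ is the number of edges of $J$. A graph $H$ on $n$ vertices (i.e. a subgraph of $K_n$) is $q$-sparse if $\mathbb{E}_qX_I\ge 1$ for every subgraph $I\subseteq H$.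
   Formalization: Here q is rational (real q follows on replacing L by 2L); the cases q = 0, K_1, and cliques or cycles with more than n vertices, where both sides are equal and the strict inequality fails, are excluded, and cycles have length at least 3. -}

module Defs where

open import Data.Bool using (Bool; true; false; _∧_; _∨_; not; if_then_else_)
open import Data.Nat using (ℕ; zero; suc; _<ᵇ_; _≡ᵇ_)
open import Data.Fin using (Fin; toℕ)
open import Data.Fin.Properties using (_≟_)
open import Data.Vec using (Vec; []; _∷_; lookup)
open import Data.List using (List; []; _∷_; [_]; map; concatMap; allFin)
open import Data.Bool.ListAction using (and; or)
open import Data.Product using (_×_; _,_)
open import Data.Integer using (+_)
open import Data.Rational using (ℚ; 1ℚ; _*_; _/_; _≤_)
open import Relation.Nullary.Decidable using (⌊_⌋)
open import Relation.Binary.PropositionalEquality using (_≡_; refl) renaming (sym to ≡sym)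
open import Relation.Nullary using (yes; no)
open import Data.Empty using (⊥-elim)

fromℕ : ℕ → ℚ
fromℕ n = + n / 1

infixr 8 _^_
_^_ : ℚ → ℕ → ℚ
x ^ zero  = 1ℚ
x ^ suc k = x * (x ^ k)

_==_ : ∀ {n} → Fin n → Fin n → Bool
i == j = ⌊ i ≟ j ⌋

allF : ∀ n → (Fin n → Bool) → Bool
allF n P = and (map P (allFin n))

anyF : ∀ n → (Fin n → Bool) → Bool
anyF n P = or (map P (allFin n))

_⇒ᵇ_ : Bool → Bool → Bool
a ⇒ᵇ b = not a ∨ b

_⇔ᵇ_ : Bool → Bool → Bool
a ⇔ᵇ b = (a ⇒ᵇ b) ∧ (b ⇒ᵇ a)

allVec : ∀ {A : Set} → List A → (m : ℕ) → List (Vec A m)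
allVec xs zero    = [ [] ]
allVec xs (suc m) = concatMap (λ v → map (_∷ v) xs) (allVec xs m)

record Graph (n : ℕ) : Set where
  field
    adj   : Fin n → Fin n → Bool
    sym   : ∀ i j → adj i j ≡ adj j i
    irref : ∀ i → adj i i ≡ false
open Graph public

-- A (vertex set, edge set) pair on the ground set Fin n.
-- A subgraph of a graph G on Fin n is such a pair satisfying isSubgraph G.
VSet : ℕ → Set
VSet n = Fin n → Bool

ESet : ℕ → Set
ESet n = Fin n → Fin n → Bool

isSubgraph : ∀ {n} → Graph n → VSet n → ESet n → Bool
isSubgraph {n} G S E =
  allF n λ i → allF n λ j →
    ((E i j ⇔ᵇ E j i) ∧ not (E i i)) ∧
    (E i j ⇒ᵇ (adj G i j ∧ (S i ∧ S j)))

countᵇ : ∀ {A : Set} → (A → Bool) → List A → ℕ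
countᵇ P []       = zero
countᵇ P (x ∷ xs) = if P x then suc (countᵇ P xs) else countᵇ P xs

numEdges : ∀ {n} → ESet n → ℕ
numEdges {n} E =
  countᵇ (λ { (i , j) → E i j ∧ (toℕ i <ᵇ toℕ j) })
         (concatMap (λ i → map (λ j → (i , j)) (allFin n)) (allFin n))

isoVia : ∀ {n m} → VSet n → ESet n → VSet m → ESet m → (Fin m → Fin n) → Bool
isoVia {n} {m} S₁ E₁ S₂ E₂ f =
  (allF m λ i → allF m λ j → (S₂ i ∧ S₂ j) ⇒ᵇ (((f i == f j) ⇒ᵇ (i == j)) ∧ (E₂ i j ⇔ᵇ E₁ (f i) (f j)))) ∧
  (allF n λ v → S₁ v ⇔ᵇ (anyF m λ i → S₂ i ∧ (f i == v)))

isIso : ∀ {n m} → VSet n → ESet n → VSet m → ESet m → Bool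
isIso {n} {m} S₁ E₁ S₂ E₂ =
  or (map (λ fv → isoVia S₁ E₁ S₂ E₂ (lookup fv)) (allVec (allFin n) m))

allPairs : ∀ n → List (Vec Bool n × Vec (Vec Bool n) n)
allPairs n = concatMap (λ S → map (S ,_) (allVec (allVec (true ∷ false ∷ []) n) n))
                       (allVec (true ∷ false ∷ []) n)

N : ∀ {n m} → Graph n → VSet m → ESet m → ℕ
N {n} G S₂ E₂ =
  countᵇ (λ { (S , E) → isSubgraph G (lookup S) (λ i j → lookup (lookup E i) j)
                      ∧ isIso (lookup S) (λ i j → lookup (lookup E i) j) S₂ E₂ })
         (allPairs n)

K : (n : ℕ) → Graph n
K n = record { adj = λ i j → not (i == j) ; sym = symK ; irref = irrK }
  where
  symK : ∀ i j → not (i == j) ≡ not (j == i)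
  symK i j with i ≟ j | j ≟ i
  ... | yes _ | yes _ = refl
  ... | no _  | no _  = refl
  ... | yes p | no q  = ⊥-elim (q (≡sym p))
  ... | no p  | yes q = ⊥-elim (p (≡sym q))
  irrK : ∀ i → not (i == i) ≡ false
  irrK i with i ≟ i
  ... | yes _ = refl
  ... | no p  = ⊥-elim (p refl)

full : ∀ {m} → VSet m
full _ = true

𝔼 : (n : ℕ) → ℚ → ∀ {m} → VSet m → ESet m → ℚ
𝔼 n p S₂ E₂ = fromℕ (N (K n) S₂ E₂) * (p ^ numEdges E₂)

Sparse : ∀ {n} → ℚ → Graph n → Set
Sparse {n} q H = (S : VSet n) (E : ESet n) → isSubgraph H S E ≡ true →
                 1ℚ ≤ 𝔼 n q S E

Kr : (r : ℕ) → ESet r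
Kr r = adj (K r)

-- the cycle C_k on Fin k : i ~ j iff j ≡ i + 1 (mod k) or i ≡ j + 1 (mod k)
-- (a simple graph when k ≥ 3)
Ck : (k : ℕ) → ESet k
Ck k i j = succ i j ∨ succ j i
  where
  succ : Fin k → Fin k → Bool
  succ a b = (suc (toℕ a) ≡ᵇ toℕ b) ∨ ((suc (toℕ a) ≡ᵇ k) ∧ (toℕ b ≡ᵇ 0))

{-# OPTIONS --safe #-}
module Submission where

-- Everything is deduced from upper bounds for the number of copies of suitable subgraphs I of H.
-- Counting codes of the copies shows: (a) n^v q^e ≥ 1 for subgraphs with v vertices and e edges,
-- hence some vertex of every nonempty set W of vertices has degree δ in W with n² q^δ ≥ 1;
-- (b) a family of pairwise edge-disjoint copies of F in H has at most 4 n^|F| q^e(F) members.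
-- Peeling off low-degree vertices reduces the theorem to the number of copies of F through one
-- such vertex and the number of vertices covered by copies.  The latter is at most n, which
-- suffices if n^(|F|-1) q^e(F) is large; otherwise (b) bounds it after a greedy sweep of the
-- copies.  For cliques a vertex of degree δ lies in at most 2^δ copies.  For cycles, put y = 2nq.
-- If ℓ ≤ k-2 is maximal with y^ℓ q ≤ 1, any two vertices are joined by only exponentially many (in ℓ)
-- paths of length ℓ, as their union has bounded excess, and the remaining vertices of a k-cycle
-- can be chosen in (C y)^j ways, since the degrees along a k-cycle add up to O(yk).
-- All estimates are carried out in ℕ, with q = p/d and n^v q^e ≥ 1 written as d^e ≤ n^v p^e.

-- The room for error is a factor `L` per edge of F. A clique may thus lose 2^(O(r²)), enough even
-- for r^r, but a k-cycle only 2^(O(k)). This is why degrees along a cycle or a path are never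
-- bounded one by one: only their sum is controlled, and a walk is coded by that sum at exponential
-- cost. Summing over the peeled vertices costs a factor n. If n^(|F|-1) q^e(F) is small, the
-- expected number of copies may be below n, so that n has to be replaced by the number of covered
-- vertices. Otherwise the choice of ℓ pays for this factor in the case of cycles: maximality gives
-- n ≤ y^(ℓ+2), and exactly ℓ + 2 vertices of the cycle are not chosen by the free walk. It pays to
-- apply sparsity to subgraphs with many symmetries, such as families of copies or stars; the
-- factorials saved there are handled by m^a ≤ a! 2^(m+a). With L = 2^Λ the estimates need Λ > 20
-- for cliques and Λ > 26 for cycles, so that 2^30 serves both.

module CopyCounts where

  open import Defs hiding (_^_; sym)
  import Defs as D
  open import Data.Bool.ListAction using (and; or)
  open import Data.Bool using (Bool; true; false; not; T; if_then_else_; _∧_; _∨_)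
  import Data.Bool.Properties as Boolₚ
  open import Data.Nat
  open import Data.Nat.ListAction using (sum)
  open import Level using (0ℓ)
  open import Data.Nat.Properties renaming (^-distribˡ-+-* to ^-split)
  open import Data.Nat.DivMod using (m≡m%n+[m/n]*n; m%n<n; m/n*n≤m)
  open import Data.Nat.Solver using (module +-*-Solver)
  open import Data.Fin using (Fin; zero; suc; toℕ)
  import Data.Fin as Fin
  import Data.Fin.Properties as Finₚ
  open import Data.List using (List; []; _∷_; [_]; _++_; map; length; filter; concatMap; allFin; tabulate; take; drop)
  import Data.List.Properties as Listₚ
  open import Data.List.Properties using (length-map; length-++; length-filter; filter-accept; filter-reject; length-take; length-drop; take++drop≡id; map-++; map-∘; map-cong; length-tabulate; ++-assoc)
  open import Data.List.Membership.Propositional using (_∈_; _∉_; find; lose)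
  open import Data.List.Membership.Propositional.Properties
  open import Data.List.Relation.Unary.Any using (Any; here; there)
  import Data.List.Relation.Unary.Any as Any
  open import Data.List.Relation.Unary.All using (All; []; _∷_)
  import Data.List.Relation.Unary.All as All
  import Data.List.Relation.Unary.All.Properties as Allₚ
  open import Data.List.Relation.Unary.AllPairs using ([]; _∷_)
  import Data.List.Relation.Unary.AllPairs as AllPairs
  open import Data.List.Relation.Unary.Unique.Propositional using (Unique)
  import Data.List.Relation.Unary.Unique.Propositional.Properties as Uniqueₚ
  open import Data.List.Relation.Binary.Subset.Propositional using (_⊆_)
  open import Data.Vec using (Vec; []; _∷_; lookup; toList)
  import Data.Vec as Vec
  import Data.Vec.Properties as Vecₚ
  open import Data.Product using (Σ; ∃; _×_; _,_; proj₁; proj₂)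
  open import Data.Product.Properties using (,-injective; ≡-dec)
  open import Data.Sum using (_⊎_; inj₁; inj₂; [_,_]′)
  open import Data.Empty using (⊥; ⊥-elim)
  open import Data.Unit using (⊤; tt)
  open import Function using (_∘_; id; case_of_)
  open import Function.Bundles using (Equivalence)
  open import Function.Definitions using (Injective)
  open import Relation.Nullary using (¬_; Dec; yes; no; does)
  open import Relation.Nullary.Decidable using (_×-dec_; ¬?; map′; dec-true; dec-false)
  open import Relation.Unary using (Pred; Decidable)
  import Relation.Binary.PropositionalEquality
  open import Relation.Binary.PropositionalEquality using (_≡_; _≢_; refl; sym; trans; cong; cong₂; subst; subst₂)
  open import Relation.Binary.Definitions using (DecidableEquality; tri<; tri≈; tri>)
  import Data.Integer as ℤ
  import Data.Integer.Properties as ℤₚ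
  import Data.Rational as ℚ
  import Data.Rational.Properties as ℚₚ
  import Data.Rational.Unnormalised as ℚᵘ
  import Data.Rational.Unnormalised.Properties as ℚᵘₚ
  import Data.Nat.Coprimality as Coprimality
  open import Data.Rational using (ℚ; mkℚ; 0ℚ; 1ℚ)
  open import Data.Rational.Solver using () renaming (module +-*-Solver to ℚ+*-Solver)

  -- Counting with duplicate-free lists.

  sumOver : ∀ {A : Set} → (A → ℕ) → List A → ℕ
  sumOver h xs = sum (map h xs)

  sumOver-++ : ∀ {A : Set} (h : A → ℕ) xs ys → sumOver h (xs ++ ys) ≡ sumOver h xs + sumOver h ys
  sumOver-++ h [] ys = refl
  sumOver-++ h (x ∷ xs) ys = trans (cong (h x +_) (sumOver-++ h xs ys)) (sym (+-assoc (h x) _ _))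

  sumOver-mono : ∀ {A : Set} {h h′ : A → ℕ} xs → (∀ {x} → x ∈ xs → h x ≤ h′ x) → sumOver h xs ≤ sumOver h′ xs
  sumOver-mono [] le = z≤n
  sumOver-mono (x ∷ xs) le = +-mono-≤ (le (here refl)) (sumOver-mono xs (le ∘ there))

  sumOver-+ : ∀ {A : Set} (h h′ : A → ℕ) xs → sumOver (λ x → h x + h′ x) xs ≡ sumOver h xs + sumOver h′ xs
  sumOver-+ h h′ [] = refl
  sumOver-+ h h′ (x ∷ xs) = trans (cong (h x + h′ x +_) (sumOver-+ h h′ xs))
    (solve 4 (λ a b c d → a :+ b :+ (c :+ d) := a :+ c :+ (b :+ d)) refl (h x) (h′ x) _ _)
    where open +-*-Solver

  sumOver-const : ∀ {A : Set} c (xs : List A) → sumOver (λ _ → c) xs ≡ length xs * c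
  sumOver-const c [] = refl
  sumOver-const c (x ∷ xs) = cong (c +_) (sumOver-const c xs)

  -- A weighted pigeonhole principle: deleting one occurrence of the head of `xs` from `ys` leaves
  -- room for the tail, since no later entry equals that head.
  sumOver-⊆ : ∀ {A : Set} (h : A → ℕ) {xs ys : List A} → Unique xs → xs ⊆ ys → sumOver h xs ≤ sumOver h ys
  sumOver-⊆ h {[]} _ _ = z≤n
  sumOver-⊆ h {x ∷ xs} {ys} (x∉ ∷ u) sub with ∈-∃++ (sub (here refl))
  ... | as , bs , refl = begin
    h x + sumOver h xs           ≤⟨ +-monoʳ-≤ (h x) (sumOver-⊆ h u sub′) ⟩
    h x + sumOver h (as ++ bs)   ≡⟨ cong (h x +_) (sumOver-++ h as bs) ⟩
    h x + (sumOver h as + sumOver h bs)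
      ≡⟨ solve 3 (λ a b c → a :+ (b :+ c) := b :+ (a :+ c)) refl (h x) (sumOver h as) (sumOver h bs) ⟩
    sumOver h as + sumOver h (x ∷ bs) ≡⟨ sumOver-++ h as (x ∷ bs) ⟨
    sumOver h (as ++ x ∷ bs)     ∎
    where
    open ≤-Reasoning
    open +-*-Solver
    sub′ : xs ⊆ as ++ bs
    sub′ {y} y∈ with ∈-++⁻ as (sub (there y∈))
    ... | inj₁ p = ∈-++⁺ˡ p
    ... | inj₂ (here y≡x) = ⊥-elim (All.lookup x∉ y∈ (sym y≡x))
    ... | inj₂ (there p) = ∈-++⁺ʳ as p

  length≡sumOver : ∀ {A : Set} (xs : List A) → length xs ≡ sumOver (λ _ → 1) xs
  length≡sumOver xs = sym (trans (sumOver-const 1 xs) (*-identityʳ _))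

  length-⊆ : ∀ {A : Set} {xs ys : List A} → Unique xs → xs ⊆ ys → length xs ≤ length ys
  length-⊆ {_} {xs} {ys} u sub = subst₂ _≤_ (sym (length≡sumOver xs)) (sym (length≡sumOver ys)) (sumOver-⊆ _ u sub)

  length-concatMap≤ : ∀ {A B : Set} (f : A → List B) m xs → (∀ {x} → x ∈ xs → length (f x) ≤ m) →
    length (concatMap f xs) ≤ length xs * m
  length-concatMap≤ f m [] le = z≤n
  length-concatMap≤ f m (x ∷ xs) le = begin
    length (f x ++ concatMap f xs)           ≡⟨ length-++ (f x) ⟩
    length (f x) + length (concatMap f xs)   ≤⟨ +-mono-≤ (le (here refl)) (length-concatMap≤ f m xs (le ∘ there)) ⟩
    m + length xs * m                        ∎
    where open ≤-Reasoning

  length-concatMap≥ : ∀ {A B : Set} (f : A → List B) m xs → (∀ {x} → x ∈ xs → m ≤ length (f x)) →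
    length xs * m ≤ length (concatMap f xs)
  length-concatMap≥ f m [] le = z≤n
  length-concatMap≥ f m (x ∷ xs) le = begin
    m + length xs * m                        ≤⟨ +-mono-≤ (le (here refl)) (length-concatMap≥ f m xs (le ∘ there)) ⟩
    length (f x) + length (concatMap f xs)   ≡⟨ length-++ (f x) ⟨
    length (f x ++ concatMap f xs)           ∎
    where open ≤-Reasoning

  ∈-concatMap : ∀ {A B : Set} (f : A → List B) {xs x y} → x ∈ xs → y ∈ f x → y ∈ concatMap f xs
  ∈-concatMap f {x ∷ xs} (here refl) q = ∈-++⁺ˡ q
  ∈-concatMap f {x ∷ xs} (there p) q = ∈-++⁺ʳ (f x) (∈-concatMap f p q)

  ∈-concatMap⁻′ : ∀ {A B : Set} (f : A → List B) {xs y} → y ∈ concatMap f xs → ∃ λ x → x ∈ xs × y ∈ f x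
  ∈-concatMap⁻′ f {x ∷ xs} q with ∈-++⁻ (f x) q
  ... | inj₁ p = x , here refl , p
  ... | inj₂ p with ∈-concatMap⁻′ f p
  ... | x′ , x∈ , y∈ = x′ , there x∈ , y∈

  concatMap-unique : ∀ {A B : Set} (f : A → List B) (g : B → A) {xs} → Unique xs →
    (∀ x → Unique (f x)) → (∀ x {y} → y ∈ f x → g y ≡ x) → Unique (concatMap f xs)
  concatMap-unique f g [] uf inv = []
  concatMap-unique f g {x ∷ xs} (x∉ ∷ u) uf inv =
    Uniqueₚ.++⁺ (uf x) (concatMap-unique f g u uf inv)
      (λ (p , q) → let x′ , x′∈ , y∈ = ∈-concatMap⁻′ f q in
         All.lookup x∉ x′∈ (trans (sym (inv x p)) (inv x′ y∈)))

  allVec-unique : ∀ {A : Set} {xs : List A} → Unique xs → ∀ m → Unique (allVec xs m)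
  allVec-unique u zero = [] ∷ []
  allVec-unique {_} {xs} u (suc m) = concatMap-unique _ Vec.tail (allVec-unique u m)
    (λ v → Uniqueₚ.map⁺ (λ eq → proj₁ (Vecₚ.∷-injective eq)) u)
    (λ v {y} y∈ → let a , _ , eq = ∈-map⁻ (_∷ v) y∈ in cong Vec.tail eq)

  allVec-complete : ∀ {A : Set} {xs : List A} {m} (v : Vec A m) → (∀ i → lookup v i ∈ xs) → v ∈ allVec xs m
  allVec-complete [] _ = here refl
  allVec-complete (a ∷ v) h = ∈-concatMap _ (allVec-complete v (h ∘ suc)) (∈-map⁺ (_∷ v) (h zero))

  length-allVec : ∀ {A : Set} (xs : List A) m → length (allVec xs m) ≤ length xs ^ m
  length-allVec xs zero = ≤-refl
  length-allVec xs (suc m) = begin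
    length (allVec xs (suc m))           ≤⟨ length-concatMap≤ _ (length xs) (allVec xs m) (λ {v} _ → ≤-reflexive (length-map (_∷ v) xs)) ⟩
    length (allVec xs m) * length xs     ≤⟨ *-monoˡ-≤ (length xs) (length-allVec xs m) ⟩
    length xs ^ m * length xs            ≡⟨ *-comm (length xs ^ m) _ ⟩
    length xs ^ suc m                    ∎
    where open ≤-Reasoning

  bools-unique : Unique (true ∷ false ∷ [])
  bools-unique = ((λ ()) ∷ []) ∷ [] ∷ []

  bools-complete : ∀ b → b ∈ true ∷ false ∷ []
  bools-complete true = here refl
  bools-complete false = there (here refl)

  allPairs-unique : ∀ n → Unique (allPairs n)
  allPairs-unique n = concatMap-unique _ proj₁ (allVec-unique bools-unique n)
    (λ S → Uniqueₚ.map⁺ (λ eq → proj₂ (,-injective eq)) (allVec-unique (allVec-unique bools-unique n) n))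
    (λ S y∈ → let a , _ , eq = ∈-map⁻ (S ,_) y∈ in cong proj₁ eq)

  allPairs-complete : ∀ n (x : Vec Bool n × Vec (Vec Bool n) n) → x ∈ allPairs n
  allPairs-complete n (S , E) = ∈-concatMap _ (allVec-complete S (bools-complete ∘ lookup S))
    (∈-map⁺ (S ,_) (allVec-complete E (λ i → allVec-complete (lookup E i) (bools-complete ∘ lookup (lookup E i)))))

  filterᵗ : ∀ {A : Set} → (A → Bool) → List A → List A
  filterᵗ P = filter (λ x → P x Boolₚ.≟ true)

  count≡length : ∀ {A : Set} (P : A → Bool) xs → countᵇ P xs ≡ length (filterᵗ P xs)
  count≡length P [] = refl
  count≡length P (x ∷ xs) with P x
  ... | true = cong suc (count≡length P xs)
  ... | false = count≡length P xs

  ∈-filterᵗ⁺ : ∀ {A : Set} (P : A → Bool) {xs x} → x ∈ xs → P x ≡ true → x ∈ filterᵗ P xs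
  ∈-filterᵗ⁺ P = ∈-filter⁺ (λ x → P x Boolₚ.≟ true)

  ∈-filterᵗ⁻ : ∀ {A : Set} (P : A → Bool) {xs x} → x ∈ filterᵗ P xs → x ∈ xs × P x ≡ true
  ∈-filterᵗ⁻ P {xs} = ∈-filter⁻ (λ x → P x Boolₚ.≟ true) {xs = xs}

  filterᵗ-unique : ∀ {A : Set} (P : A → Bool) {xs} → Unique xs → Unique (filterᵗ P xs)
  filterᵗ-unique P = Uniqueₚ.filter⁺ (λ x → P x Boolₚ.≟ true)

  -- Unordered selections and factorial estimates.

  module _ {A : Set} where

    combs : ℕ → List A → List (List A)
    combs zero xs = [ [] ]
    combs (suc g) [] = []
    combs (suc g) (x ∷ xs) = map (x ∷_) (combs g xs) ++ combs (suc g) xs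

    filter∈combs : ∀ {P : Pred A 0ℓ} (P? : Decidable P) xs → filter P? xs ∈ combs (length (filter P? xs)) xs
    filter∈combs P? [] = here refl
    filter∈combs P? (x ∷ xs) with does (P? x)
    ... | true = ∈-++⁺ˡ (∈-map⁺ (x ∷_) (filter∈combs P? xs))
    ... | false = skip (filter P? xs) (filter∈combs P? xs)
      where
      skip : ∀ ys → ys ∈ combs (length ys) xs → ys ∈ combs (length ys) (x ∷ xs)
      skip [] m = here refl
      skip (y ∷ ys) m = ∈-++⁺ʳ (map (x ∷_) (combs (length ys) xs)) m

    -- Filtering `xs` by membership in `ys` puts `ys` into the order of `xs`. Every set of g entries
    -- thus has a representative in `combs g xs`, and choosing a set costs a binomial coefficient
    -- instead of |xs|^g.
    combs-cover : DecidableEquality A → ∀ {xs ys : List A} → Unique xs → Unique ys → ys ⊆ xs →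
      ∃ λ c → c ∈ combs (length ys) xs × c ⊆ ys × ys ⊆ c
    combs-cover _≟_ {xs} {ys} ux uy sub = c , subst (λ g → c ∈ combs g xs) len (filter∈combs in? xs) , c⊆ , ⊆c
      where
      open import Data.List.Membership.DecPropositional _≟_ using (_∈?_)
      in? = λ x → x ∈? ys
      c = filter in? xs
      c⊆ : c ⊆ ys
      c⊆ m = proj₂ (∈-filter⁻ in? {xs = xs} m)
      ⊆c : ys ⊆ c
      ⊆c m = ∈-filter⁺ in? (sub m) m
      len : length c ≡ length ys
      len = ≤-antisym (length-⊆ (Uniqueₚ.filter⁺ in? ux) c⊆) (length-⊆ uy ⊆c)

    sublists : List A → List (List A)
    sublists [] = [ [] ]
    sublists (x ∷ xs) = map (x ∷_) (sublists xs) ++ sublists xs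

    length-sublists : ∀ xs → length (sublists xs) ≡ 2 ^ length xs
    length-sublists [] = refl
    length-sublists (x ∷ xs) = trans (length-++ (map (x ∷_) (sublists xs)))
      (cong₂ _+_ (trans (length-map _ (sublists xs)) (length-sublists xs)) (trans (length-sublists xs) (sym (+-identityʳ _))))

    filter∈sublists : ∀ {P : Pred A 0ℓ} (P? : Decidable P) xs → filter P? xs ∈ sublists xs
    filter∈sublists P? [] = here refl
    filter∈sublists P? (x ∷ xs) with does (P? x)
    ... | true = ∈-++⁺ˡ (∈-map⁺ (x ∷_) (filter∈sublists P? xs))
    ... | false = ∈-++⁺ʳ (map (x ∷_) (sublists xs)) (filter∈sublists P? xs)

  ^-distribʳ-* : ∀ k a b → (a * b) ^ k ≡ a ^ k * b ^ k
  ^-distribʳ-* zero a b = refl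
  ^-distribʳ-* (suc k) a b = trans (cong (a * b *_) (^-distribʳ-* k a b))
    (solve 4 (λ a b x y → a :* b :* (x :* y) := a :* x :* (b :* y)) refl a b (a ^ k) (b ^ k))
    where open +-*-Solver

  bernoulli-step : ∀ m g → suc g * m ^ g + m ^ suc g ≤ suc m ^ suc g
  bernoulli-step m zero = ≤-reflexive (solve 1 (λ m → con 1 :* con 1 :+ m :* con 1 := (con 1 :+ m) :* con 1) refl m)
    where open +-*-Solver
  bernoulli-step m (suc g) = begin
    suc (suc g) * m ^ suc g + m ^ suc (suc g)
      ≡⟨ solve 3 (λ m g a → (con 2 :+ g) :* (m :* a) :+ m :* (m :* a) := m :* ((con 1 :+ g) :* a :+ m :* a) :+ m :* a) refl m g (m ^ g) ⟩
    m * (suc g * m ^ g + m ^ suc g) + m ^ suc g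
      ≤⟨ +-mono-≤ (*-monoʳ-≤ m (bernoulli-step m g)) (^-monoˡ-≤ (suc g) (n≤1+n m)) ⟩
    m * suc m ^ suc g + suc m ^ suc g
      ≡⟨ +-comm (m * suc m ^ suc g) _ ⟩
    suc m ^ suc (suc g) ∎
    where
    open ≤-Reasoning
    open +-*-Solver

  -- The recursion of `combs` is Pascal's rule; `bernoulli-step`, the two leading terms of (m +
  -- 1)^(g + 1), closes the induction. The sparsity arguments live on the factor g! gained here.
  length-combs : ∀ {A : Set} g (xs : List A) → length (combs g xs) * g ! ≤ length xs ^ g
  length-combs zero xs = ≤-refl
  length-combs (suc g) [] = z≤n
  length-combs (suc g) (x ∷ xs) = begin
    length (map (x ∷_) (combs g xs) ++ combs (suc g) xs) * suc g !
      ≡⟨ cong (_* suc g !) (trans (length-++ (map (x ∷_) (combs g xs))) (cong (_+ c′) (length-map _ (combs g xs)))) ⟩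
    (c + c′) * (suc g * g !)
      ≡⟨ solve 4 (λ c c′ s f → (c :+ c′) :* (s :* f) := s :* (c :* f) :+ c′ :* (s :* f)) refl c c′ (suc g) (g !) ⟩
    suc g * (c * g !) + c′ * suc g !
      ≤⟨ +-mono-≤ (*-monoʳ-≤ (suc g) (length-combs g xs)) (length-combs (suc g) xs) ⟩
    suc g * length xs ^ g + length xs ^ suc g
      ≤⟨ bernoulli-step (length xs) g ⟩
    suc (length xs) ^ suc g ∎
    where
    open ≤-Reasoning
    open +-*-Solver
    c = length (combs g xs)
    c′ = length (combs (suc g) xs)

  rising : ℕ → ℕ → ℕ
  rising m zero = 1
  rising m (suc a) = m * rising (suc m) a

  ^≤rising : ∀ m a → m ^ a ≤ rising m a
  ^≤rising m zero = ≤-refl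
  ^≤rising m (suc a) = *-monoʳ-≤ m (≤-trans (^-monoˡ-≤ a (n≤1+n m)) (^≤rising (suc m) a))

  rising-last : ∀ m a → rising m (suc a) ≡ (m + a) * rising m a
  rising-last m zero = solve 1 (λ m → m :* con 1 := (m :+ con 0) :* con 1) refl m
    where open +-*-Solver
  rising-last m (suc a) = trans (cong (m *_) (rising-last (suc m) a))
    (solve 3 (λ m a r → m :* ((con 1 :+ m :+ a) :* r) := (m :+ (con 1 :+ a)) :* (m :* r)) refl m a (rising (suc m) a))
    where open +-*-Solver

  -- `rising m a` is a! times the number of multisets of size a from m elements. Splitting the last
  -- factor into m and a + 1 is Pascal's rule for these numbers, and each of the two terms takes
  -- half of the power of 2.
  rising≤ : ∀ m a → rising m a ≤ a ! * 2 ^ (m + a)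
  rising≤ m zero = ≤-trans (m^n>0 2 (m + 0)) (≤-reflexive (sym (*-identityˡ _)))
  rising≤ zero (suc a) = z≤n
  rising≤ (suc m) (suc a) = begin
    rising (suc m) (suc a)
      ≡⟨ rising-last (suc m) a ⟩
    (suc m + a) * r
      ≡⟨ solve 3 (λ m a r → (con 1 :+ m :+ a) :* r := m :* r :+ (con 1 :+ a) :* r) refl m a r ⟩
    rising m (suc a) + suc a * r
      ≤⟨ +-mono-≤ (rising≤ m (suc a)) (*-monoʳ-≤ (suc a) (rising≤ (suc m) a)) ⟩
    suc a ! * 2 ^ (m + suc a) + suc a * (a ! * 2 ^ (suc m + a))
      ≡⟨ cong₂ _+_ refl (trans (sym (*-assoc (suc a) (a !) _)) (cong (λ e → suc a ! * 2 ^ e) (sym (+-suc m a)))) ⟩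
    suc a ! * 2 ^ (m + suc a) + suc a ! * 2 ^ (m + suc a)
      ≡⟨ solve 2 (λ f t → f :* t :+ f :* t := f :* (con 2 :* t)) refl (suc a !) (2 ^ (m + suc a)) ⟩
    suc a ! * 2 ^ (suc m + suc a) ∎
    where
    open ≤-Reasoning
    open +-*-Solver
    r = rising (suc m) a

  -- This replaces both Stirling's formula and the exponential series. For a = m it reads m^m ≤ m!
  -- 4^m; for fixed m it bounds m^a / a! by 2^m up to the factor 2^a.
  ^≤!*2^ : ∀ m a → m ^ a ≤ a ! * 2 ^ (m + a)
  ^≤!*2^ m a = ≤-trans (^≤rising m a) (rising≤ m a)

  -- Coding walks by their total number of candidates.

  -- The choices of a walk are read Y at a time: either the next vertex is among the
  -- first Y candidates, or these are discarded at the expense of one unit of the budget b.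
  module Walks {A : Set} (nb : List A → List A) (Y : ℕ) where

    walks : List A → List A → ℕ → ℕ → List (List A)
    walks hist cs zero b = [ [] ]
    walks hist cs (suc j) zero = []
    walks hist cs (suc j) (suc b) =
      concatMap (λ v → map (v ∷_) (walks (v ∷ hist) (nb (v ∷ hist)) j (suc b))) (take Y cs)
        ++ walks hist (drop Y cs) (suc j) b

    Fits : List A → List A → List A → Set
    Fits hist cs [] = ⊤
    Fits hist cs (v ∷ vs) = v ∈ cs × Fits (v ∷ hist) (nb (v ∷ hist)) vs

    cost : List A → List A → List A → ℕ
    cost hist cs [] = 0
    cost hist cs (v ∷ vs) = length cs + cost (v ∷ hist) (nb (v ∷ hist)) vs

    -- Both branches lower j + b by one: accepting keeps the budget and shortens the walk,
    -- discarding does the opposite. So 2^(j + b) counts the patterns of accepting and discarding,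
    -- and Y^j the choices made on accepting.
    length-walks : ∀ hist cs j b → length (walks hist cs j b) ≤ Y ^ j * 2 ^ (j + b)
    length-walks hist cs zero b = ≤-trans (m^n>0 2 b) (≤-reflexive (sym (*-identityˡ _)))
    length-walks hist cs (suc j) zero = z≤n
    length-walks hist cs (suc j) (suc b) = begin
      length (concatMap f (take Y cs) ++ walks hist (drop Y cs) (suc j) b)
        ≡⟨ length-++ (concatMap f (take Y cs)) ⟩
      length (concatMap f (take Y cs)) + length (walks hist (drop Y cs) (suc j) b)
        ≤⟨ +-mono-≤ (length-concatMap≤ f m (take Y cs) (λ {v} _ → ≤-trans (≤-reflexive (length-map {B = List A} (v ∷_) (walks (v ∷ hist) _ j (suc b)))) (length-walks (v ∷ hist) _ j (suc b))))
                    (length-walks hist (drop Y cs) (suc j) b) ⟩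
      length (take Y cs) * m + Y ^ suc j * 2 ^ (suc j + b)
        ≤⟨ +-monoˡ-≤ _ (*-monoˡ-≤ m (≤-trans (≤-reflexive (length-take Y cs)) (m⊓n≤m Y _))) ⟩
      Y * (Y ^ j * 2 ^ (j + suc b)) + Y ^ suc j * 2 ^ (suc j + b)
        ≡⟨ cong (λ e → Y * (Y ^ j * 2 ^ e) + Y ^ suc j * 2 ^ (suc j + b)) (+-suc j b) ⟩
      Y * (Y ^ j * 2 ^ suc (j + b)) + Y ^ suc j * 2 ^ (suc j + b)
        ≡⟨ solve 3 (λ y p t → y :* (p :* t) :+ y :* p :* t := y :* p :* (con 2 :* t)) refl Y (Y ^ j) (2 ^ suc (j + b)) ⟩
      Y ^ suc j * 2 ^ (2 + (j + b))
        ≡⟨ cong (λ e → Y ^ suc j * 2 ^ suc e) (sym (+-suc j b)) ⟩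
      Y ^ suc j * 2 ^ (suc j + suc b) ∎
      where
      open ≤-Reasoning
      open +-*-Solver
      m = Y ^ j * 2 ^ (j + suc b)
      f = λ v → map (v ∷_) (walks (v ∷ hist) (nb (v ∷ hist)) j (suc b))

    -- A discard is needed only if the next vertex lies beyond the first `Y` candidates; it then
    -- removes exactly `Y` from the cost. Hence the number of discards along the walk is at most the
    -- cost divided by `Y`.
    walks-cover : ∀ hist cs vs b → Fits hist cs vs → cost hist cs vs ≤ Y * b → vs ∈ walks hist cs (length vs) b
    walks-cover hist cs [] b _ _ = here refl
    walks-cover hist cs (v ∷ vs) zero (v∈ , _) c≤ = ⊥-elim (n≮0 (≤-trans (∈-length v∈)
      (≤-trans (m≤m+n (length cs) _) (≤-trans c≤ (≤-reflexive (*-zeroʳ Y))))))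
    walks-cover hist cs (v ∷ vs) (suc b) (v∈ , fits) c≤ =
      [ (λ v∈take → ∈-++⁺ˡ (∈-concatMap _ v∈take (∈-map⁺ (v ∷_)
            (walks-cover (v ∷ hist) _ vs (suc b) fits (≤-trans (m≤n+m _ (length cs)) c≤)))))
      , (λ v∈drop → ∈-++⁺ʳ _ (walks-cover hist (drop Y cs) (v ∷ vs) b (v∈drop , fits)
            (+-cancelˡ-≤ Y _ _ (begin
              Y + (length (drop Y cs) + c)   ≡⟨ cong (λ l → Y + (l + c)) (length-drop Y cs) ⟩
              Y + (length cs ∸ Y + c)        ≡⟨ +-assoc Y (length cs ∸ Y) c ⟨
              Y + (length cs ∸ Y) + c        ≡⟨ cong (_+ c) (m+[n∸m]≡n (Y≤ v∈drop)) ⟩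
              length cs + c                  ≤⟨ c≤ ⟩
              Y * suc b                      ≡⟨ *-suc Y b ⟩
              Y + Y * b                      ∎))))
      ]′ (∈-++⁻ (take Y cs) (subst (v ∈_) (sym (take++drop≡id Y cs)) v∈))
      where
      open ≤-Reasoning
      c = cost (v ∷ hist) (nb (v ∷ hist)) vs
      Y≤ : v ∈ drop Y cs → Y ≤ length cs
      Y≤ v∈drop = <⇒≤ (m∸n≢0⇒n<m (λ eq → n≮0 (subst (0 <_) (trans (length-drop Y cs) eq) (∈-length v∈drop))))

  -- Reading the Boolean definitions: subgraphs, isomorphisms, copies.

  and-map⁻ : ∀ {A : Set} (P : A → Bool) {xs} → and (map P xs) ≡ true → ∀ {x} → x ∈ xs → P x ≡ true
  and-map⁻ P {y ∷ xs} eq m with P y in Py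
  and-map⁻ P {y ∷ xs} eq (here refl) | true = Py
  and-map⁻ P {y ∷ xs} eq (there m) | true = and-map⁻ P eq m

  and-map⁺ : ∀ {A : Set} (P : A → Bool) xs → (∀ {x} → x ∈ xs → P x ≡ true) → and (map P xs) ≡ true
  and-map⁺ P [] h = refl
  and-map⁺ P (y ∷ xs) h rewrite h (here refl) = and-map⁺ P xs (h ∘ there)

  or-map⁻ : ∀ {A : Set} (P : A → Bool) xs → or (map P xs) ≡ true → ∃ λ x → x ∈ xs × P x ≡ true
  or-map⁻ P (y ∷ xs) eq with P y in Py
  ... | true = y , here refl , Py
  ... | false with or-map⁻ P xs eq
  ... | x , m , Px = x , there m , Px

  or-map⁺ : ∀ {A : Set} (P : A → Bool) {xs x} → x ∈ xs → P x ≡ true → or (map P xs) ≡ true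
  or-map⁺ P (here refl) Px rewrite Px = refl
  or-map⁺ P {y ∷ xs} (there m) Px with P y
  ... | true = refl
  ... | false = or-map⁺ P m Px

  ∧-true⁻ : ∀ {a b} → a ∧ b ≡ true → a ≡ true × b ≡ true
  ∧-true⁻ {true} {true} _ = refl , refl

  ⇒ᵇ-true⁻ : ∀ {a b} → (a ⇒ᵇ b) ≡ true → a ≡ true → b ≡ true
  ⇒ᵇ-true⁻ {true} {true} _ _ = refl

  ⇒ᵇ-true⁺ : ∀ {a b} → (a ≡ true → b ≡ true) → (a ⇒ᵇ b) ≡ true
  ⇒ᵇ-true⁺ {true} h = h refl
  ⇒ᵇ-true⁺ {false} h = refl

  ⇔ᵇ-true⁻ : ∀ {a b} → (a ⇔ᵇ b) ≡ true → a ≡ b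
  ⇔ᵇ-true⁻ {true} {true} _ = refl
  ⇔ᵇ-true⁻ {false} {false} _ = refl

  ⇔ᵇ-true⁺ : ∀ {a b} → a ≡ b → (a ⇔ᵇ b) ≡ true
  ⇔ᵇ-true⁺ {true} refl = refl
  ⇔ᵇ-true⁺ {false} refl = refl

  true-ext : ∀ {a b : Bool} → (a ≡ true → b ≡ true) → (b ≡ true → a ≡ true) → a ≡ b
  true-ext {true} f g = sym (f refl)
  true-ext {false} {true} f g = g refl
  true-ext {false} {false} f g = refl

  does-true⁻ : ∀ {A : Set} (d : Dec A) → does d ≡ true → A
  does-true⁻ (yes a) _ = a

  ==⁺ : ∀ {n} {i j : Fin n} → i ≡ j → (i == j) ≡ true
  ==⁺ {i = i} {j} eq with i Finₚ.≟ j
  ... | yes _ = refl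
  ... | no ¬eq = ⊥-elim (¬eq eq)

  ==⁻ : ∀ {n} {i j : Fin n} → (i == j) ≡ true → i ≡ j
  ==⁻ {i = i} {j} e with i Finₚ.≟ j
  ... | yes eq = eq

  allF⁻ : ∀ {n} (P : Fin n → Bool) → allF n P ≡ true → ∀ i → P i ≡ true
  allF⁻ {n} P eq i = and-map⁻ P {allFin n} eq (∈-allFin i)

  allF⁺ : ∀ {n} (P : Fin n → Bool) → (∀ i → P i ≡ true) → allF n P ≡ true
  allF⁺ {n} P h = and-map⁺ P (allFin n) (λ {x} _ → h x)

  anyF⁻ : ∀ {n} (P : Fin n → Bool) → anyF n P ≡ true → ∃ λ i → P i ≡ true
  anyF⁻ {n} P eq with or-map⁻ P (allFin n) eq
  ... | x , _ , Px = x , Px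

  anyF⁺ : ∀ {n} (P : Fin n → Bool) i → P i ≡ true → anyF n P ≡ true
  anyF⁺ {n} P i = or-map⁺ P {allFin n} (∈-allFin i)

  record Subgraph {n} (G : Graph n) (S : VSet n) (E : ESet n) : Set where
    field
      E-sym   : ∀ i j → E i j ≡ E j i
      E-irref : ∀ i → E i i ≡ false
      E-adj   : ∀ {i j} → E i j ≡ true → adj G i j ≡ true
      E-S     : ∀ {i j} → E i j ≡ true → S i ≡ true
  open Subgraph public

  isSubgraph⁻ : ∀ {n} {G : Graph n} {S E} → isSubgraph G S E ≡ true → Subgraph G S E
  isSubgraph⁻ {n} {G} {S} {E} eq = record
    { E-sym = λ i j → ⇔ᵇ-true⁻ (proj₁ (∧-true⁻ (proj₁ (∧-true⁻ (at i j)))))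
    ; E-irref = λ i → not-true (proj₂ (∧-true⁻ {E i i ⇔ᵇ E i i} (proj₁ (∧-true⁻ (at i i)))))
    ; E-adj = λ {i} {j} e → proj₁ (∧-true⁻ {adj G i j} (⇒ᵇ-true⁻ (proj₂ (∧-true⁻ (at i j))) e))
    ; E-S = λ {i} {j} e → proj₁ (∧-true⁻ (proj₂ (∧-true⁻ {adj G i j} (⇒ᵇ-true⁻ (proj₂ (∧-true⁻ (at i j))) e))))
    }
    where
    at : ∀ i j → ((E i j ⇔ᵇ E j i) ∧ not (E i i)) ∧ (E i j ⇒ᵇ (adj G i j ∧ (S i ∧ S j))) ≡ true
    at i j = allF⁻ _ (allF⁻ _ eq i) j
    not-true : ∀ {a} → not a ≡ true → a ≡ false
    not-true {false} _ = refl

  isSubgraph⁺ : ∀ {n} {G : Graph n} {S E} → Subgraph G S E → isSubgraph G S E ≡ true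
  isSubgraph⁺ {n} {G} {S} {E} s = allF⁺ _ (λ i → allF⁺ _ (λ j → at i j))
    where
    at : ∀ i j → ((E i j ⇔ᵇ E j i) ∧ not (E i i)) ∧ (E i j ⇒ᵇ (adj G i j ∧ (S i ∧ S j))) ≡ true
    at i j rewrite ⇔ᵇ-true⁺ (E-sym s i j) | E-irref s i = ⇒ᵇ-true⁺ λ e →
      cong₂ _∧_ (E-adj s e) (cong₂ _∧_ (E-S s e) (E-S s (trans (E-sym s j i) e)))

  record Iso {n m} (S : VSet n) (E : ESet n) (F : ESet m) (f : Fin m → Fin n) : Set where
    field
      f-inj  : ∀ {i j} → f i ≡ f j → i ≡ j
      f-edge : ∀ i j → F i j ≡ E (f i) (f j)
      f-onto : ∀ {v} → S v ≡ true → ∃ λ i → f i ≡ v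
      f-in   : ∀ i → S (f i) ≡ true
  open Iso public

  isIso⁻ : ∀ {n m} {S : VSet n} {E : ESet n} {F : ESet m} → isIso S E full F ≡ true →
    ∃ λ (f : Vec (Fin n) m) → Iso S E F (lookup f)
  isIso⁻ {n} {m} {S} {E} {F} eq with or-map⁻ _ (allVec (allFin n) m) eq
  ... | fv , _ , via = fv , record
    { f-inj = λ {i} {j} eq → ==⁻ (⇒ᵇ-true⁻ (proj₁ (∧-true⁻ {(f i == f j) ⇒ᵇ (i == j)} (at i j))) (==⁺ eq))
    ; f-edge = λ i j → ⇔ᵇ-true⁻ (proj₂ (∧-true⁻ {(f i == f j) ⇒ᵇ (i == j)} (at i j)))
    ; f-onto = λ {v} e → let i , h = anyF⁻ _ (trans (sym (⇔ᵇ-true⁻ (allF⁻ _ (proj₂ both) v))) e) in i , ==⁻ h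
    ; f-in = λ i → trans (⇔ᵇ-true⁻ (allF⁻ _ (proj₂ both) (f i))) (anyF⁺ _ i (==⁺ {i = f i} refl))
    }
    where
    f = lookup fv
    both = ∧-true⁻ {allF m λ i → allF m λ j → (((f i == f j) ⇒ᵇ (i == j)) ∧ (F i j ⇔ᵇ E (f i) (f j)))} via
    at : ∀ i j → ((f i == f j) ⇒ᵇ (i == j)) ∧ (F i j ⇔ᵇ E (f i) (f j)) ≡ true
    at i j = allF⁻ _ (allF⁻ _ (proj₁ both) i) j

  isIso⁺ : ∀ {n m} {S : VSet n} {E : ESet n} {F : ESet m} (f : Vec (Fin n) m) → Iso S E F (lookup f) →
    isIso S E full F ≡ true
  isIso⁺ {n} {m} {S} {E} {F} fv iso = or-map⁺ _ (allVec-complete fv (λ i → ∈-allFin _))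
    (cong₂ _∧_
      (allF⁺ _ λ i → allF⁺ _ λ j → cong₂ _∧_
        (⇒ᵇ-true⁺ {f i == f j} λ e → ==⁺ (f-inj iso (==⁻ e)))
        (⇔ᵇ-true⁺ (f-edge iso i j)))
      (allF⁺ _ λ v → ⇔ᵇ-true⁺ {S v} (true-ext
        (λ e → let i , eq = f-onto iso e in anyF⁺ (λ i → f i == v) i (==⁺ eq))
        (λ e → let i , h = anyF⁻ (λ i → f i == v) e in subst (λ w → S w ≡ true) (==⁻ h) (f-in iso i)))))
    where f = lookup fv

  count≤length : ∀ {A : Set} (P : A → Bool) {xs Z} → Unique xs → (∀ {x} → P x ≡ true → x ∈ Z) → countᵇ P xs ≤ length Z
  count≤length P {xs} u h = ≤-trans (≤-reflexive (count≡length P xs))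
    (length-⊆ (filterᵗ-unique P u) (λ m → h (proj₂ (∈-filterᵗ⁻ P {xs} m))))

  counted : ∀ {A : Set} (P : A → Bool) xs →
    ∃ λ cs → length cs ≡ countᵇ P xs × (∀ {x} → x ∈ cs → P x ≡ true) × (∀ {x} → x ∈ xs → P x ≡ true → x ∈ cs)
  counted P xs = filterᵗ P xs , sym (count≡length P xs) , (λ m → proj₂ (∈-filterᵗ⁻ P {xs} m)) , ∈-filterᵗ⁺ P

  toVecs : ∀ {n} → VSet n × ESet n → Vec Bool n × Vec (Vec Bool n) n
  toVecs (S , E) = Vec.tabulate S , Vec.tabulate (λ i → Vec.tabulate (E i))

  toVecs-ext : ∀ {n} (z : VSet n × ESet n) (S : Vec Bool n) (E : Vec (Vec Bool n) n) →
    (∀ i → proj₁ z i ≡ lookup S i) → (∀ i j → proj₂ z i j ≡ lookup (lookup E i) j) → (S , E) ≡ toVecs z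
  toVecs-ext z S E hS hE = sym (cong₂ _,_
    (trans (Vecₚ.tabulate-cong hS) (Vecₚ.tabulate∘lookup S))
    (trans (Vecₚ.tabulate-cong (λ i → trans (Vecₚ.tabulate-cong (hE i)) (Vecₚ.tabulate∘lookup (lookup E i)))) (Vecₚ.tabulate∘lookup E)))

  -- Copies in `Z` are given by functions, so agreement is asked pointwise; `toVecs` turns it into
  -- equality of the tabulated pairs that `N` counts.
  N≤length : ∀ {n m} (G : Graph n) (F : ESet m) (Z : List (VSet n × ESet n)) →
    (∀ S E (f : Vec (Fin n) m) → Subgraph G S E → Iso S E F (lookup f) →
      ∃ λ z → z ∈ Z × (∀ i → proj₁ z i ≡ S i) × (∀ i j → proj₂ z i j ≡ E i j)) →
    N G full F ≤ length Z
  N≤length {n} G F Z h = ≤-trans (count≤length _ (allPairs-unique n) cover) (≤-reflexive (length-map toVecs Z))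
    where
    cover : ∀ {x : Vec Bool n × Vec (Vec Bool n) n} →
      isSubgraph G (lookup (proj₁ x)) (λ i j → lookup (lookup (proj₂ x) i) j)
        ∧ isIso (lookup (proj₁ x)) (λ i j → lookup (lookup (proj₂ x) i) j) full F ≡ true → x ∈ map toVecs Z
    cover {S , E} eq with ∧-true⁻ eq
    ... | sub , iso with isIso⁻ iso
    ... | f , i with h _ _ f (isSubgraph⁻ {G = G} sub) i
    ... | z , z∈ , hS , hE = subst (_∈ map toVecs Z) (sym (toVecs-ext z S E hS hE)) (∈-map⁺ toVecs z∈)

  copies : ∀ {n m} (G : Graph n) (F : ESet m) →
    ∃ λ (cs : List (Vec Bool n × Vec (Vec Bool n) n)) → length cs ≡ N G full F ×
      (∀ {x} → x ∈ cs → ∃ λ (f : Vec (Fin n) m) →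
        Subgraph G (lookup (proj₁ x)) (λ i j → lookup (lookup (proj₂ x) i) j) ×
        Iso (lookup (proj₁ x)) (λ i j → lookup (lookup (proj₂ x) i) j) F (lookup f)) ×
      (∀ S E (f : Vec (Fin n) m) → Subgraph G S E → Iso S E F (lookup f) → toVecs (S , E) ∈ cs)
  copies {n} {m} G F with counted _ (allPairs n)
  ... | cs , len , sound , complete = cs , len , snd , λ S E f sub iso → complete (allPairs-complete n _)
    (cong₂ _∧_ (isSubgraph⁺ {G = G} (transferˢ S E sub)) (isIso⁺ f (transferⁱ S E f iso)))
    where
    snd : ∀ {x} → x ∈ cs → _
    snd {S , E} x∈ with ∧-true⁻ (sound x∈)
    ... | sub , iso with isIso⁻ iso
    ... | f , i = f , isSubgraph⁻ {G = G} sub , i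
    module _ (S : VSet n) (E : ESet n) where
      eqS : ∀ i → lookup (Vec.tabulate S) i ≡ S i
      eqS = Vecₚ.lookup∘tabulate S
      eqE : ∀ i j → lookup (lookup (Vec.tabulate (λ i → Vec.tabulate (E i))) i) j ≡ E i j
      eqE i j = trans (cong (λ r → lookup r j) (Vecₚ.lookup∘tabulate (λ i → Vec.tabulate (E i)) i)) (Vecₚ.lookup∘tabulate (E i) j)
      transferˢ : Subgraph G S E → Subgraph G (lookup (Vec.tabulate S)) (λ i j → lookup (lookup (Vec.tabulate (λ i → Vec.tabulate (E i))) i) j)
      transferˢ s = record
        { E-sym = λ i j → trans (eqE i j) (trans (E-sym s i j) (sym (eqE j i)))
        ; E-irref = λ i → trans (eqE i i) (E-irref s i)
        ; E-adj = λ {i} {j} e → E-adj s (trans (sym (eqE i j)) e)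
        ; E-S = λ {i} {j} e → trans (eqS i) (E-S s (trans (sym (eqE i j)) e)) }
      transferⁱ : ∀ f → Iso S E F (lookup f) → Iso (lookup (Vec.tabulate S)) (λ i j → lookup (lookup (Vec.tabulate (λ i → Vec.tabulate (E i))) i) j) F (lookup f)
      transferⁱ f s = record
        { f-inj = f-inj s
        ; f-edge = λ i j → trans (f-edge s i j) (sym (eqE _ _))
        ; f-onto = λ {v} e → f-onto s (trans (sym (eqS v)) e)
        ; f-in = λ i → trans (eqS _) (f-in s i) }

  -- Normalised edges, edge lists and coded images.

  -- An unordered pair is stored with its smaller endpoint first.
  Edge : ℕ → Set
  Edge n = Fin n × Fin n

  module _ {n : ℕ} where

    norm : Fin n → Fin n → Edge n
    norm i j = if does (i Finₚ.<? j) then (i , j) else (j , i)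

    norm-cases : ∀ i j → norm i j ≡ (i , j) ⊎ norm i j ≡ (j , i)
    norm-cases i j with does (i Finₚ.<? j)
    ... | true = inj₁ refl
    ... | false = inj₂ refl

    norm-< : ∀ {i j} → i Fin.< j → norm i j ≡ (i , j)
    norm-< {i} {j} lt rewrite dec-true (i Finₚ.<? j) lt = refl

    norm-≮ : ∀ {i j} → ¬ (i Fin.< j) → norm i j ≡ (j , i)
    norm-≮ {i} {j} ¬lt rewrite dec-false (i Finₚ.<? j) ¬lt = refl

    norm-comm : ∀ i j → norm i j ≡ norm j i
    norm-comm i j with <-cmp (toℕ i) (toℕ j)
    ... | tri< lt _ ≯ = trans (norm-< lt) (sym (norm-≮ ≯))
    ... | tri> ≮ _ gt = trans (norm-≮ ≮) (sym (norm-< gt))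
    ... | tri≈ _ eq _ with Finₚ.toℕ-injective eq
    ... | refl = refl

    norm-inj : ∀ {i j a b} → norm i j ≡ norm a b → (i ≡ a × j ≡ b) ⊎ (i ≡ b × j ≡ a)
    norm-inj {i} {j} {a} {b} eq with norm-cases i j | norm-cases a b
    ... | inj₁ p | inj₁ q = inj₁ (,-injective (trans (sym p) (trans eq q)))
    ... | inj₁ p | inj₂ q = inj₂ (,-injective (trans (sym p) (trans eq q)))
    ... | inj₂ p | inj₁ q = let x , y = ,-injective (trans (sym p) (trans eq q)) in inj₂ (y , x)
    ... | inj₂ p | inj₂ q = let x , y = ,-injective (trans (sym p) (trans eq q)) in inj₁ (y , x)

    norm-ordered : ∀ {i j} → i ≢ j → proj₁ (norm i j) Fin.< proj₂ (norm i j)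
    norm-ordered {i} {j} i≢j with <-cmp (toℕ i) (toℕ j)
    ... | tri< lt _ _ = subst (λ e → proj₁ e Fin.< proj₂ e) (sym (norm-< lt)) lt
    ... | tri> ≮ _ gt = subst (λ e → proj₁ e Fin.< proj₂ e) (sym (norm-≮ ≮)) gt
    ... | tri≈ _ eq _ = ⊥-elim (i≢j (Finₚ.toℕ-injective eq))

    norm-adj : ∀ (G : Graph n) {i j} → adj G i j ≡ true → adj G (proj₁ (norm i j)) (proj₂ (norm i j)) ≡ true
    norm-adj G {i} {j} e with norm-cases i j
    ... | inj₁ p rewrite p = e
    ... | inj₂ p rewrite p = trans (Graph.sym G j i) e

    _≟ᵉ_ : DecidableEquality (Edge n)
    _≟ᵉ_ = ≡-dec Finₚ._≟_ Finₚ._≟_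

    open import Data.List.Membership.DecPropositional _≟ᵉ_ public using () renaming (_∈?_ to _∈ᵉ?_)
    open import Data.List.Membership.DecPropositional (Finₚ._≟_ {n}) public using () renaming (_∈?_ to _∈ᵛ?_)

    closure : List (Edge n) → ESet n
    closure es i j = does (norm i j ∈ᵉ? es)

    memb : List (Fin n) → VSet n
    memb vs v = does (v ∈ᵛ? vs)

  _≈ˢ_ : ∀ {A : Set} → List A → List A → Set
  xs ≈ˢ ys = xs ⊆ ys × ys ⊆ xs

  ≈ˢ-sym : ∀ {A : Set} {xs ys : List A} → xs ≈ˢ ys → ys ≈ˢ xs
  ≈ˢ-sym (a , b) = b , a

  ≈ˢ-trans : ∀ {A : Set} {xs ys zs : List A} → xs ≈ˢ ys → ys ≈ˢ zs → xs ≈ˢ zs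
  ≈ˢ-trans (a , b) (c , d) = (λ m → c (a m)) , (λ m → b (d m))

  ≈ˢ-++ : ∀ {A : Set} {xs ys xs′ ys′ : List A} → xs ≈ˢ xs′ → ys ≈ˢ ys′ → (xs ++ ys) ≈ˢ (xs′ ++ ys′)
  ≈ˢ-++ {A} (a , b) (c , d) = go a c , go b d
    where
    go : ∀ {xs ys xs′ ys′ : List A} → xs ⊆ xs′ → ys ⊆ ys′ → xs ++ ys ⊆ xs′ ++ ys′
    go {xs} {xs′ = xs′} a c m = [ (λ q → ∈-++⁺ˡ (a q)) , (λ q → ∈-++⁺ʳ xs′ (c q)) ]′ (∈-++⁻ xs m)

  closure-cong : ∀ {n} {es es′ : List (Edge n)} → es ≈ˢ es′ → ∀ i j → closure es i j ≡ closure es′ i j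
  closure-cong {es = es} {es′} (a , b) i j = true-ext
    (λ e → dec-true (norm i j ∈ᵉ? es′) (a (does-true⁻ (norm i j ∈ᵉ? es) e)))
    (λ e → dec-true (norm i j ∈ᵉ? es) (b (does-true⁻ (norm i j ∈ᵉ? es′) e)))

  memb-cong : ∀ {n} {vs vs′ : List (Fin n)} → vs ≈ˢ vs′ → ∀ i → memb vs i ≡ memb vs′ i
  memb-cong {vs = vs} {vs′} (a , b) i = true-ext
    (λ e → dec-true (i ∈ᵛ? vs′) (a (does-true⁻ (i ∈ᵛ? vs) e)))
    (λ e → dec-true (i ∈ᵛ? vs) (b (does-true⁻ (i ∈ᵛ? vs′) e)))

  record InGraph {n} (G : Graph n) (e : Edge n) : Set where
    constructor inGraph
    field
      ordered : proj₁ e Fin.< proj₂ e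
      adjacent : adj G (proj₁ e) (proj₂ e) ≡ true
  open InGraph public

  adj⇒≢ : ∀ {n} (G : Graph n) {i j} → adj G i j ≡ true → i ≢ j
  adj⇒≢ G {i} e refl with trans (sym e) (irref G i)
  ... | ()

  inGraph-norm : ∀ {n} (G : Graph n) {i j} → adj G i j ≡ true → InGraph G (norm i j)
  inGraph-norm G e = inGraph (norm-ordered (adj⇒≢ G e)) (norm-adj G e)

  inGraph-norm⁻ : ∀ {n} (G : Graph n) {i j} → InGraph G (norm i j) → adj G i j ≡ true
  inGraph-norm⁻ G {i} {j} h with norm-cases i j
  ... | inj₁ p = subst (λ e → adj G (proj₁ e) (proj₂ e) ≡ true) p (adjacent h)
  ... | inj₂ p = trans (Graph.sym G i j) (subst (λ e → adj G (proj₁ e) (proj₂ e) ≡ true) p (adjacent h))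

  closure-subgraph : ∀ {n} (G : Graph n) {es : List (Edge n)} → All (InGraph G) es → Subgraph G full (closure es)
  closure-subgraph G {es} es∈ = record
    { E-sym = λ i j → cong (λ e → does (e ∈ᵉ? es)) (norm-comm i j)
    ; E-irref = λ i → irr i
    ; E-adj = λ {i} {j} e → inGraph-norm⁻ G (All.lookup es∈ (does-true⁻ (norm i j ∈ᵉ? es) e))
    ; E-S = λ _ → refl }
    where
    irr : ∀ i → closure es i i ≡ false
    irr i = dec-false (norm i i ∈ᵉ? es) (λ m → adj⇒≢ G (inGraph-norm⁻ G (All.lookup es∈ m)) refl)

  allEdges : ∀ n → List (Edge n)
  allEdges n = concatMap (λ i → map (λ j → (i , j)) (allFin n)) (allFin n)

  allEdges-unique : ∀ n → Unique (allEdges n)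
  allEdges-unique n = concatMap-unique _ proj₁ (Uniqueₚ.allFin⁺ n)
    (λ i → Uniqueₚ.map⁺ (λ eq → proj₂ (,-injective eq)) (Uniqueₚ.allFin⁺ n))
    (λ i m → let _ , _ , eq = ∈-map⁻ (i ,_) m in cong proj₁ eq)

  ∈-allEdges : ∀ {n} (e : Edge n) → e ∈ allEdges n
  ∈-allEdges (i , j) = ∈-concatMap _ (∈-allFin i) (∈-map⁺ (i ,_) (∈-allFin j))

  edgeList : ∀ {m} → ESet m → List (Edge m)
  edgeList {m} F = filterᵗ (λ e → F (proj₁ e) (proj₂ e) ∧ (toℕ (proj₁ e) <ᵇ toℕ (proj₂ e))) (allEdges m)

  numEdges≡ : ∀ {m} (F : ESet m) → numEdges F ≡ length (edgeList F)
  numEdges≡ {m} F = trans (count-cong _ _ (λ _ → refl) (allEdges m)) (count≡length _ (allEdges m))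
    where
    count-cong : ∀ {A : Set} (P Q : A → Bool) → (∀ x → P x ≡ Q x) → ∀ xs → countᵇ P xs ≡ countᵇ Q xs
    count-cong P Q h [] = refl
    count-cong P Q h (x ∷ xs) rewrite h x | count-cong P Q h xs = refl

  <ᵇ-true⁺ : ∀ {a b} → a < b → (a <ᵇ b) ≡ true
  <ᵇ-true⁺ lt = Equivalence.to Boolₚ.T-≡ (<⇒<ᵇ lt)

  <ᵇ-true⁻ : ∀ a b → (a <ᵇ b) ≡ true → a < b
  <ᵇ-true⁻ a b e = <ᵇ⇒< a b (subst T (sym e) tt)

  ∈-edgeList⁺ : ∀ {m} {F : ESet m} {i j} → F i j ≡ true → i Fin.< j → (i , j) ∈ edgeList F
  ∈-edgeList⁺ e lt = ∈-filterᵗ⁺ _ (∈-allEdges _) (cong₂ _∧_ e (<ᵇ-true⁺ lt))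

  ∈-edgeList⁻ : ∀ {m} {F : ESet m} {e} → e ∈ edgeList F → F (proj₁ e) (proj₂ e) ≡ true × proj₁ e Fin.< proj₂ e
  ∈-edgeList⁻ {m} {F} {i , j} h with ∧-true⁻ (proj₂ (∈-filterᵗ⁻ _ {allEdges m} h))
  ... | a , b = a , <ᵇ-true⁻ (toℕ i) (toℕ j) b

  edgeList-unique : ∀ {m} (F : ESet m) → Unique (edgeList F)
  edgeList-unique {m} F = filterᵗ-unique _ (allEdges-unique m)

  length≤numEdges : ∀ {n} (G : Graph n) {es : List (Edge n)} → Unique es → All (InGraph G) es → length es ≤ numEdges (closure es)
  length≤numEdges G {es} u h = ≤-trans (length-⊆ u sub) (≤-reflexive (sym (numEdges≡ (closure es))))
    where
    sub : es ⊆ edgeList (closure es)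
    sub {i , j} m = ∈-edgeList⁺ (dec-true (norm i j ∈ᵉ? es) (subst (_∈ es) (sym (norm-< lt)) m)) lt
      where lt = ordered (All.lookup h m)

  img : ∀ {n m} → (Fin m → Fin n) → List (Edge m) → List (Edge n)
  img f = map (λ e → norm (f (proj₁ e)) (f (proj₂ e)))

  norm-map : ∀ {n m} (f : Fin m → Fin n) a b → norm (f (proj₁ (norm a b))) (f (proj₂ (norm a b))) ≡ norm (f a) (f b)
  norm-map f a b with norm-cases a b
  ... | inj₁ p rewrite p = refl
  ... | inj₂ p rewrite p = norm-comm (f b) (f a)

  img-img : ∀ {n m k} (g : Fin m → Fin n) (f : Fin k → Fin m) es → img g (img f es) ≡ img (g ∘ f) es
  img-img g f [] = refl
  img-img g f (e ∷ es) = cong₂ _∷_ (norm-map g _ _) (img-img g f es)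

  norm-map-inj : ∀ {n m} {f : Fin m → Fin n} → Injective _≡_ _≡_ f → ∀ {a b c d} → norm (f a) (f b) ≡ norm (f c) (f d) → norm a b ≡ norm c d
  norm-map-inj inj eq with norm-inj eq
  ... | inj₁ (p , q) = cong₂ norm (inj p) (inj q)
  ... | inj₂ (p , q) = trans (cong₂ norm (inj p) (inj q)) (norm-comm _ _)

  injective⇒surjective : ∀ {n} {f : Fin n → Fin n} → Injective _≡_ _≡_ f → ∀ v → ∃ λ i → f i ≡ v
  injective⇒surjective {n} {f} inj v with v ∈ᵛ? tabulate f
  ... | yes m = let i , eq = ∈-tabulate⁻ m in i , sym eq
  ... | no v∉ = ⊥-elim (<-irrefl refl (subst₂ _≤_ (cong suc (length-tabulate f)) (length-tabulate id)
    (length-⊆ {xs = v ∷ tabulate f} (Allₚ.¬Any⇒All¬ _ v∉ ∷ Uniqueₚ.tabulate⁺ inj) (λ {x} _ → ∈-allFin x))))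

  -- Given the images of the vertices vs, the images of es under permutations admit at most M
  -- codes.  The copies of (full, closure es) in K_n are exactly these images, so that
  -- there are at most n^|vs| M of them.
  record Coded {n} (vs : List (Fin n)) (es : List (Edge n)) (M : ℕ) : Set where
    field
      codes : List (Fin n) → List (List (Edge n))
      bound : ∀ b → length (codes b) ≤ M
      cover : ∀ (π : Fin n → Fin n) → Injective _≡_ _≡_ π → ∃ λ z → z ∈ codes (map π vs) × z ≈ˢ img π es
  open Coded public

  -- Since the pattern has vertex set `full`, a labelling of a copy is a permutation and its edges
  -- alone determine the copy. Vertices outside `vs` therefore cost nothing.
  N≤coded : ∀ {n} (G : Graph n) {vs es M} → All (InGraph G) es → Coded vs es M →
    N (K n) full (closure es) ≤ n ^ length vs * M
  N≤coded {n} G {vs} {es} {M} es∈ cd = ≤-trans (N≤length (K n) (closure es) Z prf) lenZ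
    where
    bases = map toList (allVec (allFin n) (length vs))
    Z₀ = concatMap (codes cd) bases
    Z : List (VSet n × ESet n)
    Z = map (λ z → full , closure z) Z₀
    lenZ : length Z ≤ n ^ length vs * M
    lenZ = begin
      length Z  ≡⟨ length-map _ Z₀ ⟩
      length Z₀ ≤⟨ length-concatMap≤ (codes cd) M bases (λ {b} _ → bound cd b) ⟩
      length bases * M ≤⟨ *-monoˡ-≤ M (≤-trans (≤-reflexive (length-map toList (allVec (allFin n) (length vs)))) (≤-trans (length-allVec (allFin n) (length vs))
         (≤-reflexive (cong (_^ length vs) (length-tabulate id))))) ⟩
      n ^ length vs * M ∎
      where open ≤-Reasoning
    base∈ : ∀ π → map π vs ∈ bases
    base∈ π = subst (_∈ bases) (trans (Vecₚ.toList-map π (Vec.fromList vs)) (cong (map π) (Vecₚ.toList∘fromList vs)))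
      (∈-map⁺ toList (allVec-complete (Vec.map π (Vec.fromList vs)) (λ i → ∈-allFin _)))
    prf : ∀ S E (f : Vec (Fin n) n) → Subgraph (K n) S E → Iso S E (closure es) (lookup f) →
      ∃ λ z → z ∈ Z × (∀ i → proj₁ z i ≡ S i) × (∀ i j → proj₂ z i j ≡ E i j)
    prf S E fv sub iso with cover cd (lookup fv) (f-inj iso)
    ... | z , z∈ , z≈ = (full , closure z) , ∈-map⁺ _ (∈-concatMap (codes cd) (base∈ f) z∈) , onS , onE
      where
      f = lookup fv
      surj : ∀ v → ∃ λ i → f i ≡ v
      surj v = injective⇒surjective (f-inj iso) v
      onS : ∀ i → true ≡ S i
      onS v with surj v
      ... | i , refl = sym (f-in iso i)
      onE : ∀ a b → closure z a b ≡ E a b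
      onE a b with surj a | surj b
      ... | i , refl | j , refl = trans (closure-cong z≈ (f i) (f j)) (trans (true-ext to from) (f-edge iso i j))
        where
        to : closure (img f es) (f i) (f j) ≡ true → closure es i j ≡ true
        to e with ∈-map⁻ _ (does-true⁻ (norm (f i) (f j) ∈ᵉ? img f es) e)
        ... | (a , b) , ab∈ , eq = dec-true (norm i j ∈ᵉ? es)
          (subst (_∈ es) (sym (trans (norm-map-inj (f-inj iso) eq) (norm-< (ordered (All.lookup es∈ ab∈))))) ab∈)
        from : closure es i j ≡ true → closure (img f es) (f i) (f j) ≡ true
        from e = dec-true (norm (f i) (f j) ∈ᵉ? img f es)
          (subst (_∈ img f es) (norm-map f i j) (∈-map⁺ _ (does-true⁻ (norm i j ∈ᵉ? es) e)))

  -- From rationals to natural numbers.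

  fromℕ≡ : ∀ m → fromℕ m ≡ mkℚ (ℤ.+ m) 0 (Coprimality.sym (Coprimality.1-coprimeTo m))
  fromℕ≡ m = ℚₚ.normalize-coprime _

  toℚᵘ-fromℕ : ∀ m → ℚ.toℚᵘ (fromℕ m) ≡ ℚᵘ.mkℚᵘ (ℤ.+ m) 0
  toℚᵘ-fromℕ m = cong ℚ.toℚᵘ (fromℕ≡ m)

  fromℕ-* : ∀ a b → fromℕ (a * b) ≡ fromℕ a ℚ.* fromℕ b
  fromℕ-* a b rewrite fromℕ≡ a | fromℕ≡ b = cong (λ z → z ℚ./ 1) (ℤₚ.pos-* a b)

  fromℕ-cancel-≤ : ∀ {a b} → fromℕ a ℚ.≤ fromℕ b → a ≤ b
  fromℕ-cancel-≤ {a} {b} le rewrite fromℕ≡ a | fromℕ≡ b =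
    ℤₚ.drop‿+≤+ (subst₂ ℤ._≤_ (ℤₚ.*-identityʳ (ℤ.+ a)) (ℤₚ.*-identityʳ (ℤ.+ b)) (ℚₚ.drop-*≤* le))

  fromℕ-mono-< : ∀ {a b} → a < b → fromℕ a ℚ.< fromℕ b
  fromℕ-mono-< {a} {b} lt rewrite fromℕ≡ a | fromℕ≡ b =
    ℚ.*<* (subst₂ ℤ._<_ (sym (ℤₚ.*-identityʳ (ℤ.+ a))) (sym (ℤₚ.*-identityʳ (ℤ.+ b))) (ℤ.+<+ lt))

  fromℕ-nonNeg : ∀ m → ℚ.NonNegative (fromℕ m)
  fromℕ-nonNeg m rewrite fromℕ≡ m = _

  record Fraction (q : ℚ) : Set where
    field
      num den : ℕ
      num>0 : 0 < num
      num≤den : num ≤ den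
      fraction : q ℚ.* fromℕ den ≡ fromℕ num

  toFraction : ∀ {q} → 0ℚ ℚ.< q → q ℚ.≤ 1ℚ → Fraction q
  toFraction {mkℚ (ℤ.+ zero) d c} (ℚ.*<* (ℤ.+<+ ())) q≤1
  toFraction {mkℚ (ℤ.-[1+ _ ]) d c} (ℚ.*<* ()) q≤1
  toFraction {q@(mkℚ (ℤ.+ suc a) d-1 c)} _ q≤1 = record
    { num = suc a ; den = suc d-1 ; num>0 = z<s
    ; num≤den = ℤₚ.drop‿+≤+ (subst₂ ℤ._≤_ (ℤₚ.*-identityʳ (ℤ.+ suc a)) (ℤₚ.*-identityˡ (ℤ.+ suc d-1)) (ℚₚ.drop-*≤* q≤1))
    ; fraction = ℚₚ.toℚᵘ-injective (ℚᵘₚ.≃-trans (ℚₚ.toℚᵘ-homo-* q (fromℕ (suc d-1)))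
        (subst₂ ℚᵘ._≃_ (cong (ℚ.toℚᵘ q ℚᵘ.*_) (sym (toℚᵘ-fromℕ (suc d-1)))) (sym (toℚᵘ-fromℕ (suc a)))
          (ℚᵘ.*≡* (trans (ℤₚ.*-identityʳ _) (cong (λ z → ℤ.+ suc a ℤ.* ℤ.+ z) (sym (*-identityʳ (suc d-1)))))))) }

  module _ {q : ℚ} {p d : ℕ} (fr : q ℚ.* fromℕ d ≡ fromℕ p) where

    power-fraction : ∀ l e → (fromℕ l ℚ.* q) D.^ e ℚ.* fromℕ (d ^ e) ≡ fromℕ ((l * p) ^ e)
    power-fraction l zero = refl
    power-fraction l (suc e) = begin
      x ℚ.* x D.^ e ℚ.* fromℕ (d * d ^ e)                ≡⟨ cong (x ℚ.* x D.^ e ℚ.*_) (fromℕ-* d (d ^ e)) ⟩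
      x ℚ.* x D.^ e ℚ.* (fromℕ d ℚ.* fromℕ (d ^ e))      ≡⟨ swap x (x D.^ e) (fromℕ d) (fromℕ (d ^ e)) ⟩
      (x ℚ.* fromℕ d) ℚ.* (x D.^ e ℚ.* fromℕ (d ^ e))    ≡⟨ cong₂ ℚ._*_ base (power-fraction l e) ⟩
      fromℕ (l * p) ℚ.* fromℕ ((l * p) ^ e)              ≡⟨ fromℕ-* (l * p) _ ⟨
      fromℕ ((l * p) ^ suc e)                            ∎
      where
      open Relation.Binary.PropositionalEquality.≡-Reasoning
      x = fromℕ l ℚ.* q
      swap : ∀ a b c d → a ℚ.* b ℚ.* (c ℚ.* d) ≡ (a ℚ.* c) ℚ.* (b ℚ.* d)
      swap = solve 4 (λ a b c d → a :* b :* (c :* d) := (a :* c) :* (b :* d)) refl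
        where open ℚ+*-Solver
      base : x ℚ.* fromℕ d ≡ fromℕ (l * p)
      base = trans (ℚₚ.*-assoc (fromℕ l) q (fromℕ d)) (trans (cong (fromℕ l ℚ.*_) fr) (sym (fromℕ-* l p)))

    1≤⇒^≤ : ∀ m e → 1ℚ ℚ.≤ fromℕ m ℚ.* q D.^ e → d ^ e ≤ m * p ^ e
    1≤⇒^≤ m e le = fromℕ-cancel-≤ (subst₂ ℚ._≤_ (ℚₚ.*-identityˡ _) eq
      (ℚₚ.*-monoʳ-≤-nonNeg (fromℕ (d ^ e)) {{fromℕ-nonNeg (d ^ e)}} le))
      where
      eq : fromℕ m ℚ.* q D.^ e ℚ.* fromℕ (d ^ e) ≡ fromℕ (m * p ^ e)
      eq = trans (ℚₚ.*-assoc (fromℕ m) _ _)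
        (trans (cong (fromℕ m ℚ.*_) (trans (cong (λ z → z D.^ e ℚ.* fromℕ (d ^ e)) (sym (ℚₚ.*-identityˡ q)))
          (trans (power-fraction 1 e) (cong (λ z → fromℕ (z ^ e)) (*-identityˡ p)))))
        (sym (fromℕ-* m _)))

    *<⇒< : ∀ l a b e → a * d ^ e < b * (l * p) ^ e → fromℕ a ℚ.< fromℕ b ℚ.* (fromℕ l ℚ.* q) D.^ e
    *<⇒< l a b e lt = ℚₚ.*-cancelʳ-<-nonNeg (fromℕ (d ^ e)) {{fromℕ-nonNeg (d ^ e)}}
      (subst₂ ℚ._<_ (fromℕ-* a _) (trans (fromℕ-* b _) (trans (cong (fromℕ b ℚ.*_) (sym (power-fraction l e))) (sym (ℚₚ.*-assoc (fromℕ b) _ _))))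
        (fromℕ-mono-< lt))

  -- Here n^|vs| M bounds the number of copies in K_n of the graph with edge list `es`, so this is
  -- the sparsity condition with denominators cleared. As it is stated for every code, each
  -- application may choose its own way of counting.
  Sparseᴺ : ∀ {n} → Graph n → ℕ → ℕ → Set
  Sparseᴺ {n} H p d = ∀ {vs es M} → Unique es → All (InGraph H) es → Coded vs es M →
    d ^ length es ≤ n ^ length vs * M * p ^ length es

  -- `length≤numEdges` compares the two edge counts in one direction only; the surplus `h` is traded
  -- away by p ≤ d.
  sparse⇒sparseᴺ : ∀ {n} {H : Graph n} {q p d} → q ℚ.* fromℕ d ≡ fromℕ p → 0 < p → p ≤ d → Sparse q H → Sparseᴺ H p d
  sparse⇒sparseᴺ {n} {H} {q} {p} {d} fr p>0 p≤d sp {vs} {es} {M} u es∈ cd =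
    *-cancelʳ-≤ (d ^ e) (A * p ^ e) (d ^ h) {{m^n≢0 d h {{>-nonZero (<-≤-trans p>0 p≤d)}}}} (begin
      d ^ e * d ^ h          ≡⟨ ^-split d e h ⟨
      d ^ (e + h)            ≡⟨ cong (d ^_) (m+[n∸m]≡n e≤) ⟩
      d ^ numEdges E         ≤⟨ 1≤⇒^≤ {q} {p} {d} fr (N (K n) full E) (numEdges E) (sp full E (isSubgraph⁺ {G = H} (closure-subgraph H es∈))) ⟩
      N (K n) full E * p ^ numEdges E ≤⟨ *-monoˡ-≤ _ (N≤coded H es∈ cd) ⟩
      A * p ^ numEdges E     ≡⟨ cong (λ z → A * p ^ z) (m+[n∸m]≡n e≤) ⟨
      A * p ^ (e + h)        ≡⟨ cong (A *_) (^-split p e h) ⟩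
      A * (p ^ e * p ^ h)    ≤⟨ *-monoʳ-≤ A (*-monoʳ-≤ (p ^ e) (^-monoˡ-≤ h p≤d)) ⟩
      A * (p ^ e * d ^ h)    ≡⟨ *-assoc A _ _ ⟨
      A * p ^ e * d ^ h      ∎)
    where
    open ≤-Reasoning
    E = closure es
    e = length es
    A = n ^ length vs * M
    e≤ : e ≤ numEdges E
    e≤ = length≤numEdges H u es∈
    h = numEdges E ∸ e

  -- Codes for single graphs, stars and families of copies.

  module _ {n : ℕ} where

    assoc : Fin n → List (Fin n) → List (Fin n) → Fin n
    assoc v (x ∷ xs) (y ∷ ys) = if does (v Finₚ.≟ x) then y else assoc v xs ys
    assoc v _ _ = v

    assoc-map : ∀ (π : Fin n → Fin n) {v vs} → v ∈ vs → assoc v vs (map π vs) ≡ π v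
    assoc-map π {v} {x ∷ vs} v∈ with v Finₚ.≟ x | v∈
    ... | yes refl | _ = refl
    ... | no v≢x | here eq = ⊥-elim (v≢x eq)
    ... | no v≢x | there m = assoc-map π m

    coded-base : ∀ {vs : List (Fin n)} {es} → (∀ {e} → e ∈ es → proj₁ e ∈ vs × proj₂ e ∈ vs) → Coded vs es 1
    coded-base {vs} {es} ends = record
      { codes = λ b → [ map (λ e → norm (assoc (proj₁ e) vs b) (assoc (proj₂ e) vs b)) es ]
      ; bound = λ _ → ≤-refl
      ; cover = λ π inj → img π es , here (recover π es ends) , (id , id) }
      where
      recover : ∀ π es′ → (∀ {e} → e ∈ es′ → proj₁ e ∈ vs × proj₂ e ∈ vs) →
        img π es′ ≡ map (λ e → norm (assoc (proj₁ e) vs (map π vs)) (assoc (proj₂ e) vs (map π vs))) es′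
      recover π [] _ = refl
      recover π (e ∷ es′) h = cong₂ _∷_
        (sym (cong₂ norm (assoc-map π (proj₁ (h (here refl)))) (assoc-map π (proj₂ (h (here refl))))))
        (recover π es′ (h ∘ there))

    coded-++ : ∀ {vs : List (Fin n)} {es es′ M M′} → Coded vs es M → Coded vs es′ M′ → Coded vs (es ++ es′) (M * M′)
    coded-++ {vs} {es} {es′} {M} {M′} c c′ = record
      { codes = λ b → concatMap (λ z → map (z ++_) (codes c′ b)) (codes c b)
      ; bound = λ b → ≤-trans (length-concatMap≤ _ M′ (codes c b) (λ {z} _ → ≤-trans (≤-reflexive (length-map (z ++_) (codes c′ b))) (bound c′ b)))
                        (*-monoˡ-≤ M′ (bound c b))
      ; cover = λ π inj → let z , z∈ , z≈ = cover c π inj ; z′ , z′∈ , z′≈ = cover c′ π inj in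
          z ++ z′ , ∈-concatMap _ z∈ (∈-map⁺ (z ++_) z′∈)
          , subst (λ w → (z ++ z′) ≈ˢ w) (sym (map-++ _ es es′)) (≈ˢ-++ z≈ z′≈) }

    map-≈ˢ : ∀ {A B : Set} (f : A → B) {xs ys} → xs ≈ˢ ys → map f xs ≈ˢ map f ys
    map-≈ˢ {A} f (a , b) = go a , go b
      where
      go : ∀ {xs ys : List A} → xs ⊆ ys → map f xs ⊆ map f ys
      go {xs} s m with ∈-map⁻ f m
      ... | x , x∈ , refl = ∈-map⁺ f (s x∈)

    concatMap-≈ˢ : ∀ {A B : Set} (f : A → List B) {xs ys} → xs ≈ˢ ys → concatMap f xs ≈ˢ concatMap f ys
    concatMap-≈ˢ {A} f (a , b) = go a , go b
      where
      go : ∀ {xs ys : List A} → xs ⊆ ys → concatMap f xs ⊆ concatMap f ys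
      go {xs} s m with ∈-concatMap⁻′ f {xs} m
      ... | x , x∈ , y∈ = ∈-concatMap f (s x∈) y∈

    -- Permuting the leaves does not change the star: its image is determined by the image of the
    -- centre, read off the base, and the set of leaf images. This yields C(n, |ws|) where ordered
    -- leaves would give n^|ws|.
    coded-star : ∀ {vs : List (Fin n)} {v ws} → v ∈ vs → Unique ws →
      Coded vs (map (norm v) ws) (length (combs (length ws) (allFin n)))
    coded-star {vs} {v} {ws} v∈ u = record
      { codes = λ b → map (map (norm (assoc v vs b))) (combs (length ws) (allFin n))
      ; bound = λ b → ≤-reflexive (length-map _ (combs (length ws) (allFin n)))
      ; cover = cov }
      where
      cov : ∀ (π : Fin n → Fin n) → Injective _≡_ _≡_ π → ∃ λ z →
        z ∈ map (map (norm (assoc v vs (map π vs)))) (combs (length ws) (allFin n)) × z ≈ˢ img π (map (norm v) ws)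
      cov π inj with combs-cover Finₚ._≟_ (Uniqueₚ.allFin⁺ n) (Uniqueₚ.map⁺ inj u) (λ {x} _ → ∈-allFin x)
      ... | c , c∈ , c⊆ , ⊆c = map (norm (assoc v vs (map π vs))) c
        , ∈-map⁺ _ (subst (λ l → c ∈ combs l (allFin n)) (length-map π ws) c∈)
        , subst (map (norm (assoc v vs (map π vs))) c ≈ˢ_) eq (map-≈ˢ (norm (assoc v vs (map π vs))) (c⊆ , ⊆c))
        where
        eq : map (norm (assoc v vs (map π vs))) (map π ws) ≡ img π (map (norm v) ws)
        eq rewrite assoc-map π v∈ = trans (sym (map-∘ ws)) (trans (map-cong (λ w → sym (norm-map π v w)) ws) (map-∘ ws))

    edgesOf : ∀ {k} → List (Edge k) → Vec (Fin n) k → List (Edge n)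
    edgesOf el f = img (lookup f) el

    -- No vertex is fixed in advance, the base being empty. A permutation carries the family `fs` to
    -- a family of equally many vectors, and the union of their edges depends only on this set; so a
    -- set of |fs| vectors out of n^k is a code.
    coded-copies : ∀ {k} (el : List (Edge k)) {fs : List (Vec (Fin n) k)} → Unique fs →
      Coded [] (concatMap (edgesOf el) fs) (length (combs (length fs) (allVec (allFin n) k)))
    coded-copies {k} el {fs} u = record
      { codes = λ b → map (concatMap (edgesOf el)) (combs (length fs) (allVec (allFin n) k))
      ; bound = λ b → ≤-reflexive (length-map _ (combs (length fs) (allVec (allFin n) k)))
      ; cover = cov }
      where
      map-inj : ∀ {π : Fin n → Fin n} → Injective _≡_ _≡_ π → ∀ {m} {x y : Vec (Fin n) m} → Vec.map π x ≡ Vec.map π y → x ≡ y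
      map-inj inj {x = []} {[]} _ = refl
      map-inj inj {x = a ∷ x} {b ∷ y} eq = cong₂ _∷_ (inj (proj₁ (Vecₚ.∷-injective eq))) (map-inj inj (proj₂ (Vecₚ.∷-injective eq)))
      cov : ∀ (π : Fin n → Fin n) → Injective _≡_ _≡_ π → ∃ λ z →
        z ∈ map (concatMap (edgesOf el)) (combs (length fs) (allVec (allFin n) k)) × z ≈ˢ img π (concatMap (edgesOf el) fs)
      cov π inj with combs-cover (Vecₚ.≡-dec Finₚ._≟_) (allVec-unique (Uniqueₚ.allFin⁺ n) k) (Uniqueₚ.map⁺ (map-inj inj) u)
                      (λ {x} _ → allVec-complete x (λ i → ∈-allFin _))
      ... | c , c∈ , c≈ = concatMap (edgesOf el) c
        , ∈-map⁺ _ (subst (λ l → c ∈ combs l (allVec (allFin n) k)) (length-map (Vec.map π) fs) c∈)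
        , subst (concatMap (edgesOf el) c ≈ˢ_) (eq fs) (concatMap-≈ˢ (edgesOf el) c≈)
        where
        eq₁ : ∀ f es → img (lookup (Vec.map π f)) es ≡ img π (img (lookup f) es)
        eq₁ f es = trans (map-cong (λ e → cong₂ norm (Vecₚ.lookup-map (proj₁ e) π f) (Vecₚ.lookup-map (proj₂ e) π f)) es)
          (sym (img-img π (lookup f) es))
        eq : ∀ fs → concatMap (edgesOf el) (map (Vec.map π) fs) ≡ img π (concatMap (edgesOf el) fs)
        eq [] = refl
        eq (f ∷ fs) = trans (cong₂ _++_ (eq₁ f el) (eq fs)) (sym (map-++ _ (edgesOf el f) _))

  -- Consequences of sparsity: low degrees and edge-disjoint copies.

  pow-cancel-≤ : ∀ g {a b} → 0 < g → a ^ g ≤ b ^ g → a ≤ b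
  pow-cancel-≤ (suc g) _ le = ≮⇒≥ (λ lt → <⇒≱ (^-monoˡ-< (suc g) lt) le)

  2*≡ : ∀ x → 2 * x ≡ x + x
  2*≡ x = cong (x +_) (+-identityʳ x)

  n<2^n : ∀ m → m < 2 ^ m
  n<2^n zero = ≤-refl
  n<2^n (suc m) = ≤-trans (+-mono-≤ (m^n>0 2 m) (n<2^n m)) (≤-reflexive (sym (2*≡ (2 ^ m))))

  n≤2^n : ∀ m → m ≤ 2 ^ m
  n≤2^n m = <⇒≤ (n<2^n m)

  length-concatMap : ∀ {A B : Set} (f : A → List B) xs → length (concatMap f xs) ≡ sumOver (length ∘ f) xs
  length-concatMap f [] = refl
  length-concatMap f (x ∷ xs) = trans (length-++ (f x)) (cong (length (f x) +_) (length-concatMap f xs))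

  -- The ordered pairs (v, w) with w in `nb v` are distinct, and each is one of the two orientations
  -- of an edge in `es`.
  handshake : ∀ {n} {es : List (Edge n)} (nb : Fin n → List (Fin n)) → (∀ v → Unique (nb v)) →
    (∀ {v w} → w ∈ nb v → norm v w ∈ es) → ∀ {vs} → Unique vs → sumOver (length ∘ nb) vs ≤ 2 * length es
  handshake {n} {es} nb nb-unique nb∈ {vs} u = begin
    sumOver (length ∘ nb) vs           ≡⟨ sumOver-cong vs ⟨
    sumOver (length ∘ arcs) vs         ≡⟨ length-concatMap arcs vs ⟨
    length (concatMap arcs vs)         ≤⟨ length-⊆ unique sub ⟩
    length (concatMap both es)         ≤⟨ length-concatMap≤ both 2 es (λ _ → ≤-refl) ⟩
    length es * 2                      ≡⟨ *-comm (length es) 2 ⟩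
    2 * length es                      ∎
    where
    open ≤-Reasoning
    arcs : Fin n → List (Edge n)
    arcs v = map (v ,_) (nb v)
    both : Edge n → List (Edge n)
    both e = e ∷ (proj₂ e , proj₁ e) ∷ []
    sumOver-cong : ∀ vs → sumOver (length ∘ arcs) vs ≡ sumOver (length ∘ nb) vs
    sumOver-cong [] = refl
    sumOver-cong (v ∷ vs) = cong₂ _+_ (length-map _ (nb v)) (sumOver-cong vs)
    unique : Unique (concatMap arcs vs)
    unique = concatMap-unique arcs proj₁ u (λ v → Uniqueₚ.map⁺ (λ eq → proj₂ (,-injective eq)) (nb-unique v))
      (λ v m → let _ , _ , eq = ∈-map⁻ (v ,_) m in cong proj₁ eq)
    sub : concatMap arcs vs ⊆ concatMap both es
    sub m with ∈-concatMap⁻′ arcs {vs} m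
    ... | v , _ , m′ with ∈-map⁻ (v ,_) m′
    ... | w , w∈ , refl with norm-cases v w
    ... | inj₁ eq = ∈-concatMap both (subst (_∈ es) eq (nb∈ w∈)) (here refl)
    ... | inj₂ eq = ∈-concatMap both (subst (_∈ es) eq (nb∈ w∈)) (there (here refl))

  Within : ∀ {n} → List (Fin n) → List (Edge n) → Set
  Within vs es = ∀ {e} → e ∈ es → proj₁ e ∈ vs × proj₂ e ∈ vs

  norm-ends : ∀ {n} {vs : List (Fin n)} {i j} → i ∈ vs → j ∈ vs → proj₁ (norm i j) ∈ vs × proj₂ (norm i j) ∈ vs
  norm-ends {vs = vs} {i} {j} i∈ j∈ with norm-cases i j
  ... | inj₁ eq rewrite eq = i∈ , j∈
  ... | inj₂ eq rewrite eq = j∈ , i∈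

  norm-ends⁻ : ∀ {n} {vs : List (Fin n)} {i j} → proj₁ (norm i j) ∈ vs × proj₂ (norm i j) ∈ vs → i ∈ vs × j ∈ vs
  norm-ends⁻ {vs = vs} {i} {j} (a , b) with norm-cases i j
  ... | inj₁ eq rewrite eq = a , b
  ... | inj₂ eq rewrite eq = b , a

  module Host {n : ℕ} (H : Graph n) (p d : ℕ) (p>0 : 0 < p) (p≤d : p ≤ d) (sp : Sparseᴺ H p d) where

    d>0 : 0 < d
    d>0 = <-≤-trans p>0 p≤d

    instance
      d≢0 : NonZero d
      d≢0 = >-nonZero d>0
      p≢0 : NonZero p
      p≢0 = >-nonZero p>0

    sparse-within : ∀ {vs es} → Unique es → All (InGraph H) es → Within vs es →
      d ^ length es ≤ n ^ length vs * p ^ length es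
    sparse-within {vs} {es} u h w = ≤-trans (sp u h (coded-base w)) (≤-reflexive (cong (_* p ^ length es) (*-identityʳ (n ^ length vs))))

    nbrs : List (Fin n) → Fin n → List (Fin n)
    nbrs W u = filterᵗ (adj H u) W

    induced : List (Fin n) → List (Edge n)
    induced W = edgeList (λ i j → adj H i j ∧ (memb W i ∧ memb W j))

    -- Otherwise multiplying n² p^deg < d^deg over all of W contradicts the sparsity of H[W].
    low-degree : ∀ {W} → Unique W → 0 < length W →
      ∃ λ u → u ∈ W × d ^ length (nbrs W u) ≤ n ^ 2 * p ^ length (nbrs W u)
    low-degree {W} uW W>0 with Any.any? (λ u → d ^ length (nbrs W u) ≤? n ^ 2 * p ^ length (nbrs W u)) W
    ... | yes a = let u , u∈ , h = find a in u , u∈ , h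
    ... | no none = ⊥-elim (<⇒≱ contra sparse²)
      where
      open ≤-Reasoning
      δ : Fin n → ℕ
      δ u = length (nbrs W u)
      E = induced W
      e = length E
      weight : List (Fin n) → ℕ
      weight V = (n ^ 2) ^ length V * p ^ sumOver δ V
      weight-∷ : ∀ u V → weight (u ∷ V) ≡ (n ^ 2 * p ^ δ u) * weight V
      weight-∷ u V = trans (cong ((n ^ 2) ^ suc (length V) *_) (^-split p (δ u) (sumOver δ V)))
        (solve 4 (λ a b c d → (a :* b) :* (c :* d) := (a :* c) :* (b :* d)) refl (n ^ 2) ((n ^ 2) ^ length V) (p ^ δ u) (p ^ sumOver δ V))
        where open +-*-Solver
      weight≤ : ∀ V → (∀ {u} → u ∈ V → n ^ 2 * p ^ δ u < d ^ δ u) → weight V ≤ d ^ sumOver δ V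
      weight≤ [] h = ≤-refl
      weight≤ (u ∷ V) h = subst₂ _≤_ (sym (weight-∷ u V)) (sym (^-split d (δ u) _))
        (*-mono-≤ (<⇒≤ (h (here refl))) (weight≤ V (h ∘ there)))
      weight< : ∀ V → 0 < length V → (∀ {u} → u ∈ V → n ^ 2 * p ^ δ u < d ^ δ u) → weight V < d ^ sumOver δ V
      weight< (u ∷ V) _ h = subst₂ _<_ (sym (weight-∷ u V)) (sym (^-split d (δ u) _))
        (≤-<-trans (*-monoʳ-≤ (n ^ 2 * p ^ δ u) (weight≤ V (h ∘ there)))
          (*-monoˡ-< (d ^ sumOver δ V) {{m^n≢0 d (sumOver δ V)}} (h (here refl))))
      all< : ∀ {u} → u ∈ W → n ^ 2 * p ^ δ u < d ^ δ u
      all< u∈ = ≰⇒> (λ le → none (lose u∈ le))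
      -- `handshake` asks for edges in `E` at every vertex, so the lists are made empty outside `W`.
      nbW : Fin n → List (Fin n)
      nbW v = filterᵗ (λ w → memb W v ∧ adj H v w) W
      Σδ≤ : sumOver δ W ≤ 2 * e
      Σδ≤ = ≤-trans (sumOver-mono W (λ {u} u∈ → length-⊆ (filterᵗ-unique _ uW) (λ m → let m∈ , a = ∈-filterᵗ⁻ _ {W} m in
               ∈-filterᵗ⁺ _ m∈ (cong₂ _∧_ (dec-true (u ∈ᵛ? W) u∈) a))))
            (handshake {es = E} nbW (λ v → filterᵗ-unique _ uW) edge uW)
        where
        edge : ∀ {v w} → w ∈ nbW v → norm v w ∈ E
        edge {v} {w} m with ∈-filterᵗ⁻ _ {W} m
        ... | w∈ , vw with ∧-true⁻ {memb W v} vw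
        ... | v∈ , a = let x = inGraph-norm H a
                           y , z = norm-ends (does-true⁻ (v ∈ᵛ? W) v∈) w∈ in
             ∈-edgeList⁺ (cong₂ _∧_ (adjacent x) (cong₂ _∧_ (dec-true (_ ∈ᵛ? W) y) (dec-true (_ ∈ᵛ? W) z))) (ordered x)
      sparse¹ : d ^ e ≤ n ^ length W * p ^ e
      sparse¹ = sparse-within {W} {E} (edgeList-unique _)
        (All.tabulate (λ m → let a , lt = ∈-edgeList⁻ m in inGraph lt (proj₁ (∧-true⁻ a))))
        (λ m → let a , _ = ∈-edgeList⁻ m ; x , y = ∧-true⁻ (proj₂ (∧-true⁻ {adj H _ _} a)) in
           does-true⁻ (_ ∈ᵛ? W) x , does-true⁻ (_ ∈ᵛ? W) y)
      sparse² : d ^ (2 * e) ≤ (n ^ 2) ^ length W * p ^ (2 * e)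
      sparse² = begin
        d ^ (2 * e)                               ≡⟨ trans (cong (d ^_) (*-comm 2 e)) (sym (^-*-assoc d e 2)) ⟩
        (d ^ e) ^ 2                               ≤⟨ ^-monoˡ-≤ 2 sparse¹ ⟩
        (n ^ length W * p ^ e) ^ 2                ≡⟨ ^-distribʳ-* 2 (n ^ length W) (p ^ e) ⟩
        (n ^ length W) ^ 2 * (p ^ e) ^ 2          ≡⟨ cong₂ _*_ (trans (^-*-assoc n (length W) 2) (trans (cong (n ^_) (*-comm (length W) 2)) (sym (^-*-assoc n 2 (length W)))))
                                                         (trans (^-*-assoc p e 2) (cong (p ^_) (*-comm e 2))) ⟩
        (n ^ 2) ^ length W * p ^ (2 * e)          ∎
      contra : (n ^ 2) ^ length W * p ^ (2 * e) < d ^ (2 * e)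
      contra = begin-strict
        A * p ^ (2 * e)             ≡⟨ cong (λ z → A * p ^ z) (m+[n∸m]≡n Σδ≤) ⟨
        A * p ^ (s + h)             ≡⟨ cong (A *_) (^-split p s h) ⟩
        A * (p ^ s * p ^ h)         ≡⟨ *-assoc A _ _ ⟨
        A * p ^ s * p ^ h           ≤⟨ *-monoʳ-≤ (A * p ^ s) (^-monoˡ-≤ h p≤d) ⟩
        A * p ^ s * d ^ h           <⟨ *-monoˡ-< (d ^ h) {{m^n≢0 d h}} (weight< W W>0 all<) ⟩
        d ^ s * d ^ h               ≡⟨ ^-split d s h ⟨
        d ^ (s + h)                 ≡⟨ cong (d ^_) (m+[n∸m]≡n Σδ≤) ⟩
        d ^ (2 * e)                 ∎
        where
        A = (n ^ 2) ^ length W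
        s = sumOver δ W
        h = 2 * e ∸ s

    -- The union of g such copies with e edges each has g e edges and, by `coded-copies`, at most
    -- C(n^k, g) ≤ (n^k)^g / g! images in K_n. Sparsity thus gives g! d^(e g) ≤ (n^k p^e)^g. As g^g
    -- ≤ g! 4^g, taking g-th roots costs only the factor 4.
    edge-disjoint : ∀ {k} (el : List (Edge k)) (fs : List (Vec (Fin n) k)) → Unique fs →
      Unique (concatMap (edgesOf el) fs) → All (InGraph H) (concatMap (edgesOf el) fs) →
      length fs * d ^ length el ≤ 4 * (n ^ k * p ^ length el)
    edge-disjoint el [] _ _ _ = z≤n
    edge-disjoint {k} el fs@(_ ∷ _) ufs u h = pow-cancel-≤ g z<s (*-cancelˡ-≤ (g !) {{g !≢0}} (begin
      g ! * (g * d ^ e) ^ g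
        ≡⟨ cong (g ! *_) (^-distribʳ-* g g (d ^ e)) ⟩
      g ! * (g ^ g * (d ^ e) ^ g)
        ≤⟨ *-monoʳ-≤ (g !) (*-monoˡ-≤ _ (^≤!*2^ g g)) ⟩
      g ! * (g ! * 2 ^ (g + g) * (d ^ e) ^ g)
        ≡⟨ cong (λ z → g ! * (g ! * z * (d ^ e) ^ g)) (trans (cong (2 ^_) (sym (2*≡ g))) (sym (^-*-assoc 2 2 g))) ⟩
      g ! * (g ! * 4 ^ g * (d ^ e) ^ g)
        ≡⟨ solve 3 (λ f a b → f :* (f :* a :* b) := f :* a :* (f :* b)) refl (g !) (4 ^ g) ((d ^ e) ^ g) ⟩
      g ! * 4 ^ g * (g ! * (d ^ e) ^ g)
        ≤⟨ *-monoʳ-≤ (g ! * 4 ^ g) orbit ⟩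
      g ! * 4 ^ g * ((n ^ k) ^ g * (p ^ e) ^ g)
        ≡⟨ *-assoc (g !) _ _ ⟩
      g ! * (4 ^ g * ((n ^ k) ^ g * (p ^ e) ^ g))
        ≡⟨ cong (g ! *_) (trans (^-distribʳ-* g 4 (n ^ k * p ^ e)) (cong (4 ^ g *_) (^-distribʳ-* g (n ^ k) (p ^ e)))) ⟨
      g ! * (4 * (n ^ k * p ^ e)) ^ g ∎))
      where
      open ≤-Reasoning
      open +-*-Solver
      g = length fs
      e = length el
      C = length (combs g (allVec (allFin n) k))
      es = concatMap (edgesOf el) fs
      len : length es ≡ e * g
      len = trans (length-concatMap (edgesOf el) fs) (trans (go fs) (*-comm g e))
        where
        go : ∀ fs → sumOver (length ∘ edgesOf {n} el) fs ≡ length fs * e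
        go [] = refl
        go (f ∷ fs) = cong₂ _+_ (length-map _ el) (go fs)
      orbit : g ! * (d ^ e) ^ g ≤ (n ^ k) ^ g * (p ^ e) ^ g
      orbit = begin
        g ! * (d ^ e) ^ g                ≡⟨ cong (g ! *_) (trans (^-*-assoc d e g) (cong (d ^_) (sym len))) ⟩
        g ! * d ^ length es              ≤⟨ *-monoʳ-≤ (g !) (sp u h (coded-copies el ufs)) ⟩
        g ! * (1 * C * p ^ length es)    ≡⟨ solve 3 (λ f c x → f :* (con 1 :* c :* x) := c :* f :* x) refl (g !) C (p ^ length es) ⟩
        C * g ! * p ^ length es          ≤⟨ *-mono-≤ (≤-trans (length-combs g (allVec (allFin n) k))
                                               (^-monoˡ-≤ g (≤-trans (length-allVec (allFin n) k) (≤-reflexive (cong (_^ k) (length-tabulate {n = n} id))))))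
                                               (≤-reflexive (trans (cong (p ^_) len) (sym (^-*-assoc p e g)))) ⟩
        (n ^ k) ^ g * (p ^ e) ^ g        ∎

  -- Embeddings and the greedy sweep.

  touched : ∀ {k} → (Fin k → Bool) → List (Edge k) → List (Edge k)
  touched m = filterᵗ (λ e → m (proj₁ e) ∨ m (proj₂ e))

  marked : ∀ {k} → (Fin k → Bool) → List (Fin k)
  marked {k} m = filterᵗ m (allFin k)

  toList≡map : ∀ {A : Set} {k} (f : Vec A k) → toList f ≡ map (lookup f) (allFin k)
  toList≡map f = trans (go f) (sym (Listₚ.map-tabulate id (lookup f)))
    where
    go : ∀ {A : Set} {k} (f : Vec A k) → toList f ≡ tabulate (lookup f)
    go [] = refl
    go (a ∷ f) = cong (a ∷_) (go f)

  ∈-toList : ∀ {A : Set} {k} (f : Vec A k) i → lookup f i ∈ toList f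
  ∈-toList (a ∷ f) zero = here refl
  ∈-toList (a ∷ f) (suc i) = there (∈-toList f i)

  ∈-toList⁻ : ∀ {A : Set} {k} (f : Vec A k) {a} → a ∈ toList f → ∃ λ i → lookup f i ≡ a
  ∈-toList⁻ (a ∷ f) (here refl) = zero , refl
  ∈-toList⁻ (a ∷ f) (there m) = let i , eq = ∈-toList⁻ f m in suc i , eq

  lookup-injective : ∀ {n k} {f : Vec (Fin n) k} → Unique (toList f) → Injective _≡_ _≡_ (lookup f)
  lookup-injective {f = a ∷ f} (a∉ ∷ u) {zero} {zero} eq = refl
  lookup-injective {f = a ∷ f} (a∉ ∷ u) {zero} {suc j} eq = ⊥-elim (All.lookup a∉ (∈-toList f j) eq)
  lookup-injective {f = a ∷ f} (a∉ ∷ u) {suc i} {zero} eq = ⊥-elim (All.lookup a∉ (∈-toList f i) (sym eq))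
  lookup-injective {f = a ∷ f} (a∉ ∷ u) {suc i} {suc j} eq = cong suc (lookup-injective u eq)

  toList-unique : ∀ {n k} {f : Vec (Fin n) k} → Injective _≡_ _≡_ (lookup f) → Unique (toList f)
  toList-unique {k = k} {f} inj = subst Unique (sym (toList≡map f)) (Uniqueₚ.map⁺ inj (Uniqueₚ.allFin⁺ k))

  Ordered : ∀ {k} → List (Edge k) → Set
  Ordered el = ∀ {e} → e ∈ el → proj₁ e Fin.< proj₂ e

  img-unique : ∀ {n k} {f : Fin k → Fin n} {el} → Injective _≡_ _≡_ f → Ordered el → Unique el → Unique (img f el)
  img-unique inj ord [] = []
  img-unique {f = f} {e ∷ el} inj ord (e∉ ∷ u) =
    Allₚ.map⁺ (All.tabulate (λ {e′} m eq → All.lookup e∉ m (trans (sym (norm-< (ord (here refl))))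
      (trans (norm-map-inj {f = f} inj eq) (norm-< (ord (there m)))))))
    ∷ img-unique inj (ord ∘ there) u

  Embeds : ∀ {n k} → Graph n → List (Edge k) → Vec (Fin n) k → Set
  Embeds H el f = Unique (toList f) × All (InGraph H) (edgesOf el f)

  inGraph? : ∀ {n} (H : Graph n) → Decidable (InGraph H)
  inGraph? H e = map′ (λ (a , b) → inGraph a b) (λ h → ordered h , adjacent h)
    ((proj₁ e Finₚ.<? proj₂ e) ×-dec (adj H (proj₁ e) (proj₂ e) Boolₚ.≟ true))

  embeds? : ∀ {n k} (H : Graph n) (el : List (Edge k)) → Decidable (Embeds H el)
  embeds? H el f = unique? (toList f) ×-dec All.all? (inGraph? H) (edgesOf el f)
    where open import Data.List.Relation.Unary.Unique.DecPropositional Finₚ._≟_ using (unique?)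

  -- All copies of a pattern are swept up greedily.  A copy meeting the vertices V collected so far
  -- in at most one vertex is good; good copies are pairwise edge-disjoint.  Any other copy with a
  -- new vertex is bad and multiplies n^|V| (p/d)^|E| by at most n^(-1/k), a good one by at most n.
  -- Since this quantity stays at least 1, there are at most k bad copies per good one.
  module Sweep {n : ℕ} (H : Graph n) (p d : ℕ) (p>0 : 0 < p) (p≤d : p ≤ d) (sp : Sparseᴺ H p d) (n≥2 : 2 ≤ n)
    {k : ℕ} (el : List (Edge k)) (el-unique : Unique el) (el-ordered : Ordered el)
    (good-weight : n ^ k * p ^ length el ≤ n * d ^ length el)
    (bad-weight : ∀ (m : Fin k → Bool) → 1 ≤ length (marked m) → 2 + length (marked m) ≤ k →
       n ^ (1 + k * length (marked m)) * p ^ (k * length (touched m el)) ≤ d ^ (k * length (touched m el)))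
    where
    open Host H p d p>0 p≤d sp

    record State : Set where
      field
        V : List (Fin n)
        E : List (Edge n)
        good : List (Vec (Fin n) k)
        bad : ℕ
        V-unique : Unique V
        E-unique : Unique E
        E-graph : All (InGraph H) E
        E-within : Within V E
        good-unique : Unique good
        good-edges-unique : Unique (concatMap (edgesOf el) good)
        good-edges-graph : All (InGraph H) (concatMap (edgesOf el) good)
        good-within : ∀ {f} → f ∈ good → ∀ i → lookup f i ∈ V
        V-size : length V ≤ k * (length good + bad)
        -- The k-th power of n^|V| (p/d)^|E| ≤ n^(good - bad/k): the power removes the fraction, and
        -- moving `bad` to the left avoids subtraction.
        weight : n ^ (k * length V + bad) * p ^ (k * length E) ≤ n ^ (k * length good) * d ^ (k * length E)
    open State

    initial : State
    initial = record
      { V = [] ; E = [] ; good = [] ; bad = 0 ; V-unique = [] ; E-unique = [] ; E-graph = [] ; E-within = λ ()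
      ; good-unique = [] ; good-edges-unique = [] ; good-edges-graph = [] ; good-within = λ () ; V-size = z≤n
      ; weight = weight₀ }
      where
      weight₀ : n ^ (k * 0 + 0) * p ^ (k * 0) ≤ n ^ (k * 0) * d ^ (k * 0)
      weight₀ rewrite *-zeroʳ k = ≤-refl

    weight-step : ∀ x v b e g x′ e′ g′ → n ^ x′ * p ^ (k * e′) ≤ n ^ g′ * d ^ (k * e′) → n ^ (k * v + b) * p ^ (k * e) ≤ n ^ (k * g) * d ^ (k * e) →
      x ≡ x′ + (k * v + b) → n ^ x * p ^ (k * (e′ + e)) ≤ n ^ (g′ + k * g) * d ^ (k * (e′ + e))
    weight-step x v b e g x′ e′ g′ new old refl = begin
      n ^ (x′ + y) * p ^ (k * (e′ + e))
        ≡⟨ cong₂ _*_ (^-split n x′ y) (split p) ⟩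
      (n ^ x′ * n ^ y) * (p ^ (k * e′) * p ^ (k * e))
        ≡⟨ interchange (n ^ x′) (n ^ y) (p ^ (k * e′)) (p ^ (k * e)) ⟩
      (n ^ x′ * p ^ (k * e′)) * (n ^ y * p ^ (k * e))
        ≤⟨ *-mono-≤ new old ⟩
      (n ^ g′ * d ^ (k * e′)) * (n ^ (k * g) * d ^ (k * e))
        ≡⟨ interchange (n ^ g′) (n ^ (k * g)) (d ^ (k * e′)) (d ^ (k * e)) ⟨
      (n ^ g′ * n ^ (k * g)) * (d ^ (k * e′) * d ^ (k * e))
        ≡⟨ cong₂ _*_ (^-split n g′ (k * g)) (split d) ⟨
      n ^ (g′ + k * g) * d ^ (k * (e′ + e)) ∎
      where
      open ≤-Reasoning
      y = k * v + b
      split : ∀ a → a ^ (k * (e′ + e)) ≡ a ^ (k * e′) * a ^ (k * e)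
      split a = trans (cong (a ^_) (*-distribˡ-+ k e′ e)) (^-split a (k * e′) (k * e))
      interchange : ∀ a b c d → (a * b) * (c * d) ≡ (a * c) * (b * d)
      interchange = solve 4 (λ a b c d → (a :* b) :* (c :* d) := (a :* c) :* (b :* d)) refl
        where open +-*-Solver

    module Step (s : State) (f : Vec (Fin n) k) (emb : Embeds H el f) where

      f-injective : Injective _≡_ _≡_ (lookup f)
      f-injective = lookup-injective (proj₁ emb)

      m : Fin k → Bool
      m i = not (memb (V s) (lookup f i))

      m-false : ∀ {i} → m i ≡ false → lookup f i ∈ V s
      m-false {i} eq with lookup f i ∈ᵛ? V s
      ... | yes i∈ = i∈

      m-true : ∀ {i} → m i ≡ true → lookup f i ∉ V s
      m-true {i} eq with lookup f i ∈ᵛ? V s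
      ... | no i∉ = i∉

      fresh : List (Fin n)
      fresh = map (lookup f) (marked m)

      fresh-length : length fresh ≡ length (marked m)
      fresh-length = length-map _ (marked m)

      V′ : List (Fin n)
      V′ = fresh ++ V s

      V′-unique : Unique V′
      V′-unique = Uniqueₚ.++⁺ (Uniqueₚ.map⁺ f-injective (filterᵗ-unique m (Uniqueₚ.allFin⁺ k))) (V-unique s)
        λ (a , b) → let i , i∈ , eq = ∈-map⁻ (lookup f) a in
          m-true (proj₂ (∈-filterᵗ⁻ m {allFin k} i∈)) (subst (_∈ V s) eq b)

      f⊆V′ : ∀ i → lookup f i ∈ V′
      f⊆V′ i with m i in eq
      ... | true = ∈-++⁺ˡ (∈-map⁺ (lookup f) (∈-filterᵗ⁺ m (∈-allFin i) eq))
      ... | false = ∈-++⁺ʳ fresh (m-false eq)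

      V′-size : ∀ {x} → length (V s) ≤ k * x → length V′ ≤ k * suc x
      V′-size {x} le = begin
        length V′                       ≡⟨ length-++ fresh ⟩
        length fresh + length (V s)     ≤⟨ +-mono-≤ (≤-trans (≤-reflexive fresh-length) (≤-trans (length-filter _ (allFin k)) (≤-reflexive (length-tabulate {n = k} id)))) le ⟩
        k + k * x                       ≡⟨ *-suc k x ⟨
        k * suc x                       ∎
        where open ≤-Reasoning

      module Add (el′ : List (Edge k)) (sub : el′ ⊆ el) (el′-unique : Unique el′)
                 (touch : ∀ {e} → e ∈ el′ → m (proj₁ e) ∨ m (proj₂ e) ≡ true) where

        es : List (Edge n)
        es = edgesOf el′ f

        -- Each new edge has an endpoint outside `V s`, whereas the edges of `E s` and of all
        -- earlier good copies lie inside `V s`. Both `E′-unique` and the edge-disjointness of good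
        -- copies come from this.
        outside : ∀ {e} → e ∈ es → ¬ (proj₁ e ∈ V s × proj₂ e ∈ V s)
        outside e∈ both with ∈-map⁻ _ e∈
        ... | (i , j) , ij∈ , refl with norm-ends⁻ {vs = V s} both | touch ij∈
        ... | i∈ , j∈ | t with m i in mi | m j in mj
        ... | true | _ = m-true mi i∈
        ... | false | true = m-true mj j∈

        E′ : List (Edge n)
        E′ = es ++ E s

        E′-unique : Unique E′
        E′-unique = Uniqueₚ.++⁺ (img-unique f-injective (el-ordered ∘ sub) el′-unique) (E-unique s)
          λ (a , b) → outside a (E-within s b)

        es-graph : All (InGraph H) es
        es-graph = All.tabulate λ e∈ → let _ , e′∈ , eq = ∈-map⁻ _ e∈ in
          All.lookup (proj₂ emb) (subst (_∈ edgesOf el f) (sym eq) (∈-map⁺ _ (sub e′∈)))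

        E′-graph : All (InGraph H) E′
        E′-graph = Allₚ.++⁺ es-graph (E-graph s)

        E′-within : Within V′ E′
        E′-within e∈ = [ (λ a → let _ , _ , eq = ∈-map⁻ _ a in
                             subst (λ e → proj₁ e ∈ V′ × proj₂ e ∈ V′) (sym eq) (norm-ends (f⊆V′ _) (f⊆V′ _)))
                       , (λ b → let x , y = E-within s b in ∈-++⁺ʳ fresh x , ∈-++⁺ʳ fresh y) ]′ (∈-++⁻ es e∈)

        E′-length : length E′ ≡ length el′ + length (E s)
        E′-length = trans (length-++ es) (cong (_+ length (E s)) (length-map _ el′))

      add-bad : 1 ≤ length (marked m) → 2 + length (marked m) ≤ k → State
      add-bad lo hi = record
        { V = V′ ; E = E′ ; good = good s ; bad = suc (bad s) ; V-unique = V′-unique ; E-unique = E′-unique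
        ; E-graph = E′-graph ; E-within = E′-within ; good-unique = good-unique s
        ; good-edges-unique = good-edges-unique s ; good-edges-graph = good-edges-graph s
        ; good-within = λ f∈ i → ∈-++⁺ʳ fresh (good-within s f∈ i)
        ; V-size = subst (λ x → length V′ ≤ k * x) (sym (+-suc (length (good s)) (bad s))) (V′-size (V-size s))
        ; weight = subst₂ (λ v e → n ^ (k * v + suc (bad s)) * p ^ (k * e) ≤ n ^ (k * length (good s)) * d ^ (k * e))
            (sym (trans (length-++ fresh) (cong (_+ length (V s)) fresh-length))) (sym E′-length)
            (weight-step _ (length (V s)) (bad s) (length (E s)) (length (good s)) (1 + k * length (marked m)) (length (touched m el)) 0
              (≤-trans (bad-weight m lo hi) (≤-reflexive (sym (*-identityˡ _)))) (weight s)
              (solve 4 (λ k v w b → k :* (v :+ w) :+ (con 1 :+ b) := con 1 :+ k :* v :+ (k :* w :+ b)) refl k (length (marked m)) (length (V s)) (bad s))) }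
        where
        open Add (touched m el) (λ e∈ → proj₁ (∈-filterᵗ⁻ _ {el} e∈)) (filterᵗ-unique _ el-unique) (λ e∈ → proj₂ (∈-filterᵗ⁻ _ {el} e∈))
        open +-*-Solver

      add-good : ∀ i₀ → m i₀ ≡ true → k ≤ 1 + length (marked m) → State
      add-good i₀ mi₀ hi = record
        { V = V′ ; E = E′ ; good = f ∷ good s ; bad = bad s ; V-unique = V′-unique ; E-unique = E′-unique
        ; E-graph = E′-graph ; E-within = E′-within
        ; good-unique = Allₚ.¬Any⇒All¬ _ (λ f∈ → m-true mi₀ (good-within s f∈ i₀)) ∷ good-unique s
        ; good-edges-unique = Uniqueₚ.++⁺ (img-unique f-injective el-ordered el-unique) (good-edges-unique s)
            (λ (a , b) → outside a (within (good s) (good-within s) b))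
        ; good-edges-graph = Allₚ.++⁺ es-graph (good-edges-graph s)
        ; good-within = λ { (here refl) i → f⊆V′ i ; (there f∈) i → ∈-++⁺ʳ fresh (good-within s f∈ i) }
        ; V-size = V′-size (V-size s)
        ; weight = subst₂ (λ v e → n ^ (k * v + bad s) * p ^ (k * e) ≤ n ^ (k * suc (length (good s))) * d ^ (k * e))
            (sym (trans (length-++ fresh) (cong (_+ length (V s)) fresh-length))) (sym E′-length)
            (≤-trans (weight-step _ (length (V s)) (bad s) (length (E s)) (length (good s)) (k * length (marked m)) (length el) k new (weight s)
              (solve 4 (λ k v w b → k :* (v :+ w) :+ b := k :* v :+ (k :* w :+ b)) refl k (length (marked m)) (length (V s)) (bad s)))
              (≤-reflexive (cong (λ x → n ^ x * d ^ (k * (length el + length (E s)))) (sym (*-suc k (length (good s))))))) }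
        where
        open +-*-Solver
        within : ∀ fs → (∀ {f} → f ∈ fs → ∀ i → lookup f i ∈ V s) → Within (V s) (concatMap (edgesOf el) fs)
        within fs h e∈ with ∈-concatMap⁻′ (edgesOf el) {fs} e∈
        ... | f , f∈ , e∈′ with ∈-map⁻ _ e∈′
        ... | _ , _ , refl = norm-ends (h f∈ _) (h f∈ _)
        -- At most one vertex is unmarked: two unmarked endpoints and k - 1 marked vertices would be
        -- k + 1 vertices of the pattern. Hence all edges of a good copy are new, which both its
        -- weight and edge-disjointness require.
        all-touched : ∀ {e} → e ∈ el → m (proj₁ e) ∨ m (proj₂ e) ≡ true
        all-touched {i , j} e∈ with m i in mi | m j in mj
        ... | true | _ = refl
        ... | false | true = refl
        ... | false | false = ⊥-elim (<⇒≱ (s≤s hi) (≤-trans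
              (length-⊆ {xs = i ∷ j ∷ marked m}
                (((λ { refl → <-irrefl refl (el-ordered e∈) }) ∷ unmarked mi) ∷ unmarked mj ∷ filterᵗ-unique m (Uniqueₚ.allFin⁺ k))
                (λ {x} _ → ∈-allFin x))
              (≤-reflexive (length-tabulate {n = k} id))))
          where
          unmarked : ∀ {i} → m i ≡ false → All (i ≢_) (marked m)
          unmarked mi = All.tabulate λ { x∈ refl → case trans (sym mi) (proj₂ (∈-filterᵗ⁻ m {allFin k} x∈)) of λ () }
        open Add el id el-unique all-touched
        new : n ^ (k * length (marked m)) * p ^ (k * length el) ≤ n ^ k * d ^ (k * length el)
        new = begin
          n ^ (k * length (marked m)) * p ^ (k * e)
            ≤⟨ *-monoˡ-≤ _ (^-monoʳ-≤ n {{>-nonZero (<-≤-trans z<s n≥2)}} (*-monoʳ-≤ k (≤-trans (length-filter _ (allFin k)) (≤-reflexive (length-tabulate {n = k} id))))) ⟩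
          n ^ (k * k) * p ^ (k * e)      ≡⟨ cong₂ _*_ (^-*-assoc n k k) (power p) ⟨
          (n ^ k) ^ k * (p ^ e) ^ k      ≡⟨ ^-distribʳ-* k (n ^ k) (p ^ e) ⟨
          (n ^ k * p ^ e) ^ k            ≤⟨ ^-monoˡ-≤ k good-weight ⟩
          (n * d ^ e) ^ k                ≡⟨ ^-distribʳ-* k n (d ^ e) ⟩
          n ^ k * (d ^ e) ^ k            ≡⟨ cong (n ^ k *_) (power d) ⟩
          n ^ k * d ^ (k * e)            ∎
          where
          open ≤-Reasoning
          e = length el
          power : ∀ a → (a ^ e) ^ k ≡ a ^ (k * e)
          power a = trans (^-*-assoc a e k) (cong (a ^_) (*-comm e k))

      result : ∃ λ s′ → V s ⊆ V s′ × (∀ i → lookup f i ∈ V s′)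
      result with marked m in eq
      -- All vertices are covered already; edges that are new nevertheless are not recorded, so the
      -- invariant is untouched.
      ... | [] = s , id , λ i → m-false (unmarked i)
        where
        unmarked : ∀ i → m i ≡ false
        unmarked i with m i in mi
        ... | false = refl
        ... | true = case subst (i ∈_) eq (∈-filterᵗ⁺ m (∈-allFin i) mi) of λ ()
      ... | i₀ ∷ _ with 2 + length (marked m) ≤? k
      ... | yes hi = add-bad (subst (1 ≤_) (cong length (sym eq)) (s≤s z≤n)) hi , ∈-++⁺ʳ fresh , f⊆V′
      ... | no hi = add-good i₀ (proj₂ (∈-filterᵗ⁻ m {allFin k} (subst (i₀ ∈_) (sym eq) (here refl)))) (≤-pred (≰⇒> hi)) , ∈-++⁺ʳ fresh , f⊆V′

    sweep : ∀ fs → ∃ λ s → ∀ {f} → f ∈ fs → Embeds H el f → ∀ i → lookup f i ∈ V s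
    sweep [] = initial , λ ()
    sweep (f ∷ fs) with sweep fs | embeds? H el f
    ... | s , h | yes emb = let s′ , mono , f∈ = Step.result s f emb in
      s′ , λ { (here refl) _ → f∈ ; (there m) emb′ i → mono (h m emb′ i) }
    ... | s , h | no ¬emb = s , λ { (here refl) emb → ⊥-elim (¬emb emb) ; (there m) → h m }

    bad≤ : ∀ s → bad s ≤ k * length (good s)
    bad≤ s = ≮⇒≥ λ lt → <⇒≱ (^-monoʳ-< n n≥2 lt) (*-cancelʳ-≤ (n ^ b) (n ^ (k * g)) (n ^ (k * v) * p ^ (k * e)) {{nz}} (begin
      n ^ b * (n ^ (k * v) * p ^ (k * e))   ≡⟨ solve 3 (λ x y z → x :* (y :* z) := y :* x :* z) refl (n ^ b) (n ^ (k * v)) (p ^ (k * e)) ⟩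
      n ^ (k * v) * n ^ b * p ^ (k * e)     ≡⟨ cong (_* p ^ (k * e)) (^-split n (k * v) b) ⟨
      n ^ (k * v + b) * p ^ (k * e)         ≤⟨ weight s ⟩
      n ^ (k * g) * d ^ (k * e)             ≤⟨ *-monoʳ-≤ (n ^ (k * g)) powered ⟩
      n ^ (k * g) * (n ^ (k * v) * p ^ (k * e)) ∎))
      where
      open ≤-Reasoning
      open +-*-Solver
      b = bad s
      g = length (good s)
      v = length (V s)
      e = length (E s)
      instance
        n≢0 : NonZero n
        n≢0 = >-nonZero (<-≤-trans z<s n≥2)
      nz : NonZero (n ^ (k * v) * p ^ (k * e))
      nz = m*n≢0 _ _ {{m^n≢0 n (k * v)}} {{m^n≢0 p (k * e)}}
      power : ∀ a e → (a ^ e) ^ k ≡ a ^ (k * e)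
      power a e = trans (^-*-assoc a e k) (cong (a ^_) (*-comm e k))
      powered : d ^ (k * e) ≤ n ^ (k * v) * p ^ (k * e)
      powered = begin
        d ^ (k * e)                ≡⟨ power d e ⟨
        (d ^ e) ^ k                ≤⟨ ^-monoˡ-≤ k (sparse-within (E-unique s) (E-graph s) (E-within s)) ⟩
        (n ^ v * p ^ e) ^ k        ≡⟨ ^-distribʳ-* k (n ^ v) (p ^ e) ⟩
        (n ^ v) ^ k * (p ^ e) ^ k  ≡⟨ cong₂ _*_ (power n v) (power p e) ⟩
        n ^ (k * v) * p ^ (k * e)  ∎

    swept : ∃ λ vs → Unique vs × (∀ {f} → Embeds H el f → ∀ i → lookup f i ∈ vs) ×
      length vs * d ^ length el ≤ k * suc k * (4 * (n ^ k * p ^ length el))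
    swept with sweep (allVec (allFin n) k)
    ... | s , h = V s , V-unique s , (λ {f} → h (allVec-complete f (λ i → ∈-allFin _))) , (begin
      length (V s) * d ^ e               ≤⟨ *-monoˡ-≤ _ (≤-trans (V-size s) (*-monoʳ-≤ k (+-monoʳ-≤ g (bad≤ s)))) ⟩
      k * (g + k * g) * d ^ e            ≡⟨ solve 3 (λ k g x → k :* (g :+ k :* g) :* x := k :* (con 1 :+ k) :* (g :* x)) refl k g (d ^ e) ⟩
      k * suc k * (g * d ^ e)            ≤⟨ *-monoʳ-≤ (k * suc k) (edge-disjoint el (good s) (good-unique s) (good-edges-unique s) (good-edges-graph s)) ⟩
      k * suc k * (4 * (n ^ k * p ^ e))  ∎)
      where
      open ≤-Reasoning
      open +-*-Solver
      g = length (good s)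
      e = length el

  -- Peeling off low-degree vertices.

  without : ∀ {n} → Fin n → List (Fin n) → List (Fin n)
  without u = filter (λ w → ¬? (u Finₚ.≟ w))

  -- Of the objects inside `W`, those through a low vertex `u` number at most `B`, and the others
  -- lie inside `without u W`. Lowness refers to the current `W`, not to the whole graph. The
  -- objects and the relation `_~_` are kept abstract because cliques are compared by their vertex
  -- sets and cycles by vertex and edge sets.
  peel : ∀ {n} (Low : List (Fin n) → Fin n → Set) →
    (∀ {W} → Unique W → 0 < length W → ∃ λ u → u ∈ W × Low W u) →
    ∀ {X : Set} (verts : X → List (Fin n)) (Good : X → Set) (_~_ : X → X → Set) (B : ℕ) →
    (∀ {x} → Good x → 0 < length (verts x)) →
    (∀ {W u} → Unique W → u ∈ W → Low W u → ∃ λ Z → length Z ≤ B ×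
       (∀ {x} → Good x → u ∈ verts x → verts x ⊆ W → ∃ λ z → z ∈ Z × z ~ x)) →
    ∀ W → Unique W → ∃ λ Z → length Z ≤ length W * B × (∀ {x} → Good x → verts x ⊆ W → ∃ λ z → z ∈ Z × z ~ x)
  peel {n} Low low {X} verts Good _~_ B nonempty through W u =
    let Z , len , cov = go (length W) W ≤-refl u in Z , len , cov
    where
    go : ∀ t W → length W ≤ t → Unique W → ∃ λ Z → length Z ≤ t * B × (∀ {x} → Good x → verts x ⊆ W → ∃ λ z → z ∈ Z × z ~ x)
    go zero [] _ _ = [] , z≤n , λ {x} gx sub → ⊥-elim (empty (verts x) (nonempty gx) sub)
      where
      empty : ∀ (vs : List (Fin n)) → 0 < length vs → vs ⊆ [] → ⊥
      empty (v ∷ vs) _ sub with sub (here refl)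
      ... | ()
    go (suc t) [] _ _ = go-nil
      where
      go-nil : ∃ λ Z → length Z ≤ suc t * B × (∀ {x} → Good x → verts x ⊆ [] → ∃ λ z → z ∈ Z × z ~ x)
      go-nil = let Z , len , cov = go t [] z≤n [] in Z , ≤-trans len (m≤n+m _ B) , cov
    go (suc t) W@(_ ∷ _) len uW with low uW z<s
    ... | u , u∈ , lowu with through uW u∈ lowu | go t (without u W) smaller (Uniqueₚ.filter⁺ (λ w → ¬? (u Finₚ.≟ w)) uW)
      where
      smaller : length (without u W) ≤ t
      smaller = ≤-pred (≤-trans (length-⊆ {xs = u ∷ without u W}
        (All.tabulate (λ w∈ → proj₂ (∈-filter⁻ (λ w → ¬? (u Finₚ.≟ w)) {xs = W} w∈)) ∷ Uniqueₚ.filter⁺ (λ w → ¬? (u Finₚ.≟ w)) uW)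
        (λ { (here refl) → u∈ ; (there w∈) → proj₁ (∈-filter⁻ (λ w → ¬? (u Finₚ.≟ w)) {xs = W} w∈) })) len)
    ... | Z₁ , len₁ , cov₁ | Z₂ , len₂ , cov₂ = Z₁ ++ Z₂
      , ≤-trans (≤-reflexive (length-++ Z₁)) (+-mono-≤ len₁ len₂)
      , λ {x} gx sub → cov gx sub (u ∈ᵛ? verts x)
      where
      cov : ∀ {x} → Good x → verts x ⊆ W → Dec (u ∈ verts x) → ∃ λ z → z ∈ Z₁ ++ Z₂ × z ~ x
      cov gx sub (yes u∈x) = let z , z∈ , eq = cov₁ gx u∈x sub in z , ∈-++⁺ˡ z∈ , eq
      cov gx sub (no u∉x) = let z , z∈ , eq = cov₂ gx (λ {w} w∈ → ∈-filter⁺ (λ w → ¬? (u Finₚ.≟ w)) (sub w∈) (λ { refl → u∉x w∈ })) in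
        z , ∈-++⁺ʳ Z₁ z∈ , eq

  -- Short paths between two vertices.

  pathEdges : ∀ {n} → List (Fin n) → List (Edge n)
  pathEdges (x ∷ y ∷ zs) = norm x y ∷ pathEdges (y ∷ zs)
  pathEdges _ = []

  last : ∀ {A : Set} → A → List A → A
  last c [] = c
  last c (y ∷ ys) = last y ys

  last-∈ : ∀ {A : Set} (c : A) xs → last c xs ∈ c ∷ xs
  last-∈ c [] = here refl
  last-∈ c (y ∷ ys) = there (last-∈ y ys)

  length-pathEdges : ∀ {n} (x : Fin n) xs → length (pathEdges (x ∷ xs)) ≡ length xs
  length-pathEdges x [] = refl
  length-pathEdges x (y ∷ zs) = cong suc (length-pathEdges y zs)

  pathEdges-within : ∀ {n} (xs : List (Fin n)) → Within xs (pathEdges xs)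
  pathEdges-within (x ∷ y ∷ zs) (here refl) = norm-ends (here refl) (there (here refl))
  pathEdges-within (x ∷ y ∷ zs) (there e∈) = let a , b = pathEdges-within (y ∷ zs) e∈ in there a , there b

  pathEdges-unique : ∀ {n} {xs : List (Fin n)} → Unique xs → Unique (pathEdges xs)
  pathEdges-unique {xs = []} _ = []
  pathEdges-unique {xs = x ∷ []} _ = []
  pathEdges-unique {xs = x ∷ y ∷ zs} (x∉ ∷ u) =
    All.tabulate (λ e∈ eq → let a , _ = norm-ends⁻ {i = x} {j = y} (subst (λ e → proj₁ e ∈ y ∷ zs × proj₂ e ∈ y ∷ zs) (sym eq) (pathEdges-within (y ∷ zs) e∈)) in
      All.lookup x∉ a refl)
    ∷ pathEdges-unique u

  interior-degree : ∀ {n} {x : Fin n} {xs v} → Unique (x ∷ xs) → v ∈ x ∷ xs → v ≢ x → v ≢ last x xs →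
    ∃ λ w₁ → ∃ λ w₂ → w₁ ≢ w₂ × norm v w₁ ∈ pathEdges (x ∷ xs) × norm v w₂ ∈ pathEdges (x ∷ xs)
  interior-degree u (here refl) v≢x _ = ⊥-elim (v≢x refl)
  interior-degree {x = x} {y ∷ []} u (there (here refl)) _ v≢l = ⊥-elim (v≢l refl)
  interior-degree {x = x} {y ∷ z ∷ zs} ((_ ∷ x≢z ∷ _) ∷ _) (there (here refl)) _ _ =
    x , z , x≢z , here (norm-comm y x) , there (here refl)
  interior-degree {x = x} {y ∷ z ∷ zs} (_ ∷ u@(y∉ ∷ _)) (there (there v∈)) v≢x v≢l
    with interior-degree u (there v∈) (λ eq → All.lookup y∉ v∈ (sym eq)) v≢l
  ... | w₁ , w₂ , ne , e₁ , e₂ = w₁ , w₂ , ne , there e₁ , there e₂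

  sumOver-indicator : ∀ {n} (c : Fin n) {vs} → Unique vs → sumOver (λ v → if does (v Finₚ.≟ c) then 2 else 0) vs ≤ 2
  sumOver-indicator c [] = z≤n
  sumOver-indicator c {x ∷ vs} (x∉ ∷ u) with x Finₚ.≟ c
  ... | no _ = sumOver-indicator c u
  ... | yes refl = ≤-reflexive (cong (2 +_) (zeros vs x∉))
    where
    zeros : ∀ vs → All (c ≢_) vs → sumOver (λ v → if does (v Finₚ.≟ c) then 2 else 0) vs ≡ 0
    zeros [] _ = refl
    zeros (v ∷ vs) (c≢v ∷ h) with v Finₚ.≟ c
    ... | yes refl = ⊥-elim (c≢v refl)
    ... | no _ = zeros vs h

  -- Put q = p/d, y = X/d > 1, ℓ = ℓ′ + 1 and g = e - v. Sparsity gives 1 ≤ (nq)^v q^g ≤ y^v q^g.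
  -- The two size bounds give s ≤ g + 2 and v ≤ 2ℓ + ℓ′ g, so that 1 ≤ y^(2ℓ + ℓ′ g) q^g. As q ≤
  -- 1/y^ℓ by `short`, the right-hand side is at most y^(2ℓ - g), which forces g ≤ 2ℓ.
  excess-bound : ∀ {n p d X ℓ′ v e s} → 0 < d → 0 < X → d < X → n * p ≤ X → X ^ suc ℓ′ * p ≤ d ^ suc (suc ℓ′) →
    d ^ e ≤ n ^ v * p ^ e → v ≤ 2 + ℓ′ * s → v + s ≤ e + 2 → e ≤ v + 2 * suc ℓ′
  excess-bound {n} {p} {d} {X} {ℓ′} {v} {e} {s} d>0 X>0 d<X np≤X short sparse v≤ vs≤ with e ≤? v
  ... | yes e≤v = ≤-trans e≤v (m≤m+n v _)
  ... | no e≰v = subst (_≤ v + 2 * ℓ) (m+[n∸m]≡n (<⇒≤ (≰⇒> e≰v))) (+-monoʳ-≤ v g≤)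
    where
    open ≤-Reasoning
    open +-*-Solver
    instance
      d≢0 : NonZero d
      d≢0 = >-nonZero d>0
      X≢0 : NonZero X
      X≢0 = >-nonZero X>0
    ℓ = suc ℓ′
    g = e ∸ v
    e≡ : v + g ≡ e
    e≡ = m+[n∸m]≡n (<⇒≤ (≰⇒> e≰v))
    s≤ : s ≤ g + 2
    s≤ = +-cancelˡ-≤ v s (g + 2) (≤-trans vs≤ (≤-reflexive (trans (cong (_+ 2) (sym e≡)) (+-assoc v g 2))))
    w = 2 * ℓ + ℓ′ * g
    v≤w : v ≤ w
    v≤w = ≤-trans v≤ (≤-trans (+-monoʳ-≤ 2 (*-monoʳ-≤ ℓ′ s≤))
      (≤-reflexive (solve 2 (λ l g → con 2 :+ l :* (g :+ con 2) := con 2 :* (con 1 :+ l) :+ l :* g) refl ℓ′ g)))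
    step₁ : d ^ v * d ^ g ≤ X ^ v * p ^ g
    step₁ = begin
      d ^ v * d ^ g               ≡⟨ ^-split d v g ⟨
      d ^ (v + g)                 ≡⟨ cong (d ^_) e≡ ⟩
      d ^ e                       ≤⟨ sparse ⟩
      n ^ v * p ^ e               ≡⟨ cong (λ z → n ^ v * p ^ z) e≡ ⟨
      n ^ v * p ^ (v + g)         ≡⟨ cong (n ^ v *_) (^-split p v g) ⟩
      n ^ v * (p ^ v * p ^ g)     ≡⟨ *-assoc (n ^ v) _ _ ⟨
      n ^ v * p ^ v * p ^ g       ≡⟨ cong (_* p ^ g) (^-distribʳ-* v n p) ⟨
      (n * p) ^ v * p ^ g         ≤⟨ *-monoˡ-≤ _ (^-monoˡ-≤ v np≤X) ⟩
      X ^ v * p ^ g               ∎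
    step₂ : d ^ w * d ^ g ≤ X ^ w * p ^ g
    step₂ = begin
      d ^ w * d ^ g                     ≡⟨ cong (λ z → d ^ z * d ^ g) (m∸n+n≡m v≤w) ⟨
      d ^ (r + v) * d ^ g               ≡⟨ trans (cong (_* d ^ g) (^-split d r v)) (*-assoc (d ^ r) _ _) ⟩
      d ^ r * (d ^ v * d ^ g)           ≤⟨ *-mono-≤ (^-monoˡ-≤ r (<⇒≤ d<X)) step₁ ⟩
      X ^ r * (X ^ v * p ^ g)           ≡⟨ trans (cong (_* p ^ g) (^-split X r v)) (*-assoc (X ^ r) _ _) ⟨
      X ^ (r + v) * p ^ g               ≡⟨ cong (λ z → X ^ z * p ^ g) (m∸n+n≡m v≤w) ⟩
      X ^ w * p ^ g                     ∎
      where r = w ∸ v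
    step₃ : d ^ (2 * ℓ) * X ^ g ≤ X ^ (2 * ℓ) * d ^ g
    step₃ = *-cancelʳ-≤ _ _ (d ^ (ℓ * g)) {{m^n≢0 d (ℓ * g)}} (begin
      d ^ (2 * ℓ) * X ^ g * d ^ (ℓ * g)
        ≡⟨ cong (d ^ (2 * ℓ) * X ^ g *_) (trans (cong (d ^_) (+-comm g (ℓ′ * g))) (^-split d (ℓ′ * g) g)) ⟩
      d ^ (2 * ℓ) * X ^ g * (d ^ (ℓ′ * g) * d ^ g)
        ≡⟨ solve 4 (λ a b c e → a :* b :* (c :* e) := a :* c :* e :* b) refl (d ^ (2 * ℓ)) (X ^ g) (d ^ (ℓ′ * g)) (d ^ g) ⟩
      d ^ (2 * ℓ) * d ^ (ℓ′ * g) * d ^ g * X ^ g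
        ≡⟨ cong (λ z → z * d ^ g * X ^ g) (^-split d (2 * ℓ) (ℓ′ * g)) ⟨
      d ^ w * d ^ g * X ^ g
        ≤⟨ *-monoˡ-≤ (X ^ g) step₂ ⟩
      X ^ w * p ^ g * X ^ g
        ≡⟨ cong (λ z → z * p ^ g * X ^ g) (trans (^-split X (2 * ℓ) (ℓ′ * g)) (cong (X ^ (2 * ℓ) *_) (sym (^-*-assoc X ℓ′ g)))) ⟩
      X ^ (2 * ℓ) * (X ^ ℓ′) ^ g * p ^ g * X ^ g
        ≡⟨ solve 4 (λ a b c e → a :* b :* c :* e := a :* (e :* b :* c)) refl (X ^ (2 * ℓ)) ((X ^ ℓ′) ^ g) (p ^ g) (X ^ g) ⟩
      X ^ (2 * ℓ) * (X ^ g * (X ^ ℓ′) ^ g * p ^ g)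
        ≡⟨ cong (X ^ (2 * ℓ) *_) (trans (^-distribʳ-* g (X ^ ℓ) p) (cong (_* p ^ g) (^-distribʳ-* g X (X ^ ℓ′)))) ⟨
      X ^ (2 * ℓ) * (X ^ ℓ * p) ^ g
        ≤⟨ *-monoʳ-≤ (X ^ (2 * ℓ)) (^-monoˡ-≤ g short) ⟩
      X ^ (2 * ℓ) * (d ^ suc ℓ) ^ g
        ≡⟨ cong (X ^ (2 * ℓ) *_) (trans (^-*-assoc d (suc ℓ) g) (^-split d g (ℓ * g))) ⟩
      X ^ (2 * ℓ) * (d ^ g * d ^ (ℓ * g))
        ≡⟨ *-assoc (X ^ (2 * ℓ)) _ _ ⟨
      X ^ (2 * ℓ) * d ^ g * d ^ (ℓ * g) ∎)
    g≤ : g ≤ 2 * ℓ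
    g≤ = ≮⇒≥ λ lt → <⇒≱ (^-monoˡ-< (g ∸ 2 * ℓ) {{>-nonZero (m<n⇒0<n∸m lt)}} d<X)
      (*-cancelˡ-≤ (d ^ (2 * ℓ) * X ^ (2 * ℓ)) {{m*n≢0 _ _ {{m^n≢0 d (2 * ℓ)}} {{m^n≢0 X (2 * ℓ)}}}} (begin
        d ^ (2 * ℓ) * X ^ (2 * ℓ) * X ^ (g ∸ 2 * ℓ)    ≡⟨ *-assoc (d ^ (2 * ℓ)) _ _ ⟩
        d ^ (2 * ℓ) * (X ^ (2 * ℓ) * X ^ (g ∸ 2 * ℓ))  ≡⟨ cong (d ^ (2 * ℓ) *_) (trans (sym (^-split X (2 * ℓ) _)) (cong (X ^_) (m+[n∸m]≡n (<⇒≤ lt)))) ⟩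
        d ^ (2 * ℓ) * X ^ g                            ≤⟨ step₃ ⟩
        X ^ (2 * ℓ) * d ^ g                            ≡⟨ cong (X ^ (2 * ℓ) *_) (trans (cong (d ^_) (sym (m+[n∸m]≡n (<⇒≤ lt)))) (^-split d (2 * ℓ) _)) ⟩
        X ^ (2 * ℓ) * (d ^ (2 * ℓ) * d ^ (g ∸ 2 * ℓ))  ≡⟨ solve 3 (λ a b c → a :* (b :* c) := b :* a :* c) refl (X ^ (2 * ℓ)) (d ^ (2 * ℓ)) (d ^ (g ∸ 2 * ℓ)) ⟩
        d ^ (2 * ℓ) * X ^ (2 * ℓ) * d ^ (g ∸ 2 * ℓ)    ∎))

  IsPath : ∀ {n} → Graph n → Fin n → Fin n → List (Fin n) → Set
  IsPath H c b xs = Unique (c ∷ xs) × All (InGraph H) (pathEdges (c ∷ xs)) × last c xs ≡ b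

  isPath? : ∀ {n} (H : Graph n) c b → Decidable (IsPath H c b)
  isPath? H c b xs = unique? (c ∷ xs) ×-dec All.all? (inGraph? H) (pathEdges (c ∷ xs)) ×-dec (last c xs Finₚ.≟ b)
    where open import Data.List.Relation.Unary.Unique.DecPropositional Finₚ._≟_ using (unique?)

  last∈rest : ∀ {A : Set} (c : A) {xs} → 0 < length xs → last c xs ∈ xs
  last∈rest c {y ∷ ys} _ = last-∈ y ys

  filterᵗ-mono : ∀ {A : Set} {P Q : A → Bool} {xs} → Unique xs → (∀ {x} → P x ≡ true → Q x ≡ true) →
    length (filterᵗ P xs) ≤ length (filterᵗ Q xs)
  filterᵗ-mono {P = P} {Q} {xs} u h = length-⊆ (filterᵗ-unique P u) (λ m → let m∈ , px = ∈-filterᵗ⁻ P {xs} m in ∈-filterᵗ⁺ Q m∈ (h px))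

  -- The union of all paths of length ℓ from c to b has excess |E| − |V| ≤ 2ℓ: every path
  -- that contributes something new adds more edges than vertices.  All vertices other than c
  -- and b have degree at least 2, so the degrees along a path add up to O(ℓ).
  module Paths {n : ℕ} (H : Graph n) (p d : ℕ) (p>0 : 0 < p) (p≤d : p ≤ d) (sp : Sparseᴺ H p d)
    {X ℓ′ : ℕ} (d<X : d < X) (np≤X : n * p ≤ X) (short : X ^ suc ℓ′ * p ≤ d ^ suc (suc ℓ′))
    {c b : Fin n} (c≢b : c ≢ b)
    where
    open Host H p d p>0 p≤d sp

    nbE : List (Edge n) → Fin n → List (Fin n)
    nbE E v = filterᵗ (closure E v) (allFin n)

    nbE-mono : ∀ {E E′} → E ⊆ E′ → ∀ v → length (nbE E v) ≤ length (nbE E′ v)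
    nbE-mono {E} {E′} sub v = filterᵗ-mono (Uniqueₚ.allFin⁺ n) (λ {w} t → dec-true (norm v w ∈ᵉ? E′) (sub (does-true⁻ (norm v w ∈ᵉ? E) t)))

    record State : Set where
      field
        V : List (Fin n)
        E : List (Edge n)
        steps : ℕ
        V-unique : Unique V
        E-unique : Unique E
        E-graph : All (InGraph H) E
        E-within : Within V E
        c∈V : c ∈ V
        b∈V : b ∈ V
        -- A path adds at most its ℓ′ interior vertices, and at least one edge more than vertices;
        -- both occurrences of 2 stand for the ends `c` and `b`, which are present from the start.
        V-size : length V ≤ 2 + ℓ′ * steps
        E-size : length V + steps ≤ length E + 2
        degree : ∀ {v} → v ∈ V → v ≢ c → v ≢ b → 2 ≤ length (nbE E v)
    open State

    initial : State
    initial = record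
      { V = c ∷ b ∷ [] ; E = [] ; steps = 0 ; V-unique = (c≢b ∷ []) ∷ [] ∷ [] ; E-unique = [] ; E-graph = []
      ; E-within = λ () ; c∈V = here refl ; b∈V = there (here refl) ; V-size = m≤m+n 2 _ ; E-size = ≤-refl
      ; degree = λ { (here refl) ne _ → ⊥-elim (ne refl) ; (there (here refl)) _ ne → ⊥-elim (ne refl) } }

    module Step (s : State) {xs : List (Fin n)} (len : length xs ≡ suc ℓ′) (path : IsPath H c b xs) where

      ∉V? : Decidable (λ v → ¬ (v ∈ V s))
      ∉V? v = ¬? (v ∈ᵛ? V s)

      ∉E? : Decidable (λ e → ¬ (e ∈ E s))
      ∉E? e = ¬? (e ∈ᵉ? E s)

      newV : List (Fin n) → List (Fin n)
      newV = filter ∉V?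

      newE : List (Fin n) → List (Edge n)
      newE ys = filter ∉E? (pathEdges ys)

      edge-new : ∀ x y zs → x ∉ V s ⊎ y ∉ V s → length (newE (x ∷ y ∷ zs)) ≡ suc (length (newE (y ∷ zs)))
      edge-new x y zs h = cong length (filter-accept ∉E? {xs = pathEdges (y ∷ zs)}
        (λ e∈ → let x∈ , y∈ = norm-ends⁻ (E-within s e∈) in [ (λ x∉ → x∉ x∈) , (λ y∉ → y∉ y∈) ]′ h))

      edge-any : ∀ x y zs → length (newE (y ∷ zs)) ≤ length (newE (x ∷ y ∷ zs))
      edge-any x y zs with ∉E? (norm x y)
      ... | yes h = ≤-trans (n≤1+n _) (≤-reflexive (sym (cong length (filter-accept ∉E? {xs = pathEdges (y ∷ zs)} h))))
      ... | no h = ≤-reflexive (sym (cong length (filter-reject ∉E? {xs = pathEdges (y ∷ zs)} h)))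

      mutual
        -- Charge every new vertex to the path edge leaving it, which is new as well. The path ends
        -- at an old vertex, so each new vertex has such an edge, and the edge entering the first
        -- new vertex is left over; this makes the inequality strict. `from-new` is the same count
        -- started at a new vertex, where no edge is left over.
        from-old : ∀ x ys → x ∈ V s → last x ys ∈ V s → newV ys ≡ [] ⊎ length (newV ys) < length (newE (x ∷ ys))
        from-old x [] _ _ = inj₁ refl
        from-old x (y ∷ ys) x∈ l∈ = from-old′ x y ys (y ∈ᵛ? V s) l∈

        from-old′ : ∀ x y ys → Dec (y ∈ V s) → last y ys ∈ V s → newV (y ∷ ys) ≡ [] ⊎ length (newV (y ∷ ys)) < length (newE (x ∷ y ∷ ys))
        from-old′ x y ys (no y∉) l∈ = inj₂ (≤-trans (s≤s (from-new y ys y∉ l∈)) (≤-reflexive (sym (edge-new x y ys (inj₂ y∉)))))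
        from-old′ x y ys (yes y∈) l∈ with from-old y ys y∈ l∈
        ... | inj₁ eq = inj₁ (trans (filter-reject ∉V? (λ y∉ → y∉ y∈)) eq)
        ... | inj₂ lt = inj₂ (subst (_< length (newE (x ∷ y ∷ ys))) (sym (cong length (filter-reject ∉V? {xs = ys} (λ y∉ → y∉ y∈)))) (≤-trans lt (edge-any x y ys)))

        from-new : ∀ x ys → x ∉ V s → last x ys ∈ V s → length (newV (x ∷ ys)) ≤ length (newE (x ∷ ys))
        from-new x [] x∉ l∈ = ⊥-elim (x∉ l∈)
        from-new x (y ∷ ys) x∉ l∈ = begin
          length (newV (x ∷ y ∷ ys))        ≡⟨ cong length (filter-accept ∉V? {xs = y ∷ ys} x∉) ⟩
          suc (length (newV (y ∷ ys)))      ≤⟨ s≤s (from-any y ys (y ∈ᵛ? V s) l∈) ⟩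
          suc (length (newE (y ∷ ys)))      ≡⟨ edge-new x y ys (inj₁ x∉) ⟨
          length (newE (x ∷ y ∷ ys))        ∎
          where open ≤-Reasoning

        from-any : ∀ y ys → Dec (y ∈ V s) → last y ys ∈ V s → length (newV (y ∷ ys)) ≤ length (newE (y ∷ ys))
        from-any y ys (no y∉) l∈ = from-new y ys y∉ l∈
        from-any y ys (yes y∈) l∈ = subst (_≤ length (newE (y ∷ ys))) (sym (cong length (filter-reject ∉V? {xs = ys} (λ y∉ → y∉ y∈))))
          ([ (λ eq → subst (_≤ length (newE (y ∷ ys))) (sym (cong length eq)) z≤n) , <⇒≤ ]′ (from-old y ys y∈ l∈))

      ps : List (Fin n)
      ps = c ∷ xs

      ps-unique : Unique ps
      ps-unique = proj₁ path

      last∈V : last c xs ∈ V s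
      last∈V = subst (_∈ V s) (sym (proj₂ (proj₂ path))) (b∈V s)

      V′ : List (Fin n)
      V′ = newV xs ++ V s

      E′ : List (Edge n)
      E′ = newE ps ++ E s

      xs⊆V′ : xs ⊆ V′
      xs⊆V′ {v} v∈ with v ∈ᵛ? V s
      ... | yes h = ∈-++⁺ʳ (newV xs) h
      ... | no h = ∈-++⁺ˡ (∈-filter⁺ ∉V? v∈ h)

      ps⊆V′ : ps ⊆ V′
      ps⊆V′ (here refl) = ∈-++⁺ʳ (newV xs) (c∈V s)
      ps⊆V′ (there v∈) = xs⊆V′ v∈

      edges⊆E′ : pathEdges ps ⊆ E′
      edges⊆E′ {e} e∈ with e ∈ᵉ? E s
      ... | yes h = ∈-++⁺ʳ (newE ps) h
      ... | no h = ∈-++⁺ˡ (∈-filter⁺ ∉E? e∈ h)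

      newV-small : length (newV xs) ≤ ℓ′
      newV-small = ≤-pred (≤-trans (length-⊆ {xs = b ∷ newV xs}
        (All.tabulate (λ { v∈ refl → proj₂ (∈-filter⁻ ∉V? {xs = xs} v∈) (b∈V s) }) ∷ Uniqueₚ.filter⁺ ∉V? (AllPairs.tail ps-unique))
        (λ { (here refl) → subst (_∈ xs) (proj₂ (proj₂ path)) (last∈rest c (subst (0 <_) (sym len) z<s))
           ; (there v∈) → proj₁ (∈-filter⁻ ∉V? {xs = xs} v∈) }))
        (≤-reflexive len))

      extend : length (newV xs) < length (newE ps) → State
      extend lt = record
        { V = V′ ; E = E′ ; steps = suc (steps s)
        ; V-unique = Uniqueₚ.++⁺ (Uniqueₚ.filter⁺ ∉V? (AllPairs.tail ps-unique)) (V-unique s)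
            (λ (x , y) → proj₂ (∈-filter⁻ ∉V? {xs = xs} x) y)
        ; E-unique = Uniqueₚ.++⁺ (Uniqueₚ.filter⁺ ∉E? (pathEdges-unique ps-unique)) (E-unique s)
            (λ (x , y) → proj₂ (∈-filter⁻ ∉E? {xs = pathEdges ps} x) y)
        ; E-graph = Allₚ.++⁺ (Allₚ.filter⁺ ∉E? (proj₁ (proj₂ path))) (E-graph s)
        ; E-within = λ e∈ → [ (λ h → let x , y = pathEdges-within ps (proj₁ (∈-filter⁻ ∉E? {xs = pathEdges ps} h)) in ps⊆V′ x , ps⊆V′ y)
                            , (λ h → let x , y = E-within s h in ∈-++⁺ʳ (newV xs) x , ∈-++⁺ʳ (newV xs) y) ]′ (∈-++⁻ (newE ps) e∈)
        ; c∈V = ∈-++⁺ʳ (newV xs) (c∈V s) ; b∈V = ∈-++⁺ʳ (newV xs) (b∈V s)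
        ; V-size = begin
            length V′                            ≡⟨ length-++ (newV xs) ⟩
            length (newV xs) + length (V s)      ≤⟨ +-mono-≤ newV-small (V-size s) ⟩
            ℓ′ + (2 + ℓ′ * steps s)              ≡⟨ solve 2 (λ l s → l :+ (con 2 :+ l :* s) := con 2 :+ l :* (con 1 :+ s)) refl ℓ′ (steps s) ⟩
            2 + ℓ′ * suc (steps s)               ∎
        ; E-size = begin
            length V′ + suc (steps s)                             ≡⟨ cong (_+ suc (steps s)) (length-++ (newV xs)) ⟩
            length (newV xs) + length (V s) + suc (steps s)       ≡⟨ solve 3 (λ a v s → a :+ v :+ (con 1 :+ s) := (con 1 :+ a) :+ (v :+ s)) refl (length (newV xs)) (length (V s)) (steps s) ⟩
            suc (length (newV xs)) + (length (V s) + steps s)     ≤⟨ +-mono-≤ lt (E-size s) ⟩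
            length (newE ps) + (length (E s) + 2)                 ≡⟨ +-assoc (length (newE ps)) _ 2 ⟨
            length (newE ps) + length (E s) + 2                   ≡⟨ cong (_+ 2) (length-++ (newE ps)) ⟨
            length E′ + 2                                         ∎
        ; degree = λ v∈ v≢c v≢b → [ (λ h → interior (proj₁ (∈-filter⁻ ∉V? {xs = xs} h)) v≢c v≢b)
                                  , (λ h → ≤-trans (degree s h v≢c v≢b) (nbE-mono (∈-++⁺ʳ (newE ps)) _)) ]′ (∈-++⁻ (newV xs) v∈) }
        where
        open ≤-Reasoning
        open +-*-Solver
        interior : ∀ {v} → v ∈ xs → v ≢ c → v ≢ b → 2 ≤ length (nbE E′ v)
        interior {v} v∈ v≢c v≢b with interior-degree ps-unique (there v∈) v≢c (λ eq → v≢b (trans eq (proj₂ (proj₂ path))))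
        ... | w₁ , w₂ , ne , e₁ , e₂ = length-⊆ {xs = w₁ ∷ w₂ ∷ []} ((ne ∷ []) ∷ [] ∷ [])
          (λ { (here refl) → member e₁ ; (there (here refl)) → member e₂ })
          where
          member : ∀ {w} → norm v w ∈ pathEdges ps → w ∈ nbE E′ v
          member {w} e∈ = ∈-filterᵗ⁺ (closure E′ v) (∈-allFin w) (dec-true (norm v w ∈ᵉ? E′) (edges⊆E′ e∈))

      result : ∃ λ s′ → V s ⊆ V s′ × E s ⊆ E s′ × ps ⊆ V s′ × pathEdges ps ⊆ E s′
      result with from-old c xs (c∈V s) last∈V | newE ps in eqE
      ... | inj₂ lt | _ = extend lt , ∈-++⁺ʳ (newV xs) , ∈-++⁺ʳ (newE ps) , ps⊆V′ , edges⊆E′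
      ... | inj₁ eqV | [] = s , id , id , (λ v∈ → subst (λ l → _ ∈ l ++ V s) eqV (ps⊆V′ v∈)) , (λ e∈ → subst (λ l → _ ∈ l ++ E s) eqE (edges⊆E′ e∈))
      -- Only old vertices but a new edge: the excess still grows, so the path counts as a step.
      ... | inj₁ eqV | e ∷ es = extend (subst₂ (λ l l′ → length l < length l′) (sym eqV) (sym eqE) z<s)
          , ∈-++⁺ʳ (newV xs) , ∈-++⁺ʳ (newE ps) , ps⊆V′ , edges⊆E′

    Covered : State → List (Fin n) → Set
    Covered s xs = c ∷ xs ⊆ V s × pathEdges (c ∷ xs) ⊆ E s

    union : ∀ xss → (∀ {xs} → xs ∈ xss → length xs ≡ suc ℓ′) → ∃ λ s → ∀ {xs} → xs ∈ xss → IsPath H c b xs → Covered s xs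
    union [] _ = initial , λ ()
    union (xs ∷ xss) len with union xss (len ∘ there) | isPath? H c b xs
    ... | s , h | no ¬path = s , λ { (here refl) path → ⊥-elim (¬path path) ; (there m) → h m }
    ... | s , h | yes path = let s′ , V⊆ , E⊆ , cov = Step.result s (len (here refl)) path in
      s′ , λ { (here refl) _ → cov ; (there m) path′ → let x , y = h m path′ in (λ z → V⊆ (x z)) , (λ z → E⊆ (y z)) }

    next : State → List (Fin n) → List (Fin n)
    next s [] = []
    next s (v ∷ _) = nbE (E s) v

    budget : ℕ
    budget = 6 * suc ℓ′ + 6

    -- All vertices of the union other than `c` and `b` have degree at least 2, so the surplus over
    -- 2, summed over `V s`, is at most 2|E| - 2|V| + 4 ≤ 4ℓ + 4, where ℓ = ℓ′ + 1. The ℓ + 1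
    -- vertices of the path add 2 each, which makes 6ℓ + 6.
    degree-sum : ∀ s {xs} → Unique (c ∷ xs) → c ∷ xs ⊆ V s → length xs ≡ suc ℓ′ → sumOver (length ∘ nbE (E s)) (c ∷ xs) ≤ budget
    degree-sum s {xs} u sub len = begin
      sumOver δ ps                              ≤⟨ sumOver-mono ps (λ {v} _ → ≤-trans (m≤n+m∸n (δ v) 2) (≤-reflexive (+-comm 2 _))) ⟩
      sumOver (λ v → (δ v ∸ 2) + 2) ps          ≡⟨ trans (sumOver-+ (λ v → δ v ∸ 2) (λ _ → 2) ps) (cong (sumOver (λ v → δ v ∸ 2) ps +_) (sumOver-const 2 ps)) ⟩
      sumOver (λ v → δ v ∸ 2) ps + length ps * 2 ≤⟨ +-mono-≤ (≤-trans (sumOver-⊆ (λ v → δ v ∸ 2) u sub) surplus) (≤-reflexive (cong (λ l → suc l * 2) len)) ⟩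
      2 * (2 * ℓ) + 4 + suc ℓ * 2               ≡⟨ solve 1 (λ l → con 2 :* (con 2 :* l) :+ con 4 :+ (con 1 :+ l) :* con 2 := con 6 :* l :+ con 6) refl ℓ ⟩
      budget                                    ∎
      where
      open ≤-Reasoning
      open +-*-Solver
      ℓ = suc ℓ′
      ps = c ∷ xs
      δ : Fin n → ℕ
      δ v = length (nbE (E s) v)
      ind : Fin n → Fin n → ℕ
      ind x v = if does (v Finₚ.≟ x) then 2 else 0
      pointwise : ∀ {v} → v ∈ V s → (δ v ∸ 2) + 2 ≤ δ v + (ind c v + ind b v)
      pointwise {v} v∈ with v Finₚ.≟ c | v Finₚ.≟ b
      ... | yes _ | yes _ = +-mono-≤ (m∸n≤m (δ v) 2) (m≤m+n 2 2)
      ... | yes _ | no _ = +-mono-≤ (m∸n≤m (δ v) 2) ≤-refl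
      ... | no _ | yes _ = +-mono-≤ (m∸n≤m (δ v) 2) ≤-refl
      ... | no v≢c | no v≢b = ≤-reflexive (trans (m∸n+n≡m (degree s v∈ v≢c v≢b)) (sym (+-identityʳ _)))
      excess : length (E s) ≤ length (V s) + 2 * ℓ
      excess = excess-bound {n} {p} {d} {X} {ℓ′} d>0 (<-trans d>0 d<X) d<X np≤X short
        (sparse-within (E-unique s) (E-graph s) (E-within s)) (V-size s) (E-size s)
      surplus : sumOver (λ v → δ v ∸ 2) (V s) ≤ 2 * (2 * ℓ) + 4
      surplus = +-cancelʳ-≤ (length (V s) * 2) _ _ (begin
        sumOver (λ v → δ v ∸ 2) (V s) + length (V s) * 2
          ≡⟨ trans (sumOver-+ (λ v → δ v ∸ 2) (λ _ → 2) (V s)) (cong (sumOver (λ v → δ v ∸ 2) (V s) +_) (sumOver-const 2 (V s))) ⟨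
        sumOver (λ v → (δ v ∸ 2) + 2) (V s)
          ≤⟨ sumOver-mono (V s) pointwise ⟩
        sumOver (λ v → δ v + (ind c v + ind b v)) (V s)
          ≡⟨ trans (sumOver-+ δ (λ v → ind c v + ind b v) (V s)) (cong (sumOver δ (V s) +_) (sumOver-+ (ind c) (ind b) (V s))) ⟩
        sumOver δ (V s) + (sumOver (ind c) (V s) + sumOver (ind b) (V s))
          ≤⟨ +-mono-≤ (handshake (nbE (E s)) (λ v → filterᵗ-unique _ (Uniqueₚ.allFin⁺ n))
               (λ {v} {w} m → does-true⁻ (norm v w ∈ᵉ? E s) (proj₂ (∈-filterᵗ⁻ (closure (E s) v) {allFin n} m))) (V-unique s))
             (+-mono-≤ (sumOver-indicator c (V-unique s)) (sumOver-indicator b (V-unique s))) ⟩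
        2 * length (E s) + 4
          ≤⟨ +-monoˡ-≤ 4 (*-monoʳ-≤ 2 excess) ⟩
        2 * (length (V s) + 2 * ℓ) + 4
          ≡⟨ solve 2 (λ v l → con 2 :* (v :+ con 2 :* l) :+ con 4 := con 2 :* (con 2 :* l) :+ con 4 :+ v :* con 2) refl (length (V s)) ℓ ⟩
        2 * (2 * ℓ) + 4 + length (V s) * 2 ∎)

    -- Walks inside the union are coded with Y = 1. The cost of a path is then a sum of degrees in
    -- the union, bounded by `budget`, and the path is determined by at most ℓ′ + 1 + `budget`
    -- binary decisions.
    bounded : ∃ λ Z → length Z ≤ 2 ^ (suc ℓ′ + budget) × (∀ {xs} → length xs ≡ suc ℓ′ → IsPath H c b xs → xs ∈ Z)
    bounded with union (map toList (allVec (allFin n) (suc ℓ′))) lens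
      where
      lens : ∀ {xs} → xs ∈ map toList (allVec (allFin n) (suc ℓ′)) → length xs ≡ suc ℓ′
      lens m with ∈-map⁻ toList m
      ... | v , _ , refl = Vecₚ.length-toList v
    ... | s , cov = walks (c ∷ []) (nbE (E s) c) (suc ℓ′) budget
      , ≤-trans (length-walks (c ∷ []) (nbE (E s) c) (suc ℓ′) budget) (≤-reflexive (trans (cong (_* 2 ^ (suc ℓ′ + budget)) (^-zeroˡ (suc ℓ′))) (*-identityˡ _)))
      , covers
      where
      open Walks (next s) 1
      fits : ∀ hist x ys → pathEdges (x ∷ ys) ⊆ E s → Fits (x ∷ hist) (nbE (E s) x) ys
      fits hist x [] _ = tt
      fits hist x (y ∷ ys) sub = ∈-filterᵗ⁺ (closure (E s) x) (∈-allFin y) (dec-true (norm x y ∈ᵉ? E s) (sub (here refl)))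
        , fits (x ∷ hist) y ys (sub ∘ there)
      cost≤ : ∀ hist x ys → cost (x ∷ hist) (nbE (E s) x) ys ≤ sumOver (length ∘ nbE (E s)) (x ∷ ys)
      cost≤ hist x [] = z≤n
      cost≤ hist x (y ∷ ys) = +-monoʳ-≤ (length (nbE (E s) x)) (cost≤ (x ∷ hist) y ys)
      covers : ∀ {xs} → length xs ≡ suc ℓ′ → IsPath H c b xs → xs ∈ walks (c ∷ []) (nbE (E s) c) (suc ℓ′) budget
      covers {xs} len path = subst (λ l → xs ∈ walks (c ∷ []) (nbE (E s) c) l budget) len
        (walks-cover (c ∷ []) _ xs budget (fits [] c xs (proj₂ (cov enumerated path)))
          (≤-trans (cost≤ [] c xs) (≤-trans (degree-sum s (proj₁ path) (proj₁ (cov enumerated path)) len) (≤-reflexive (sym (*-identityˡ budget))))))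
        where
        enumerated : xs ∈ map toList (allVec (allFin n) (suc ℓ′))
        enumerated = subst (λ l → xs ∈ map toList (allVec (allFin n) l)) len
          (subst (_∈ map toList (allVec (allFin n) (length xs))) (Vecₚ.toList∘fromList xs)
            (∈-map⁺ toList (allVec-complete (Vec.fromList xs) (λ i → ∈-allFin _))))

  -- Cycles as vertex lists, and the degrees along them.

  cycEdges : ∀ {n} → List (Fin n) → List (Edge n)
  cycEdges [] = []
  cycEdges (x ∷ xs) = pathEdges (x ∷ xs ++ [ x ])

  length-cycEdges : ∀ {n} (xs : List (Fin n)) → length (cycEdges xs) ≡ length xs
  length-cycEdges [] = refl
  length-cycEdges (x ∷ xs) = trans (length-pathEdges x (xs ++ [ x ])) (trans (length-++ xs) (+-comm (length xs) 1))

  cycEdges-within : ∀ {n} (xs : List (Fin n)) → Within xs (cycEdges xs)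
  cycEdges-within (x ∷ xs) e∈ = let a , b = pathEdges-within (x ∷ xs ++ [ x ]) e∈ in back a , back b
    where
    back : ∀ {v} → v ∈ x ∷ xs ++ [ x ] → v ∈ x ∷ xs
    back (here eq) = here eq
    back (there m) with ∈-++⁻ xs m
    ... | inj₁ h = there h
    ... | inj₂ (here eq) = here eq

  pathEdges-++ : ∀ {n} (as : List (Fin n)) x bs → pathEdges (as ++ x ∷ bs) ≡ pathEdges (as ++ [ x ]) ++ pathEdges (x ∷ bs)
  pathEdges-++ [] x bs = refl
  pathEdges-++ (a ∷ []) x bs = refl
  pathEdges-++ (a ∷ a′ ∷ as) x bs = cong (norm a a′ ∷_) (pathEdges-++ (a′ ∷ as) x bs)

  pathEdges-snoc : ∀ {n} (x : Fin n) ys z → pathEdges (x ∷ ys ++ [ z ]) ≡ pathEdges (x ∷ ys) ++ [ norm (last x ys) z ]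
  pathEdges-snoc x [] z = refl
  pathEdges-snoc x (y ∷ ys) z = cong (norm x y ∷_) (pathEdges-snoc y ys z)

  -- The closing edge contains the first vertex, so it could only coincide with the first edge; a
  -- third vertex excludes this.
  cycEdges-unique : ∀ {n} {xs : List (Fin n)} → 3 ≤ length xs → Unique xs → Unique (cycEdges xs)
  cycEdges-unique {xs = _ ∷ []} (s≤s ()) _
  cycEdges-unique {xs = _ ∷ _ ∷ []} (s≤s (s≤s ())) _
  cycEdges-unique {xs = x ∷ y ∷ z ∷ zs} _ u@((_ ∷ x≢z ∷ _) ∷ y∉ ∷ _) = subst Unique (sym (pathEdges-snoc x (y ∷ z ∷ zs) x))
    (Uniqueₚ.++⁺ (pathEdges-unique u) ([] ∷ [])
      λ { (e∈ , here eq) → not-twice (subst (_∈ pathEdges (x ∷ y ∷ z ∷ zs)) eq e∈) })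
    where
    l = last z zs
    l∈ : l ∈ z ∷ zs
    l∈ = last-∈ z zs
    not-twice : norm l x ∉ pathEdges (x ∷ y ∷ z ∷ zs)
    not-twice (here eq) with norm-inj eq
    ... | inj₁ (refl , refl) = All.lookup (AllPairs.head u) (there l∈) refl
    ... | inj₂ (l≡y , _) = All.lookup y∉ l∈ (sym l≡y)
    not-twice (there e∈) with norm-ends⁻ (pathEdges-within (y ∷ z ∷ zs) e∈)
    ... | _ , x∈ = Uniqueₚ.Unique[x∷xs]⇒x∉xs u x∈

  record IsCycle {n} (H : Graph n) (k : ℕ) (xs : List (Fin n)) : Set where
    field
      cyc-length : length xs ≡ k
      cyc-unique : Unique xs
      cyc-graph : All (InGraph H) (cycEdges xs)
  open IsCycle public

  -- A copy is a vertex set together with an edge set, so both have to agree; the starting point and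
  -- the direction are forgotten.
  _≈ᶜ_ : ∀ {n} → List (Fin n) → List (Fin n) → Set
  xs ≈ᶜ ys = xs ≈ˢ ys × cycEdges xs ≈ˢ cycEdges ys

  ++-swap : ∀ {A : Set} (xs ys : List A) → xs ++ ys ⊆ ys ++ xs
  ++-swap xs ys m = [ ∈-++⁺ʳ ys , ∈-++⁺ˡ ]′ (∈-++⁻ xs m)

  cycEdges-rotate : ∀ {n} (as : List (Fin n)) u bs → cycEdges (as ++ u ∷ bs) ≈ˢ cycEdges (u ∷ bs ++ as)
  cycEdges-rotate [] u bs rewrite Listₚ.++-identityʳ bs = id , id
  cycEdges-rotate (a ∷ as) u bs = subst₂ _≈ˢ_ (sym left) (sym right) (++-swap p₁ p₂ , ++-swap p₂ p₁)
    where
    p₁ = pathEdges (a ∷ as ++ [ u ])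
    p₂ = pathEdges (u ∷ bs ++ [ a ])
    left : cycEdges (a ∷ as ++ u ∷ bs) ≡ p₁ ++ p₂
    left = trans (cong (λ l → pathEdges (a ∷ l)) (++-assoc as (u ∷ bs) [ a ])) (pathEdges-++ (a ∷ as) u (bs ++ [ a ]))
    right : cycEdges (u ∷ bs ++ a ∷ as) ≡ p₂ ++ p₁
    right = trans (cong (λ l → pathEdges (u ∷ l)) (++-assoc bs (a ∷ as) [ u ])) (pathEdges-++ (u ∷ bs) a (as ++ [ u ]))

  Unique-++ˡ : ∀ {A : Set} (xs : List A) {ys} → Unique (xs ++ ys) → Unique xs
  Unique-++ˡ [] _ = []
  Unique-++ˡ (x ∷ xs) (h ∷ u) = Allₚ.++⁻ˡ xs h ∷ Unique-++ˡ xs u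

  Unique-swap : ∀ {A : Set} (xs : List A) {ys} → Unique (xs ++ ys) → Unique (ys ++ xs)
  Unique-swap [] {ys} u = subst Unique (sym (Listₚ.++-identityʳ ys)) u
  Unique-swap (x ∷ xs) {ys} (x∉ ∷ u) = Uniqueₚ.++⁺ (Unique-++ˡ ys (Unique-swap xs u)) (Allₚ.++⁻ˡ xs x∉ ∷ Unique-++ˡ xs u)
    λ { (y∈ , here refl) → All.lookup (Allₚ.++⁻ʳ xs x∉) y∈ refl
      ; (y∈ , there y∈′) → apart xs u y∈′ y∈ }
    where
    apart : ∀ {A : Set} (xs : List A) {ys} → Unique (xs ++ ys) → ∀ {v} → v ∈ xs → v ∈ ys → ⊥
    apart (x ∷ xs) (h ∷ u) (here refl) v∈ = All.lookup (Allₚ.++⁻ʳ xs h) v∈ refl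
    apart (x ∷ xs) (h ∷ u) (there m) v∈ = apart xs u m v∈

  All-≈ˢ : ∀ {A : Set} {P : A → Set} {xs ys : List A} → ys ⊆ xs → All P xs → All P ys
  All-≈ˢ sub h = All.tabulate (λ m → All.lookup h (sub m))

  rotate-to : ∀ {n} {H : Graph n} {k xs u} → IsCycle H k xs → u ∈ xs →
    ∃ λ ys → IsCycle H k (u ∷ ys) × (u ∷ ys) ≈ᶜ xs
  rotate-to {H = H} {k} {u = u} cyc u∈ with ∈-∃++ u∈
  ... | as , bs , refl = bs ++ as
    , record { cyc-length = trans (length-++ (u ∷ bs)) (trans (+-comm (length (u ∷ bs)) (length as)) (trans (sym (length-++ as {u ∷ bs})) (cyc-length cyc)))
             ; cyc-unique = Unique-swap as (cyc-unique cyc)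
             ; cyc-graph = All-≈ˢ (proj₂ (cycEdges-rotate as u bs)) (cyc-graph cyc) }
    , (++-swap (u ∷ bs) as , ++-swap as (u ∷ bs))
    , ≈ˢ-sym (cycEdges-rotate as u bs)

  fresh : ∀ {n} → Graph n → List (Fin n) → Fin n → Fin n → Bool
  fresh H seen v w = adj H v w ∧ not (memb seen w)

  extensions : ∀ {n} → Graph n → List (Fin n) → List (Fin n)
  extensions H [] = []
  extensions {n} H (v ∷ seen) = filterᵗ (fresh H seen v) (allFin n)

  -- Counting the images of a cycle with all further edges at a set of its vertices
  -- shows that these vertices have only O(Yk) edges altogether.
  module CycleBudget {n : ℕ} (H : Graph n) (p d : ℕ) (p>0 : 0 < p) (p≤d : p ≤ d) (sp : Sparseᴺ H p d)
    {Y k : ℕ} (Y>0 : 0 < Y) (np≤Yd : n * p ≤ Y * d) (k≥3 : 3 ≤ k)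
    {xs : List (Fin n)} (cyc : IsCycle H k xs) where
    open Host H p d p>0 p≤d sp

    C : List (Edge n)
    C = cycEdges xs

    star : List (Fin n) → Fin n → List (Fin n)
    star seen v = filterᵗ (λ w → fresh H seen v w ∧ not (closure C v w)) (allFin n)

    ∈-star⁻ : ∀ {seen v w} → w ∈ star seen v → adj H v w ≡ true × w ∉ seen × norm v w ∉ C
    ∈-star⁻ {seen} {v} {w} m with ∧-true⁻ {fresh H seen v w} (proj₂ (∈-filterᵗ⁻ _ {allFin n} m))
    ... | a , c with ∧-true⁻ {adj H v w} a
    ... | a₁ , a₂ = a₁ , not-memb a₂ , not-closure c
      where
      not-memb : not (memb seen w) ≡ true → w ∉ seen
      not-memb e w∈ rewrite dec-true (w ∈ᵛ? seen) w∈ with e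
      ... | ()
      not-closure : not (closure C v w) ≡ true → norm v w ∉ C
      not-closure e m rewrite dec-true (norm v w ∈ᵉ? C) m with e
      ... | ()

    -- Visited vertices are excluded as partners, so an edge between two vertices of `vs` is
    -- recorded only at the one visited first. `extensions` makes the same exclusion, which lets the
    -- cost of a self-avoiding walk be compared with a set of edges.
    stars : List (Fin n) → List (Fin n) → List (Edge n)
    stars seen [] = []
    stars seen (v ∷ vs) = map (norm v) (star seen v) ++ stars (v ∷ seen) vs

    ∈-stars⁻ : ∀ seen vs {e} → e ∈ stars seen vs → ∃ λ v → ∃ λ w → e ≡ norm v w × v ∈ vs × adj H v w ≡ true × w ∉ seen × norm v w ∉ C
    ∈-stars⁻ seen (v ∷ vs) e∈ with ∈-++⁻ (map (norm v) (star seen v)) e∈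
    ... | inj₁ m = let w , w∈ , eq = ∈-map⁻ (norm v) m ; a , b , c = ∈-star⁻ w∈ in v , w , eq , here refl , a , b , c
    ... | inj₂ m = let v′ , w , eq , v′∈ , a , b , c = ∈-stars⁻ (v ∷ seen) vs m in v′ , w , eq , there v′∈ , a , b ∘ there , c

    stars-unique : ∀ seen {vs} → Unique vs → Unique (stars seen vs)
    stars-unique seen [] = []
    stars-unique seen {v ∷ vs} (v∉ ∷ u) = Uniqueₚ.++⁺ (norm-unique (filterᵗ-unique _ (Uniqueₚ.allFin⁺ n))) (stars-unique (v ∷ seen) u) disjoint
      where
      norm-unique : ∀ {ws} → Unique ws → Unique (map (norm v) ws)
      norm-unique = Uniqueₚ.map⁺ λ eq → [ proj₂ , (λ (a , b) → trans b a) ]′ (norm-inj eq)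
      disjoint : ∀ {e} → (e ∈ map (norm v) (star seen v) × e ∈ stars (v ∷ seen) vs) → ⊥
      disjoint (a , b) with ∈-map⁻ (norm v) a | ∈-stars⁻ (v ∷ seen) vs b
      ... | w , _ , refl | v′ , w′ , eq , v′∈ , _ , w′∉ , _ with norm-inj eq
      ... | inj₁ (refl , _) = All.lookup v∉ v′∈ refl
      ... | inj₂ (refl , _) = w′∉ (here refl)

    -- Put q = p/d. From C(n, a) ≤ n^a / a! and nq ≤ Y follows C(n, a) (2q)^a ≤ (2Y)^a / a!, and
    -- (4Y)^a ≤ a! 2^(4Y + a) bounds this independently of a. The additional factor 2^a is what
    -- later limits the total number of star edges.
    star-weight : ∀ a → length (combs a (allFin n)) * (2 ^ a * p ^ a) ≤ d ^ a * 2 ^ (4 * Y)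
    star-weight a = *-cancelˡ-≤ ((2 * Y) ^ a) {{m^n≢0 (2 * Y) a {{m*n≢0 2 Y {{_}} {{>-nonZero Y>0}}}}}} (begin
      (2 * Y) ^ a * (c * (2 ^ a * p ^ a))
        ≡⟨ solve 4 (λ y c t p → y :* (c :* (t :* p)) := c :* ((t :* y) :* p)) refl ((2 * Y) ^ a) c (2 ^ a) (p ^ a) ⟩
      c * (2 ^ a * (2 * Y) ^ a * p ^ a)
        ≡⟨ cong (λ z → c * (z * p ^ a)) (trans (sym (^-distribʳ-* a 2 (2 * Y))) (cong (_^ a) (sym (*-assoc 2 2 Y)))) ⟩
      c * ((4 * Y) ^ a * p ^ a)
        ≤⟨ *-monoʳ-≤ c (*-monoˡ-≤ (p ^ a) (^≤!*2^ (4 * Y) a)) ⟩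
      c * (a ! * 2 ^ (4 * Y + a) * p ^ a)
        ≡⟨ cong (λ z → c * (a ! * z * p ^ a)) (^-split 2 (4 * Y) a) ⟩
      c * (a ! * (2 ^ (4 * Y) * 2 ^ a) * p ^ a)
        ≡⟨ solve 5 (λ c f s t p → c :* (f :* (s :* t) :* p) := c :* f :* p :* (t :* s)) refl c (a !) (2 ^ (4 * Y)) (2 ^ a) (p ^ a) ⟩
      c * a ! * p ^ a * (2 ^ a * 2 ^ (4 * Y))
        ≤⟨ *-monoˡ-≤ _ (*-monoˡ-≤ (p ^ a) (≤-trans (length-combs a (allFin n)) (≤-reflexive (cong (_^ a) (length-tabulate {n = n} id))))) ⟩
      n ^ a * p ^ a * (2 ^ a * 2 ^ (4 * Y))
        ≡⟨ cong (_* (2 ^ a * 2 ^ (4 * Y))) (^-distribʳ-* a n p) ⟨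
      (n * p) ^ a * (2 ^ a * 2 ^ (4 * Y))
        ≤⟨ *-monoˡ-≤ _ (^-monoˡ-≤ a np≤Yd) ⟩
      (Y * d) ^ a * (2 ^ a * 2 ^ (4 * Y))
        ≡⟨ cong (_* (2 ^ a * 2 ^ (4 * Y))) (^-distribʳ-* a Y d) ⟩
      Y ^ a * d ^ a * (2 ^ a * 2 ^ (4 * Y))
        ≡⟨ solve 4 (λ y d t s → y :* d :* (t :* s) := t :* y :* (d :* s)) refl (Y ^ a) (d ^ a) (2 ^ a) (2 ^ (4 * Y)) ⟩
      2 ^ a * Y ^ a * (d ^ a * 2 ^ (4 * Y))
        ≡⟨ cong (_* (d ^ a * 2 ^ (4 * Y))) (^-distribʳ-* a 2 Y) ⟨
      (2 * Y) ^ a * (d ^ a * 2 ^ (4 * Y)) ∎)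
      where
      open ≤-Reasoning
      open +-*-Solver
      c = length (combs a (allFin n))

    -- All centres lie on the cycle, whose vertices form the base; so the stars are coded
    -- independently and the bounds of `star-weight` multiply.
    stars-coded : ∀ seen vs → vs ⊆ xs → ∃ λ M → Coded xs (stars seen vs) M ×
      M * (2 ^ length (stars seen vs) * p ^ length (stars seen vs)) ≤ d ^ length (stars seen vs) * 2 ^ (4 * Y * length vs)
    stars-coded seen [] _ = 1 , coded-base (λ ()) , ≤-trans (m^n>0 2 (4 * Y * 0)) (≤-reflexive (sym (*-identityˡ _)))
    stars-coded seen (v ∷ vs) sub with stars-coded (v ∷ seen) vs (sub ∘ there)
    ... | M , cd , w = c * M , coded-++ (coded-star (sub (here refl)) (filterᵗ-unique _ (Uniqueₚ.allFin⁺ n))) cd ,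
      subst (λ l → c * M * (2 ^ l * p ^ l) ≤ d ^ l * 2 ^ (4 * Y * suc (length vs))) (sym len) (begin
        c * M * (2 ^ (a + A) * p ^ (a + A))
          ≡⟨ cong₂ (λ y z → c * M * (y * z)) (^-split 2 a A) (^-split p a A) ⟩
        c * M * (2 ^ a * 2 ^ A * (p ^ a * p ^ A))
          ≡⟨ solve 6 (λ c m x y z w → c :* m :* (x :* y :* (z :* w)) := c :* (x :* z) :* (m :* (y :* w))) refl c M (2 ^ a) (2 ^ A) (p ^ a) (p ^ A) ⟩
        c * (2 ^ a * p ^ a) * (M * (2 ^ A * p ^ A))
          ≤⟨ *-mono-≤ (star-weight a) w ⟩
        d ^ a * 2 ^ (4 * Y) * (d ^ A * 2 ^ (4 * Y * length vs))
          ≡⟨ solve 4 (λ x y z w → x :* y :* (z :* w) := x :* z :* (y :* w)) refl (d ^ a) (2 ^ (4 * Y)) (d ^ A) (2 ^ (4 * Y * length vs)) ⟩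
        d ^ a * d ^ A * (2 ^ (4 * Y) * 2 ^ (4 * Y * length vs))
          ≡⟨ cong₂ _*_ (^-split d a A) (trans (cong (2 ^_) (*-suc (4 * Y) (length vs))) (^-split 2 (4 * Y) (4 * Y * length vs))) ⟨
        d ^ (a + A) * 2 ^ (4 * Y * suc (length vs)) ∎)
      where
      open ≤-Reasoning
      open +-*-Solver
      a = length (star seen v)
      A = length (stars (v ∷ seen) vs)
      c = length (combs a (allFin n))
      len : length (stars seen (v ∷ vs)) ≡ a + A
      len = trans (length-++ (map (norm v) (star seen v))) (cong (_+ A) (length-map (norm v) (star seen v)))

    -- Sparsity of the cycle with all A star edges reads 1 ≤ (nq)^k M q^A. Here (nq)^k ≤ Y^k ≤
    -- 2^(Yk) and M (2q)^A ≤ 2^(4Yk), hence 2^A ≤ 2^(5Yk).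
    few-star-edges : ∀ {vs} → Unique vs → vs ⊆ xs → length (stars [] vs) ≤ 5 * Y * k
    few-star-edges {vs} u sub with stars-coded [] vs sub
    ... | M , cd , w = ≮⇒≥ λ lt → <⇒≱ (^-monoʳ-< 2 ≤-refl lt) final
      where
      open ≤-Reasoning
      open +-*-Solver
      es = stars [] vs
      A = length es
      len : length (C ++ es) ≡ k + A
      len = trans (length-++ C) (cong (_+ A) (trans (length-cycEdges xs) (cyc-length cyc)))
      all-unique : Unique (C ++ es)
      all-unique = Uniqueₚ.++⁺ (cycEdges-unique (subst (3 ≤_) (sym (cyc-length cyc)) k≥3) (cyc-unique cyc)) (stars-unique [] u)
        (λ (a , b) → let _ , _ , eq , _ , _ , _ , ∉C = ∈-stars⁻ [] vs b in ∉C (subst (_∈ C) eq a))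
      all-graph : All (InGraph H) (C ++ es)
      all-graph = Allₚ.++⁺ (cyc-graph cyc) (All.tabulate λ m → let _ , _ , eq , _ , a , _ = ∈-stars⁻ [] vs m in
        subst (InGraph H) (sym eq) (inGraph-norm H a))
      orbit : d ^ (k + A) ≤ n ^ k * M * p ^ (k + A)
      orbit = subst₂ (λ l v → d ^ l ≤ n ^ v * M * p ^ l) len (cyc-length cyc)
        (subst (λ M′ → d ^ length (C ++ es) ≤ n ^ length xs * M′ * p ^ length (C ++ es)) (*-identityˡ M)
          (sp all-unique all-graph (coded-++ (coded-base (cycEdges-within xs)) cd)))
      final : 2 ^ A ≤ 2 ^ (5 * Y * k)
      final = *-cancelʳ-≤ _ _ (d ^ (k + A)) {{m^n≢0 d (k + A)}} (begin
        2 ^ A * d ^ (k + A)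
          ≤⟨ *-monoʳ-≤ (2 ^ A) orbit ⟩
        2 ^ A * (n ^ k * M * p ^ (k + A))
          ≡⟨ cong (λ z → 2 ^ A * (n ^ k * M * z)) (^-split p k A) ⟩
        2 ^ A * (n ^ k * M * (p ^ k * p ^ A))
          ≡⟨ solve 5 (λ t n m q r → t :* (n :* m :* (q :* r)) := n :* q :* (m :* (t :* r))) refl (2 ^ A) (n ^ k) M (p ^ k) (p ^ A) ⟩
        n ^ k * p ^ k * (M * (2 ^ A * p ^ A))
          ≤⟨ *-mono-≤ (≤-trans (≤-reflexive (sym (^-distribʳ-* k n p))) (^-monoˡ-≤ k np≤Yd)) w ⟩
        (Y * d) ^ k * (d ^ A * 2 ^ (4 * Y * length vs))
          ≤⟨ *-mono-≤ (≤-trans (^-monoˡ-≤ k (*-monoˡ-≤ d (n≤2^n Y))) (≤-reflexive (^-distribʳ-* k (2 ^ Y) d)))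
               (*-monoʳ-≤ (d ^ A) (^-monoʳ-≤ 2 (*-monoʳ-≤ (4 * Y) (≤-trans (length-⊆ u sub) (≤-reflexive (cyc-length cyc)))))) ⟩
        (2 ^ Y) ^ k * d ^ k * (d ^ A * 2 ^ (4 * Y * k))
          ≡⟨ solve 4 (λ a b c e → a :* b :* (c :* e) := a :* e :* (b :* c)) refl ((2 ^ Y) ^ k) (d ^ k) (d ^ A) (2 ^ (4 * Y * k)) ⟩
        (2 ^ Y) ^ k * 2 ^ (4 * Y * k) * (d ^ k * d ^ A)
          ≡⟨ cong₂ _*_ (trans (cong (_* 2 ^ (4 * Y * k)) (^-*-assoc 2 Y k)) (trans (sym (^-split 2 (Y * k) (4 * Y * k)))
               (cong (2 ^_) (solve 2 (λ y k → y :* k :+ con 4 :* y :* k := con 5 :* y :* k) refl Y k)))) (sym (^-split d k A)) ⟩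
        2 ^ (5 * Y * k) * d ^ (k + A) ∎)

    nbC : Fin n → List (Fin n)
    nbC v = filterᵗ (closure C v) (allFin n)

    length-extensions : ∀ v seen → length (extensions H (v ∷ seen)) ≤ length (star seen v) + length (nbC v)
    length-extensions v seen = ≤-trans (length-⊆ (filterᵗ-unique _ (Uniqueₚ.allFin⁺ n)) sub) (≤-reflexive (length-++ (star seen v)))
      where
      sub : extensions H (v ∷ seen) ⊆ star seen v ++ nbC v
      sub {w} m with closure C v w in eq
      ... | true = ∈-++⁺ʳ (star seen v) (∈-filterᵗ⁺ _ (∈-allFin w) eq)
      ... | false = ∈-++⁺ˡ (∈-filterᵗ⁺ _ (∈-allFin w) (cong₂ _∧_ (proj₂ (∈-filterᵗ⁻ (fresh H seen v) {allFin n} m)) (cong not eq)))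

    open Walks (extensions H) Y

    cost≤ : ∀ x seen ys → cost (x ∷ seen) (extensions H (x ∷ seen)) ys ≤ length (stars seen (x ∷ ys)) + sumOver (length ∘ nbC) (x ∷ ys)
    cost≤ x seen [] = z≤n
    cost≤ x seen (y ∷ ys) = begin
      length (extensions H (x ∷ seen)) + cost (y ∷ x ∷ seen) (extensions H (y ∷ x ∷ seen)) ys
        ≤⟨ +-mono-≤ (length-extensions x seen) (cost≤ y (x ∷ seen) ys) ⟩
      length (star seen x) + length (nbC x) + (length (stars (x ∷ seen) (y ∷ ys)) + sumOver (length ∘ nbC) (y ∷ ys))
        ≡⟨ solve 4 (λ a b c e → a :+ b :+ (c :+ e) := a :+ c :+ (b :+ e)) refl (length (star seen x)) (length (nbC x)) (length (stars (x ∷ seen) (y ∷ ys))) (sumOver (length ∘ nbC) (y ∷ ys)) ⟩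
      length (star seen x) + length (stars (x ∷ seen) (y ∷ ys)) + sumOver (length ∘ nbC) (x ∷ y ∷ ys)
        ≡⟨ cong (_+ sumOver (length ∘ nbC) (x ∷ y ∷ ys)) (trans (length-++ (map (norm x) (star seen x))) (cong (_+ length (stars (x ∷ seen) (y ∷ ys))) (length-map (norm x) (star seen x)))) ⟨
      length (stars seen (x ∷ y ∷ ys)) + sumOver (length ∘ nbC) (x ∷ y ∷ ys) ∎
      where
      open ≤-Reasoning
      open +-*-Solver

    -- Candidates at a vertex belong to its star or are its neighbours on the cycle. The stars
    -- contribute 5Yk and the cycle 2k ≤ 2Yk; as candidates are read `Y` at a time, a budget of 7k
    -- suffices.
    segment-cost : ∀ {x ys} → Unique (x ∷ ys) → x ∷ ys ⊆ xs → cost (x ∷ []) (extensions H (x ∷ [])) ys ≤ Y * (7 * k)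
    segment-cost {x} {ys} u sub = begin
      cost (x ∷ []) (extensions H (x ∷ [])) ys
        ≤⟨ cost≤ x [] ys ⟩
      length (stars [] (x ∷ ys)) + sumOver (length ∘ nbC) (x ∷ ys)
        ≤⟨ +-mono-≤ (few-star-edges u sub) (≤-trans (handshake nbC (λ v → filterᵗ-unique _ (Uniqueₚ.allFin⁺ n))
             (λ {v} {w} m → does-true⁻ (norm v w ∈ᵉ? C) (proj₂ (∈-filterᵗ⁻ (closure C v) {allFin n} m))) u)
             (≤-reflexive (cong (2 *_) (trans (length-cycEdges xs) (cyc-length cyc))))) ⟩
      5 * Y * k + 2 * k
        ≤⟨ +-monoʳ-≤ (5 * Y * k) (*-monoʳ-≤ 2 (≤-trans (≤-reflexive (sym (*-identityˡ k))) (*-monoˡ-≤ k Y>0))) ⟩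
      5 * Y * k + 2 * (Y * k)
        ≡⟨ solve 2 (λ y k → con 5 :* y :* k :+ con 2 :* (y :* k) := y :* (con 7 :* k)) refl Y k ⟩
      Y * (7 * k) ∎
      where
      open ≤-Reasoning
      open +-*-Solver

    segment-fits : ∀ x seen ys → All (InGraph H) (pathEdges (x ∷ ys)) → (∀ {v} → v ∈ ys → v ∉ x ∷ seen) → Unique ys →
      Fits (x ∷ seen) (extensions H (x ∷ seen)) ys
    segment-fits x seen [] _ _ _ = tt
    segment-fits x seen (y ∷ ys) (e ∷ es) new (y∉ ∷ u) =
      ∈-filterᵗ⁺ _ (∈-allFin y) (cong₂ _∧_ (inGraph-norm⁻ H e) (cong not (dec-false (y ∈ᵛ? seen) (new (here refl) ∘ there))))
      , segment-fits y (x ∷ seen) ys es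
          (λ { v∈ (here refl) → All.lookup y∉ v∈ refl ; v∈ (there v∈′) → new (there v∈) v∈′ }) u

  -- Patterns and their embeddings; the cycle C_k.

  module Pattern {m : ℕ} (F : ESet m) (F-sym : ∀ i j → F i j ≡ F j i) (F-irref : ∀ i → F i i ≡ false) where

    el : List (Edge m)
    el = edgeList F

    el-ordered : Ordered el
    el-ordered e∈ = proj₂ (∈-edgeList⁻ {F = F} e∈)

    F⇒≢ : ∀ {i j} → F i j ≡ true → i ≢ j
    F⇒≢ {i} e refl = case trans (sym e) (F-irref i) of λ ()

    norm∈el : ∀ {i j} → F i j ≡ true → norm i j ∈ el
    norm∈el {i} {j} e with norm-cases i j | norm-ordered (F⇒≢ e)
    ... | inj₁ eq | lt rewrite eq = ∈-edgeList⁺ e lt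
    ... | inj₂ eq | lt rewrite eq = ∈-edgeList⁺ (trans (F-sym j i) e) lt

    closure-edgesOf⁺ : ∀ {n} (f : Vec (Fin n) m) {i j} → F i j ≡ true → closure (edgesOf el f) (lookup f i) (lookup f j) ≡ true
    closure-edgesOf⁺ f {i} {j} e = dec-true (_ ∈ᵉ? edgesOf el f)
      (subst (_∈ edgesOf el f) (norm-map (lookup f) i j) (∈-map⁺ _ (norm∈el e)))

    closure-edgesOf⁻ : ∀ {n} (f : Vec (Fin n) m) {a b} → closure (edgesOf el f) a b ≡ true →
      ∃ λ i → ∃ λ j → F i j ≡ true × lookup f i ≡ a × lookup f j ≡ b
    closure-edgesOf⁻ f {a} {b} e with ∈-map⁻ _ (does-true⁻ (norm a b ∈ᵉ? edgesOf el f) e)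
    ... | (i , j) , ij∈ , eq with norm-inj eq
    ... | inj₁ (refl , refl) = i , j , proj₁ (∈-edgeList⁻ {F = F} ij∈) , refl , refl
    ... | inj₂ (refl , refl) = j , i , trans (F-sym j i) (proj₁ (∈-edgeList⁻ {F = F} ij∈)) , refl , refl

    module _ {n} {G : Graph n} {S E} {f : Vec (Fin n) m} (sub : Subgraph G S E) (iso : Iso S E F (lookup f)) where

      memb≡ : ∀ v → memb (toList f) v ≡ S v
      memb≡ v = true-ext
        (λ e → let i , eq = ∈-toList⁻ f (does-true⁻ (v ∈ᵛ? toList f) e) in subst (λ w → S w ≡ true) eq (f-in iso i))
        (λ e → let i , eq = f-onto iso e in dec-true (v ∈ᵛ? toList f) (subst (_∈ toList f) eq (∈-toList f i)))

      closure≡ : ∀ a b → closure (edgesOf el f) a b ≡ E a b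
      closure≡ a b = true-ext to from
        where
        to : closure (edgesOf el f) a b ≡ true → E a b ≡ true
        to e with closure-edgesOf⁻ f e
        ... | i , j , ij , refl , refl = trans (sym (f-edge iso i j)) ij
        from : E a b ≡ true → closure (edgesOf el f) a b ≡ true
        from e with f-onto iso (E-S sub e) | f-onto iso (E-S sub (trans (E-sym sub b a) e))
        ... | i , refl | j , refl = closure-edgesOf⁺ f (trans (f-edge iso i j) e)

      embeds : Embeds G el f
      embeds = toList-unique (f-inj iso) , All.tabulate λ {e} e∈ → let (i , j) , ij∈ , eq = ∈-map⁻ _ e∈ in
        subst (InGraph G) (sym eq) (inGraph-norm G (E-adj sub (trans (sym (f-edge iso i j)) (proj₁ (∈-edgeList⁻ {F = F} ij∈)))))

    module _ {n} {G : Graph n} {f : Vec (Fin n) m} (emb : Embeds G el f) where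

      embeds⇒subgraph : Subgraph G (memb (toList f)) (closure (edgesOf el f))
      embeds⇒subgraph = record
        { E-sym = E-sym s ; E-irref = E-irref s ; E-adj = E-adj s
        ; E-S = λ {a} {b} e → let i , _ , _ , eq , _ = closure-edgesOf⁻ f e in
            dec-true (a ∈ᵛ? toList f) (subst (_∈ toList f) eq (∈-toList f i)) }
        where s = closure-subgraph G (proj₂ emb)

      embeds⇒iso : Iso (memb (toList f)) (closure (edgesOf el f)) F (lookup f)
      embeds⇒iso = record
        { f-inj = inj
        ; f-edge = λ i j → true-ext (closure-edgesOf⁺ f) (λ e → let i′ , j′ , h , p , q = closure-edgesOf⁻ f e in
            subst₂ (λ x y → F x y ≡ true) (inj p) (inj q) h)
        ; f-onto = λ {v} e → ∈-toList⁻ f (does-true⁻ (v ∈ᵛ? toList f) e)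
        ; f-in = λ i → dec-true (_ ∈ᵛ? toList f) (∈-toList f i) }
        where
        inj : Injective _≡_ _≡_ (lookup f)
        inj = lookup-injective (proj₁ emb)

    N≤covering : ∀ {n} (G : Graph n) {X : Set} (Z : List X) (verts : X → List (Fin n)) (edges : X → List (Edge n)) →
      (∀ {f : Vec (Fin n) m} → Embeds G el f → ∃ λ z → z ∈ Z × verts z ≈ˢ toList f × edges z ≈ˢ edgesOf el f) →
      N G full F ≤ length Z
    N≤covering G Z verts edges h = ≤-trans (N≤length G F (map (λ z → memb (verts z) , closure (edges z)) Z) λ S E f sub iso →
      let z , z∈ , v≈ , e≈ = h {f} (embeds {f = f} sub iso) in
      _ , ∈-map⁺ _ z∈ , (λ i → trans (memb-cong v≈ i) (memb≡ {f = f} sub iso i)) , (λ i j → trans (closure-cong e≈ i j) (closure≡ {f = f} sub iso i j)))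
      (≤-reflexive (length-map _ Z))

  pathEdges-map : ∀ {n m} (f : Fin m → Fin n) xs → pathEdges (map f xs) ≡ img f (pathEdges xs)
  pathEdges-map f [] = refl
  pathEdges-map f (x ∷ []) = refl
  pathEdges-map f (x ∷ y ∷ zs) = cong₂ _∷_ (sym (norm-map f x y)) (pathEdges-map f (y ∷ zs))

  cycEdges-map : ∀ {n m} (f : Fin m → Fin n) xs → cycEdges (map f xs) ≡ img f (cycEdges xs)
  cycEdges-map f [] = refl
  cycEdges-map f (x ∷ xs) = trans (cong (λ l → pathEdges (f x ∷ l)) (sym (map-++ f xs [ x ]))) (pathEdges-map f (x ∷ xs ++ [ x ]))

  pathEdges-tabulate : ∀ {n m} (f : Fin (suc m) → Fin n) →
    pathEdges (tabulate f) ≡ tabulate (λ (i : Fin m) → norm (f (Fin.inject₁ i)) (f (suc i)))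
  pathEdges-tabulate {m = zero} f = refl
  pathEdges-tabulate {m = suc m} f = cong (norm (f zero) (f (suc zero)) ∷_) (pathEdges-tabulate (f ∘ suc))

  last-tabulate : ∀ {A : Set} {m} (f : Fin (suc m) → A) → last (f zero) (tabulate (f ∘ suc)) ≡ f (Fin.fromℕ m)
  last-tabulate {m = zero} f = refl
  last-tabulate {m = suc m} f = last-tabulate (f ∘ suc)

  ≡ᵇ-true⁻ : ∀ a b → (a ≡ᵇ b) ≡ true → a ≡ b
  ≡ᵇ-true⁻ a b e = ≡ᵇ⇒≡ a b (subst T (sym e) tt)

  ≡ᵇ-true⁺ : ∀ a b → a ≡ b → (a ≡ᵇ b) ≡ true
  ≡ᵇ-true⁺ a b eq = Equivalence.to Boolₚ.T-≡ (≡⇒≡ᵇ a b eq)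

  ∨-true⁻ : ∀ {a b} → a ∨ b ≡ true → a ≡ true ⊎ b ≡ true
  ∨-true⁻ {true} _ = inj₁ refl
  ∨-true⁻ {false} e = inj₂ e

  ∨-trueʳ : ∀ a {b} → b ≡ true → a ∨ b ≡ true
  ∨-trueʳ true _ = refl
  ∨-trueʳ false e = e

  Follows : ∀ {k} → Fin k → Fin k → Set
  Follows {k} i j = suc (toℕ i) ≡ toℕ j ⊎ (suc (toℕ i) ≡ k × toℕ j ≡ 0)

  Ck⁻ : ∀ k i j → Ck k i j ≡ true → Follows i j ⊎ Follows j i
  Ck⁻ k i j e = [ (λ h → inj₁ (follows i j h)) , (λ h → inj₂ (follows j i h)) ]′
    (∨-true⁻ {((suc (toℕ i) ≡ᵇ toℕ j) ∨ ((suc (toℕ i) ≡ᵇ k) ∧ (toℕ j ≡ᵇ 0)))} e)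
    where
    follows : ∀ (i j : Fin k) → ((suc (toℕ i) ≡ᵇ toℕ j) ∨ ((suc (toℕ i) ≡ᵇ k) ∧ (toℕ j ≡ᵇ 0))) ≡ true → Follows i j
    follows i j h with ∨-true⁻ {suc (toℕ i) ≡ᵇ toℕ j} h
    ... | inj₁ x = inj₁ (≡ᵇ-true⁻ _ _ x)
    ... | inj₂ x = let y , z = ∧-true⁻ {suc (toℕ i) ≡ᵇ k} x in inj₂ (≡ᵇ-true⁻ _ _ y , ≡ᵇ-true⁻ _ _ z)

  Ck⁺ : ∀ k i j → Follows i j → Ck k i j ≡ true
  Ck⁺ k i j (inj₁ eq) rewrite ≡ᵇ-true⁺ (suc (toℕ i)) (toℕ j) eq = refl
  Ck⁺ k i j (inj₂ (p , q)) rewrite ≡ᵇ-true⁺ (suc (toℕ i)) k p | ≡ᵇ-true⁺ (toℕ j) 0 q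
    | Boolₚ.∨-zeroʳ (suc (toℕ i) ≡ᵇ toℕ j) = refl

  Ck-sym : ∀ k i j → Ck k i j ≡ Ck k j i
  Ck-sym k i j = Boolₚ.∨-comm ((suc (toℕ i) ≡ᵇ toℕ j) ∨ ((suc (toℕ i) ≡ᵇ k) ∧ (toℕ j ≡ᵇ 0))) ((suc (toℕ j) ≡ᵇ toℕ i) ∨ ((suc (toℕ j) ≡ᵇ k) ∧ (toℕ i ≡ᵇ 0)))

  Ck-irref : ∀ {k} → 3 ≤ k → ∀ i → Ck k i i ≡ false
  Ck-irref {k} k≥3 i = Boolₚ.¬-not (λ e → [ absurd , absurd ]′ (Ck⁻ k i i e))
    where
    absurd : ¬ Follows i i
    absurd (inj₁ eq) = 1+n≢n eq
    absurd (inj₂ (p , q)) = <⇒≱ k≥3 (subst (_≤ 2) (trans (cong suc (sym q)) p) (s≤s z≤n))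

  module CyclePattern {k : ℕ} (k≥3 : 3 ≤ k) where

    open Pattern (Ck k) (Ck-sym k) (Ck-irref k≥3) public

    cycEdges-allFin⁺ : ∀ {i j} → Follows i j → norm i j ∈ cycEdges (allFin k)
    cycEdges-allFin⁺ = go k
      where
      go : ∀ k {i j : Fin k} → Follows i j → norm i j ∈ cycEdges (allFin k)
      go (suc m) {i} {j} h = subst (norm i j ∈_) (sym (pathEdges-snoc zero (tabulate suc) zero)) (by h)
        where
        by : Follows i j → norm i j ∈ pathEdges (allFin (suc m)) ++ [ norm (last zero (tabulate suc)) zero ]
        by (inj₁ eq) = ∈-++⁺ˡ (consecutive j eq)
          where
          consecutive : ∀ j → suc (toℕ i) ≡ toℕ j → norm i j ∈ pathEdges (allFin (suc m))
          consecutive (suc t) eq = subst₂ _∈_ (cong (λ x → norm x (suc t)) (Finₚ.toℕ-injective (trans (Finₚ.toℕ-inject₁ t) (sym (suc-injective eq)))))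
            (sym (pathEdges-tabulate {m = m} id)) (∈-tabulate⁺ t)
        by (inj₂ (p , q)) = ∈-++⁺ʳ (pathEdges (allFin (suc m))) (here (cong₂ norm
          (trans (Finₚ.toℕ-injective (trans (suc-injective p) (sym (Finₚ.toℕ-fromℕ m)))) (sym (last-tabulate {m = m} id)))
          (Finₚ.toℕ-injective q)))

    cycEdges-allFin⁻ : ∀ {e} → e ∈ cycEdges (allFin k) → ∃ λ i → ∃ λ j → e ≡ norm i j × Follows i j
    cycEdges-allFin⁻ = go k
      where
      go : ∀ k {e : Edge k} → e ∈ cycEdges (allFin k) → ∃ λ i → ∃ λ j → e ≡ norm i j × Follows i j
      go (suc m) {e} e∈ with ∈-++⁻ (pathEdges (allFin (suc m))) (subst (e ∈_) (pathEdges-snoc zero (tabulate suc) zero) e∈)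
      ... | inj₁ h = let t , eq = ∈-tabulate⁻ (subst (e ∈_) (pathEdges-tabulate {m = m} id) h) in
        Fin.inject₁ t , suc t , eq , inj₁ (cong suc (Finₚ.toℕ-inject₁ t))
      ... | inj₂ (here eq) = _ , zero , eq , inj₂ (cong suc (trans (cong toℕ (last-tabulate {m = m} id)) (Finₚ.toℕ-fromℕ m)) , refl)

    cycEdges≈el : cycEdges (allFin k) ≈ˢ el
    cycEdges≈el = to , from
      where
      to : cycEdges (allFin k) ⊆ el
      to e∈ with cycEdges-allFin⁻ e∈
      ... | i , j , refl , h = norm∈el (Ck⁺ k i j h)
      from : el ⊆ cycEdges (allFin k)
      from {i , j} e∈ with ∈-edgeList⁻ {F = Ck k} e∈
      ... | ij , lt = subst (_∈ cycEdges (allFin k)) (norm-< lt)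
        ([ cycEdges-allFin⁺ , (λ h → subst (_∈ cycEdges (allFin k)) (norm-comm j i) (cycEdges-allFin⁺ h)) ]′ (Ck⁻ k i j ij))

    length-el : length el ≡ k
    length-el = trans (≤-antisym (length-⊆ (edgeList-unique (Ck k)) (proj₂ cycEdges≈el))
                                 (length-⊆ (cycEdges-unique (subst (3 ≤_) (sym len) k≥3) (Uniqueₚ.allFin⁺ k)) (proj₁ cycEdges≈el)))
                      (trans (length-cycEdges (allFin k)) len)
      where
      len : length (allFin k) ≡ k
      len = length-tabulate {n = k} id

    cycEdges≈edgesOf : ∀ {n} (f : Vec (Fin n) k) → cycEdges (toList f) ≈ˢ edgesOf el f
    cycEdges≈edgesOf {n} f = subst (_≈ˢ edgesOf el f) (sym (trans (cong cycEdges (toList≡map f)) (cycEdges-map (lookup f) (allFin k))))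
      (map-≈ˢ {n} _ cycEdges≈el)

    embeds⇒cycle : ∀ {n} {H : Graph n} {f : Vec (Fin n) k} → Embeds H el f → IsCycle H k (toList f)
    embeds⇒cycle {f = f} (u , h) = record
      { cyc-length = Vecₚ.length-toList f ; cyc-unique = u ; cyc-graph = All-≈ˢ (proj₁ (cycEdges≈edgesOf f)) h }

    -- Going round the cycle from an unmarked vertex, an edge enters the first marked vertex
    -- and another one leaves each marked vertex.
    touched-cycle : ∀ (m : Fin k → Bool) → 1 ≤ length (marked m) → 2 + length (marked m) ≤ k → suc (length (marked m)) ≤ length (touched m el)
    touched-cycle m lo hi = go
      where
      touch : ∀ {k} (m : Fin k → Bool) x y zs → m x ∨ m y ≡ true → length (touched m (pathEdges (x ∷ y ∷ zs))) ≡ suc (length (touched m (pathEdges (y ∷ zs))))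
      touch m x y zs e = cong length (filter-accept _ {xs = pathEdges (y ∷ zs)} (trans same e))
        where
        same : m (proj₁ (norm x y)) ∨ m (proj₂ (norm x y)) ≡ m x ∨ m y
        same with norm-cases x y
        ... | inj₁ eq rewrite eq = refl
        ... | inj₂ eq rewrite eq = Boolₚ.∨-comm (m y) (m x)
      touch≤ : ∀ {k} (m : Fin k → Bool) x y zs → length (touched m (pathEdges (y ∷ zs))) ≤ length (touched m (pathEdges (x ∷ y ∷ zs)))
      touch≤ m x y zs = length-filter-∷ (norm x y) (pathEdges (y ∷ zs))
        where
        length-filter-∷ : ∀ e es → length (touched m es) ≤ length (touched m (e ∷ es))
        length-filter-∷ e es with m (proj₁ e) ∨ m (proj₂ e)
        ... | true = n≤1+n _
        ... | false = ≤-refl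
      count-∷ : ∀ {k} (m : Fin k → Bool) x xs → length (filterᵗ m (x ∷ xs)) ≡ (if m x then 1 else 0) + length (filterᵗ m xs)
      count-∷ m x xs with m x
      ... | true = refl
      ... | false = refl
      any-path : ∀ {k} (m : Fin k → Bool) x xs z → length (filterᵗ m (x ∷ xs)) ≤ length (touched m (pathEdges (x ∷ xs ++ [ z ])))
      any-path m x [] z rewrite count-∷ m x [] with m x in eq
      ... | false = z≤n
      ... | true = ≤-reflexive (sym (touch m x z [] (cong (_∨ m z) eq)))
      any-path m x (y ∷ ys) z rewrite count-∷ m x (y ∷ ys) with m x in eq
      ... | false = ≤-trans (any-path m y ys z) (touch≤ m x y (ys ++ [ z ]))
      ... | true = ≤-trans (s≤s (any-path m y ys z)) (≤-reflexive (sym (touch m x y (ys ++ [ z ]) (cong (_∨ m y) eq))))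
      from-unmarked : ∀ {k} (m : Fin k → Bool) x xs z → m x ≡ false → (∃ λ v → v ∈ xs ++ [ z ] × m v ≡ true) →
        suc (length (filterᵗ m xs)) ≤ length (touched m (pathEdges (x ∷ xs ++ [ z ])))
      from-unmarked m x [] z mx (v , here refl , mv) = ≤-reflexive (sym (touch m x z [] (∨-trueʳ (m x) mv)))
      from-unmarked m x (y ∷ ys) z mx (v , v∈ , mv) = by (m y) refl v∈
        where
        by : ∀ b → m y ≡ b → v ∈ y ∷ ys ++ [ z ] → suc (length (filterᵗ m (y ∷ ys))) ≤ length (touched m (pathEdges (x ∷ y ∷ ys ++ [ z ])))
        by true my _ = ≤-trans (s≤s (any-path m y ys z)) (≤-reflexive (sym (touch m x y (ys ++ [ z ]) (∨-trueʳ (m x) my))))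
        by false my (here refl) = case trans (sym my) mv of λ ()
        by false my (there v∈) = subst (λ l → suc l ≤ length (touched m (pathEdges (x ∷ y ∷ ys ++ [ z ])))) (sym (trans (count-∷ m y ys) (cong (λ b → (if b then 1 else 0) + length (filterᵗ m ys)) my)))
          (≤-trans (from-unmarked m y ys z my (v , v∈ , mv)) (touch≤ m x y (ys ++ [ z ])))
      len : length (allFin k) ≡ k
      len = length-tabulate {n = k} id
      unmarked : ∃ λ u → m u ≡ false
      unmarked with Finₚ.any? (λ u → m u Boolₚ.≟ false)
      ... | yes h = h
      ... | no none = ⊥-elim (<⇒≱ (≤-trans (n≤1+n _) hi) (subst (_≤ length (marked m)) len
        (length-⊆ (Uniqueₚ.allFin⁺ k) (λ {x} x∈ → ∈-filterᵗ⁺ m x∈ (true-by x)))))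
        where
        true-by : ∀ x → m x ≡ true
        true-by x with m x in eq
        ... | true = refl
        ... | false = ⊥-elim (none (x , eq))
      from : ∀ u as bs → m u ≡ false → allFin k ≡ as ++ u ∷ bs → suc (length (marked m)) ≤ length (touched m el)
      from u as bs mu split = begin
        suc (length (marked m))
          ≤⟨ s≤s (length-⊆ (filterᵗ-unique m (Uniqueₚ.allFin⁺ k)) marked⊆) ⟩
        suc (length (filterᵗ m (bs ++ as)))
          ≤⟨ from-unmarked m u (bs ++ as) u mu (marked-in-rest (marked m) refl lo) ⟩
        length (touched m (cycEdges (u ∷ bs ++ as)))
          ≤⟨ length-⊆ (filterᵗ-unique _ (cycEdges-unique (subst (3 ≤_) (sym rot-length) k≥3) rot-unique))
               (λ e∈ → let a , b = ∈-filterᵗ⁻ _ {cycEdges (u ∷ bs ++ as)} e∈ in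
                  ∈-filterᵗ⁺ _ (proj₁ cycEdges≈el (subst (λ l → _ ∈ cycEdges l) (sym split) (proj₂ (cycEdges-rotate as u bs) a))) b) ⟩
        length (touched m el) ∎
        where
        open ≤-Reasoning
        rot-unique : Unique (u ∷ bs ++ as)
        rot-unique = Unique-swap as (subst Unique split (Uniqueₚ.allFin⁺ k))
        rot-length : length (u ∷ bs ++ as) ≡ k
        rot-length = trans (length-++ (u ∷ bs)) (trans (+-comm (length (u ∷ bs)) (length as)) (trans (sym (length-++ as {u ∷ bs})) (trans (cong length (sym split)) len)))
        marked⊆ : marked m ⊆ filterᵗ m (bs ++ as)
        marked⊆ {v} v∈ with ∈-filterᵗ⁻ m {allFin k} v∈
        ... | v∈′ , mv with ++-swap as (u ∷ bs) (subst (v ∈_) split v∈′)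
        ... | here refl = case trans (sym mu) mv of λ ()
        ... | there h = ∈-filterᵗ⁺ m h mv
        marked-in-rest : ∀ ms → marked m ≡ ms → 1 ≤ length ms → ∃ λ v → v ∈ (bs ++ as) ++ [ u ] × m v ≡ true
        marked-in-rest (v ∷ _) eq _ = let a , b = ∈-filterᵗ⁻ m {bs ++ as} (marked⊆ (subst (v ∈_) (sym eq) (here refl))) in v , ∈-++⁺ˡ a , b
      go : suc (length (marked m)) ≤ length (touched m el)
      go = let u , mu = unmarked ; as , bs , split = ∈-∃++ (∈-allFin u) in from u as bs mu split

  -- Enumerating the cycles through a vertex.

  pathEdges-split : ∀ {n} (a : Fin n) as bs → pathEdges (a ∷ as ++ bs) ≡ pathEdges (a ∷ as) ++ pathEdges (last a as ∷ bs)
  pathEdges-split a [] bs = refl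
  pathEdges-split a (y ∷ as) bs = cong (norm a y ∷_) (pathEdges-split y as bs)

  last-++ : ∀ {A : Set} (a : A) as bs → last a (as ++ bs) ≡ last (last a as) bs
  last-++ a [] bs = refl
  last-++ a (y ∷ as) bs = last-++ y as bs

  Unique-last : ∀ {A : Set} (a : A) as {bs} → Unique (a ∷ as ++ bs) → Unique (last a as ∷ bs)
  Unique-last a [] u = u
  Unique-last a (y ∷ as) (_ ∷ u) = Unique-last y as u

  -- A cycle through u of length 2 + j + ℓ consists of two neighbours of u, a walk of length j
  -- from one of them, and a path of length ℓ closing up.
  module Cycles {n : ℕ} (H : Graph n) (p d : ℕ) (p>0 : 0 < p) (p≤d : p ≤ d) (sp : Sparseᴺ H p d)
    {X Y j ℓ : ℕ} (d<X : d < X) (np≤X : n * p ≤ X) (short : X ^ ℓ * p ≤ d ^ suc ℓ)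
    (Y>0 : 0 < Y) (np≤Yd : n * p ≤ Y * d) (k≥3 : 3 ≤ 2 + (j + ℓ)) where
    open Host H p d p>0 p≤d sp

    k : ℕ
    k = 2 + (j + ℓ)

    -- `Paths` deals with positive length and distinct ends. For ℓ = 0 the empty list is the only
    -- candidate, and a path of positive length cannot return to its start.
    paths-between : ∀ {ℓ} → X ^ ℓ * p ≤ d ^ suc ℓ → ∀ c b →
      ∃ λ Z → length Z ≤ 2 ^ (ℓ + (6 * ℓ + 6)) × (∀ {xs} → length xs ≡ ℓ → IsPath H c b xs → xs ∈ Z)
    paths-between {zero} _ c b = [ [] ] , s≤s z≤n , λ { {[]} _ _ → here refl }
    paths-between {suc ℓ′} short c b with c Finₚ.≟ b
    ... | no c≢b = Paths.bounded H p d p>0 p≤d sp d<X np≤X short c≢b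
    ... | yes refl = [] , z≤n , λ { {xs} len (u , _ , eq) → ⊥-elim (Uniqueₚ.Unique[x∷xs]⇒x∉xs u
      (subst (_∈ xs) eq (last∈rest c (subst (0 <_) (sym len) z<s)))) }

    P : Fin n → Fin n → List (List (Fin n))
    P c b = proj₁ (paths-between {ℓ} short c b)

    segments : Fin n → List (List (Fin n))
    segments a = Walks.walks (extensions H) Y (a ∷ []) (extensions H (a ∷ [])) j (7 * k)

    cycles : List (Fin n) → Fin n → List (List (Fin n))
    cycles W u = concatMap (λ a → concatMap (λ as → concatMap (λ b → map (λ bs → u ∷ a ∷ as ++ bs) (P (last a as) b)) (nbrs W u)) (segments a)) (nbrs W u)

    length-cycles : ∀ W u → length (cycles W u) ≤ length (nbrs W u) * (Y ^ j * 2 ^ (j + 7 * k) * (length (nbrs W u) * 2 ^ (ℓ + (6 * ℓ + 6))))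
    length-cycles W u = length-concatMap≤ _ _ (nbrs W u) λ {a} _ →
      ≤-trans (length-concatMap≤ _ (length (nbrs W u) * 2 ^ (ℓ + (6 * ℓ + 6))) (segments a) λ {as} _ →
        length-concatMap≤ _ _ (nbrs W u) λ {b} _ → ≤-trans (≤-reflexive (length-map (λ bs → u ∷ a ∷ as ++ bs) (P (last a as) b))) (proj₁ (proj₂ (paths-between {ℓ} short (last a as) b))))
      (*-monoˡ-≤ _ (Walks.length-walks (extensions H) Y (a ∷ []) (extensions H (a ∷ [])) j (7 * k)))

    cycles-cover : ∀ {W u xs} → IsCycle H k xs → u ∈ xs → xs ⊆ W → ∃ λ z → z ∈ cycles W u × z ≈ᶜ xs
    cycles-cover {W} {u} {xs} cyc u∈ sub with rotate-to cyc u∈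
    ... | [] , cyc′ , _ = ⊥-elim (1≢k (cyc-length cyc′))
      where
      1≢k : 1 ≢ k
      1≢k ()
    ... | a ∷ rest , cyc′ , eq = u ∷ a ∷ rest , subst (λ l → u ∷ a ∷ l ∈ cycles W u) (take++drop≡id j rest)
        (∈-concatMap _ a∈ (∈-concatMap _ as∈ (∈-concatMap _ b∈ (∈-map⁺ (λ bs → u ∷ a ∷ as ++ bs) bs∈)))) , eq
      where
      as = take j rest
      bs = drop j rest
      rest-length : length rest ≡ j + ℓ
      rest-length = suc-injective (suc-injective (cyc-length cyc′))
      as-length : length as ≡ j
      as-length = trans (length-take j rest) (trans (cong (j ⊓_) rest-length) (m≤n⇒m⊓n≡m (m≤m+n j ℓ)))
      bs-length : length bs ≡ ℓ
      bs-length = trans (length-drop j rest) (trans (cong (_∸ j) rest-length) (m+n∸m≡n j ℓ))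
      edges : All (InGraph H) (pathEdges (u ∷ a ∷ rest) ++ [ norm (last a rest) u ])
      edges = subst (All (InGraph H)) (pathEdges-snoc u (a ∷ rest) u) (cyc-graph cyc′)
      in-W : ∀ {v} → v ∈ u ∷ a ∷ rest → v ∈ W
      in-W v∈ = sub (proj₁ (proj₁ eq) v∈)
      a∈ : a ∈ nbrs W u
      a∈ = ∈-filterᵗ⁺ _ (in-W (there (here refl))) (inGraph-norm⁻ H (All.lookup edges (here refl)))
      b = last a rest
      b∈ : b ∈ nbrs W u
      b∈ = ∈-filterᵗ⁺ _ (in-W (there (last-∈ a rest)))
        (inGraph-norm⁻ H (subst (InGraph H) (norm-comm b u) (All.lookup edges (∈-++⁺ʳ (pathEdges (u ∷ a ∷ rest)) (here refl)))))
      uniq : Unique (a ∷ as ++ bs)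
      uniq = subst (λ l → Unique (a ∷ l)) (sym (take++drop≡id j rest)) (AllPairs.tail (cyc-unique cyc′))
      path : All (InGraph H) (pathEdges (a ∷ as) ++ pathEdges (last a as ∷ bs))
      path = subst (All (InGraph H)) (trans (cong (λ l → pathEdges (a ∷ l)) (sym (take++drop≡id j rest))) (pathEdges-split a as bs))
        (Allₚ.++⁻ˡ (pathEdges (a ∷ rest)) (All.tail edges))
      bs∈ : bs ∈ P (last a as) b
      bs∈ = proj₂ (proj₂ (paths-between {ℓ} short (last a as) b)) bs-length
        (Unique-last a as uniq , Allₚ.++⁻ʳ (pathEdges (a ∷ as)) path
        , trans (sym (last-++ a as bs)) (cong (last a) (take++drop≡id j rest)))
      as∈ : as ∈ segments a
      as∈ = subst (λ l → as ∈ Walks.walks (extensions H) Y (a ∷ []) (extensions H (a ∷ [])) l (7 * k)) as-length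
        (Walks.walks-cover (extensions H) Y (a ∷ []) (extensions H (a ∷ [])) as (7 * k)
          (B.segment-fits a [] as (Allₚ.++⁻ˡ (pathEdges (a ∷ as)) path)
            (λ { v∈ (here refl) → Uniqueₚ.Unique[x∷xs]⇒x∉xs (Unique-++ˡ (a ∷ as) uniq) v∈ }) (AllPairs.tail (Unique-++ˡ (a ∷ as) uniq)))
          (B.segment-cost (Unique-++ˡ (a ∷ as) uniq) (λ v∈ → there (subst (λ l → _ ∈ a ∷ l) (take++drop≡id j rest) (∈-++⁺ˡ v∈)))))
        where module B = CycleBudget H p d p>0 p≤d sp Y>0 np≤Yd k≥3 cyc′

  -- The clique K_r and its touched edges.

  filterᵗ-length-map : ∀ {A B : Set} (P : B → Bool) (f : A → B) xs → length (filterᵗ P (map f xs)) ≡ length (filterᵗ (P ∘ f) xs)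
  filterᵗ-length-map P f [] = refl
  filterᵗ-length-map P f (x ∷ xs) with P (f x)
  ... | true = cong suc (filterᵗ-length-map P f xs)
  ... | false = filterᵗ-length-map P f xs

  filterᵗ-length-++ : ∀ {A : Set} (P : A → Bool) xs ys → length (filterᵗ P (xs ++ ys)) ≡ length (filterᵗ P xs) + length (filterᵗ P ys)
  filterᵗ-length-++ P xs ys = trans (cong length (Listₚ.filter-++ _ xs ys)) (length-++ (filterᵗ P xs))

  filterᵗ-true : ∀ {A : Set} (xs : List A) → length (filterᵗ (λ _ → true) xs) ≡ length xs
  filterᵗ-true [] = refl
  filterᵗ-true (x ∷ xs) = cong suc (filterᵗ-true xs)

  filterᵗ-≈ˢ : ∀ {A : Set} (P : A → Bool) {xs ys} → Unique xs → Unique ys → xs ≈ˢ ys → length (filterᵗ P xs) ≡ length (filterᵗ P ys)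
  filterᵗ-≈ˢ {A} P {xs} {ys} ux uy (a , b) = ≤-antisym (length-⊆ (filterᵗ-unique P ux) (go a)) (length-⊆ (filterᵗ-unique P uy) (go b))
    where
    go : ∀ {xs ys : List A} → xs ⊆ ys → filterᵗ P xs ⊆ filterᵗ P ys
    go {xs} sub m = let m∈ , px = ∈-filterᵗ⁻ P {xs} m in ∈-filterᵗ⁺ P (sub m∈) px

  pairs : ∀ r → List (Edge r)
  pairs zero = []
  pairs (suc r) = map (λ j → zero , suc j) (allFin r) ++ map (λ e → suc (proj₁ e) , suc (proj₂ e)) (pairs r)

  ∈-pairs⁺ : ∀ {r} {i j : Fin r} → i Fin.< j → (i , j) ∈ pairs r
  ∈-pairs⁺ {i = zero} {suc j} _ = ∈-++⁺ˡ (∈-map⁺ _ (∈-allFin j))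
  ∈-pairs⁺ {suc r} {suc i} {suc j} lt = ∈-++⁺ʳ (map (λ j → zero , suc j) (allFin r)) (∈-map⁺ _ (∈-pairs⁺ (≤-pred lt)))

  ∈-pairs⁻ : ∀ {r} {e : Edge r} → e ∈ pairs r → proj₁ e Fin.< proj₂ e
  ∈-pairs⁻ {suc r} e∈ with ∈-++⁻ (map (λ j → zero , suc j) (allFin r)) e∈
  ... | inj₁ h with ∈-map⁻ _ h
  ... | _ , _ , refl = z<s
  ∈-pairs⁻ {suc r} e∈ | inj₂ h with ∈-map⁻ _ h
  ... | _ , e∈′ , refl = s<s (∈-pairs⁻ e∈′)

  pairs-unique : ∀ r → Unique (pairs r)
  pairs-unique zero = []
  pairs-unique (suc r) = Uniqueₚ.++⁺ (Uniqueₚ.map⁺ (λ { refl → refl }) (Uniqueₚ.allFin⁺ r)) (Uniqueₚ.map⁺ (λ { refl → refl }) (pairs-unique r))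
    λ (a , b) → case ∈-map⁻ (λ j → zero , suc j) a of λ { (_ , _ , refl) → case ∈-map⁻ (λ e → suc (proj₁ e) , suc (proj₂ e)) b of λ { (_ , _ , ()) } }

  marked-suc : ∀ {r} (m : Fin (suc r) → Bool) → length (marked m) ≡ (if m zero then 1 else 0) + length (marked (m ∘ suc))
  marked-suc {r} m with m zero
  ... | true = cong suc (tail-count m)
    where
    tail-count : ∀ (m : Fin (suc r) → Bool) → length (filterᵗ m (tabulate suc)) ≡ length (marked (m ∘ suc))
    tail-count m = trans (cong (length ∘ filterᵗ m) (sym (Listₚ.map-tabulate id suc))) (filterᵗ-length-map m suc (allFin r))
  ... | false = trans (cong (length ∘ filterᵗ m) (sym (Listₚ.map-tabulate id suc))) (filterᵗ-length-map m suc (allFin r))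

  -- With a marked and c unmarked vertices, a(a - 1)/2 + a c pairs are touched; the equation is
  -- arranged so as to avoid subtraction and division. In the induction a marked new vertex touches
  -- all r new pairs, an unmarked one as many as there are marked vertices.
  touched-pairs : ∀ r (m : Fin r → Bool) → ∃ λ c → length (marked m) + c ≡ r ×
    2 * length (touched m (pairs r)) + length (marked m) ≡ length (marked m) * length (marked m) + 2 * (length (marked m) * c)
  touched-pairs zero m = 0 , refl , refl
  touched-pairs (suc r) m with touched-pairs r (m ∘ suc)
  ... | c , a+c , eq = by (m zero) refl
    where
    open +-*-Solver
    a = length (marked (m ∘ suc))
    t = length (touched (m ∘ suc) (pairs r))
    split : length (touched m (pairs (suc r))) ≡ length (filterᵗ (λ j → m zero ∨ m (suc j)) (allFin r)) + t
    split = trans (filterᵗ-length-++ _ (map (λ j → zero , suc j) (allFin r)) _)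
      (cong₂ _+_ (filterᵗ-length-map _ (λ j → zero , suc j) (allFin r)) (filterᵗ-length-map _ (λ e → suc (proj₁ e) , suc (proj₂ e)) (pairs r)))
    Claim : ℕ → ℕ → Set
    Claim T A = ∃ λ c → A + c ≡ suc r × 2 * T + A ≡ A * A + 2 * (A * c)
    by : ∀ b → m zero ≡ b → Claim (length (touched m (pairs (suc r)))) (length (marked m))
    by true m0 = subst₂ Claim
      (sym (trans split (cong (_+ t) (trans (cong (λ b → length (filterᵗ (λ j → b ∨ m (suc j)) (allFin r))) m0) (trans (filterᵗ-true (allFin r)) (trans (length-tabulate {n = r} id) (sym a+c)))))))
      (sym (trans (marked-suc m) (cong (λ b → (if b then 1 else 0) + a) m0)))
      (c , cong suc a+c , (begin
        2 * (a + c + t) + suc a                       ≡⟨ solve 3 (λ a c t → con 2 :* (a :+ c :+ t) :+ (con 1 :+ a) := con 2 :* (a :+ c) :+ con 1 :+ (con 2 :* t :+ a)) refl a c t ⟩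
        2 * (a + c) + 1 + (2 * t + a)                 ≡⟨ cong (2 * (a + c) + 1 +_) eq ⟩
        2 * (a + c) + 1 + (a * a + 2 * (a * c))       ≡⟨ solve 2 (λ a c → con 2 :* (a :+ c) :+ con 1 :+ (a :* a :+ con 2 :* (a :* c)) := (con 1 :+ a) :* (con 1 :+ a) :+ con 2 :* ((con 1 :+ a) :* c)) refl a c ⟩
        suc a * suc a + 2 * (suc a * c)               ∎))
      where open Relation.Binary.PropositionalEquality.≡-Reasoning
    by false m0 = subst₂ Claim
      (sym (trans split (cong (_+ t) (cong (λ b → length (filterᵗ (λ j → b ∨ m (suc j)) (allFin r))) m0))))
      (sym (trans (marked-suc m) (cong (λ b → (if b then 1 else 0) + a) m0)))
      (suc c , trans (+-suc a c) (cong suc a+c) , (begin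
        2 * (a + t) + a                     ≡⟨ solve 2 (λ a t → con 2 :* (a :+ t) :+ a := con 2 :* a :+ (con 2 :* t :+ a)) refl a t ⟩
        2 * a + (2 * t + a)                 ≡⟨ cong (2 * a +_) eq ⟩
        2 * a + (a * a + 2 * (a * c))       ≡⟨ solve 2 (λ a c → con 2 :* a :+ (a :* a :+ con 2 :* (a :* c)) := a :* a :+ con 2 :* (a :* (con 1 :+ c))) refl a c ⟩
        a * a + 2 * (a * suc c)             ∎))
      where open Relation.Binary.PropositionalEquality.≡-Reasoning

  not==⁺ : ∀ {n} {i j : Fin n} → i ≢ j → not (i == j) ≡ true
  not==⁺ {i = i} {j} ne with i Finₚ.≟ j
  ... | yes eq = ⊥-elim (ne eq)
  ... | no _ = refl

  module CliquePattern (r : ℕ) where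

    open Pattern (Kr r) (Graph.sym (K r)) (irref (K r)) public

    pairs≈el : pairs r ≈ˢ el
    pairs≈el = (λ e∈ → ∈-edgeList⁺ (not==⁺ (λ eq → <-irrefl (cong toℕ eq) (∈-pairs⁻ e∈))) (∈-pairs⁻ e∈))
             , (λ e∈ → ∈-pairs⁺ (el-ordered e∈))

    touched-clique : ∀ (m : Fin r → Bool) → ∃ λ c → length (marked m) + c ≡ r ×
      2 * length (touched m el) + length (marked m) ≡ length (marked m) * length (marked m) + 2 * (length (marked m) * c)
    touched-clique m with touched-pairs r m
    ... | c , h , eq = c , h , subst (λ t → 2 * t + length (marked m) ≡ length (marked m) * length (marked m) + 2 * (length (marked m) * c)) (filterᵗ-≈ˢ _ (pairs-unique r) (edgeList-unique (Kr r)) pairs≈el) eq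

    length-el : 2 * length el + r ≡ r * r
    length-el with touched-clique (λ _ → true)
    ... | c , a+c , eq = subst₂ (λ t a → 2 * t + a ≡ a * a) (filterᵗ-true el) all
        (trans eq (trans (cong (λ c → a * a + 2 * (a * c)) c≡0) (trans (cong (λ z → a * a + 2 * z) (*-zeroʳ a)) (+-identityʳ (a * a)))))
      where
      a = length (marked {r} (λ _ → true))
      all : a ≡ r
      all = trans (filterᵗ-true (allFin r)) (length-tabulate {n = r} id)
      c≡0 : c ≡ 0
      c≡0 = +-cancelˡ-≡ a c 0 (trans a+c (trans (sym all) (sym (+-identityʳ a))))

    embeds⇒adj : ∀ {n} {H : Graph n} {f : Vec (Fin n) r} → Embeds H el f → ∀ {v w} → v ∈ toList f → w ∈ toList f → v ≢ w → adj H v w ≡ true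
    embeds⇒adj {H = H} {f} (_ , h) v∈ w∈ v≢w with ∈-toList⁻ f v∈ | ∈-toList⁻ f w∈
    ... | i , refl | j , refl = inGraph-norm⁻ H (All.lookup h (subst (_∈ edgesOf el f) (norm-map (lookup f) i j)
      (∈-map⁺ _ (norm∈el (not==⁺ (λ eq → v≢w (cong (lookup f) eq)))))))

    cliqueEdges : ∀ {n} → List (Fin n) → List (Edge n)
    cliqueEdges z = edgeList (λ i j → memb z i ∧ memb z j)

    cliqueEdges≈ : ∀ {n} {f : Vec (Fin n) r} {z} → Unique (toList f) → z ≈ˢ toList f → cliqueEdges z ≈ˢ edgesOf el f
    cliqueEdges≈ {n} {f} {z} u (z⊆ , ⊆z) = to , from
      where
      to : cliqueEdges z ⊆ edgesOf el f
      to {a , b} e∈ with ∈-edgeList⁻ {F = λ i j → memb z i ∧ memb z j} e∈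
      ... | ab , lt with ∧-true⁻ {memb z a} ab
      ... | a∈ , b∈ with ∈-toList⁻ f (z⊆ (does-true⁻ (a ∈ᵛ? z) a∈)) | ∈-toList⁻ f (z⊆ (does-true⁻ (b ∈ᵛ? z) b∈))
      ... | i , refl | j , refl = subst (_∈ edgesOf el f) (trans (norm-map (lookup f) i j) (norm-< lt))
        (∈-map⁺ _ (norm∈el (not==⁺ (λ eq → <-irrefl (cong (toℕ ∘ lookup f) eq) lt))))
      from : edgesOf el f ⊆ cliqueEdges z
      from e∈ with ∈-map⁻ _ e∈
      ... | (i , j) , ij∈ , refl = ∈-edgeList⁺ (cong₂ _∧_ (dec-true (_ ∈ᵛ? z) (proj₁ ends)) (dec-true (_ ∈ᵛ? z) (proj₂ ends)))
          (norm-ordered (λ eq → <-irrefl (cong toℕ (lookup-injective u eq)) (el-ordered ij∈)))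
        where ends = norm-ends (⊆z (∈-toList f i)) (⊆z (∈-toList f j))

  -- Counting copies by degeneracy.

  module Degeneracy {n : ℕ} (H : Graph n) (p d : ℕ) (p>0 : 0 < p) (p≤d : p ≤ d) (sp : Sparseᴺ H p d) (n>0 : 0 < n) where
    open Host H p d p>0 p≤d sp

    LowDegree : ℕ → Set
    LowDegree δ = d ^ δ ≤ n ^ 2 * p ^ δ

    -- No degree exceeds n, so the search for the largest degree `D` permitted by `low-degree` may
    -- stop there. A single `D` makes the bounds uniform over all peeled vertices.
    largest : ∀ t → ∃ λ D → LowDegree D × (∀ {δ} → δ ≤ t → LowDegree δ → δ ≤ D)
    largest zero = 0 , ≤-trans (m^n>0 n {{>-nonZero n>0}} 2) (≤-reflexive (sym (*-identityʳ _))) , λ le _ → le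
    largest (suc t) with largest t | d ^ suc t ≤? n ^ 2 * p ^ suc t
    ... | D , hD , max | yes h = suc t , h , λ le _ → le
    ... | D , hD , max | no ¬h = D , hD , λ {δ} le h → max (≤-pred (≤∧≢⇒< le (λ { refl → ¬h h }))) h

    D : ℕ
    D = proj₁ (largest n)

    D-low : LowDegree D
    D-low = proj₁ (proj₂ (largest n))

    nbrs≤n : ∀ {W} → Unique W → ∀ u → length (nbrs W u) ≤ n
    nbrs≤n uW u = ≤-trans (length-⊆ (filterᵗ-unique _ uW) (λ {x} _ → ∈-allFin x)) (≤-reflexive (length-tabulate {n = n} id))

    Low : List (Fin n) → Fin n → Set
    Low W u = length (nbrs W u) ≤ D

    low : ∀ {W} → Unique W → 0 < length W → ∃ λ u → u ∈ W × Low W u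
    low uW W>0 = let u , u∈ , h = low-degree uW W>0 in u , u∈ , proj₂ (proj₂ (largest n)) (nbrs≤n uW u) h

    clique-count : ∀ {r} → 1 ≤ r → ∀ {W} → Unique W →
      (∀ {f : Vec (Fin n) r} → Embeds H (CliquePattern.el r) f → ∀ i → lookup f i ∈ W) →
      N H full (Kr r) ≤ length W * 2 ^ D
    clique-count {r} r≥1 {W} uW inW =
      let Z , len , cov = peel Low low id Clique _≈ˢ_ (2 ^ D) nonempty through W uW in
      ≤-trans (N≤covering H Z id cliqueEdges (λ {f} emb →
        let z , z∈ , z≈ = cov (f , emb , refl) (λ v∈ → let i , eq = ∈-toList⁻ f v∈ in subst (_∈ W) eq (inW emb i)) in
        z , z∈ , z≈ , cliqueEdges≈ (proj₁ emb) z≈)) len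
      where
      open CliquePattern r
      Clique : List (Fin n) → Set
      Clique xs = ∃ λ (f : Vec (Fin n) r) → Embeds H el f × toList f ≡ xs
      nonempty : ∀ {xs} → Clique xs → 0 < length xs
      nonempty (f , _ , refl) = subst (0 <_) (sym (Vecₚ.length-toList f)) r≥1
      through : ∀ {W u} → Unique W → u ∈ W → Low W u → ∃ λ Z → length Z ≤ 2 ^ D ×
        (∀ {xs} → Clique xs → u ∈ xs → xs ⊆ W → ∃ λ z → z ∈ Z × z ≈ˢ xs)
      through {W} {u} uW u∈W lowu = map (u ∷_) (sublists (nbrs W u))
        , ≤-trans (≤-reflexive (trans (length-map _ (sublists (nbrs W u))) (length-sublists (nbrs W u)))) (^-monoʳ-≤ 2 lowu)
        , λ { {xs} (f , emb , refl) u∈ sub →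
            u ∷ filter (_∈ᵛ? xs) (nbrs W u) , ∈-map⁺ (u ∷_) (filter∈sublists (_∈ᵛ? xs) (nbrs W u))
            , (λ { (here refl) → u∈ ; (there m) → proj₂ (∈-filter⁻ (_∈ᵛ? xs) {xs = nbrs W u} m) })
            , (λ {w} w∈ → other emb u∈ sub w∈ (w Finₚ.≟ u)) }
        where
        other : ∀ {f : Vec (Fin n) r} → Embeds H el f → u ∈ toList f → toList f ⊆ W → ∀ {w} → w ∈ toList f → Dec (w ≡ u) → w ∈ u ∷ filter (_∈ᵛ? toList f) (nbrs W u)
        other _ _ _ _ (yes eq) = here eq
        other emb u∈ sub w∈ (no ne) = there (∈-filter⁺ (_∈ᵛ? _) (∈-filterᵗ⁺ _ (sub w∈) (embeds⇒adj {H = H} emb u∈ w∈ (ne ∘ sym))) w∈)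

    cycle-count : ∀ {k X Y j ℓ} → k ≡ 2 + (j + ℓ) → d < X → n * p ≤ X → X ^ ℓ * p ≤ d ^ suc ℓ → 0 < Y → n * p ≤ Y * d →
      ∀ (k≥3 : 3 ≤ k) {W} → Unique W →
      (∀ {f : Vec (Fin n) k} → Embeds H (CyclePattern.el k≥3) f → ∀ i → lookup f i ∈ W) →
      N H full (Ck k) ≤ length W * (D * (Y ^ j * 2 ^ (j + 7 * k) * (D * 2 ^ (ℓ + (6 * ℓ + 6)))))
    cycle-count {_} {X} {Y} {j} {ℓ} refl d<X np≤X short Y>0 np≤Yd k≥3 {W} uW inW =
      let Z , len , cov = peel Low low id (IsCycle H k) _≈ᶜ_ B nonempty through W uW in
      ≤-trans (N≤covering H Z id cycEdges (λ {f} emb →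
        let z , z∈ , z≈ , e≈ = cov (embeds⇒cycle emb) (λ v∈ → let i , eq = ∈-toList⁻ f v∈ in subst (_∈ W) eq (inW emb i)) in
        z , z∈ , z≈ , ≈ˢ-trans e≈ (cycEdges≈edgesOf f))) len
      where
      open CyclePattern k≥3
      open Cycles H p d p>0 p≤d sp {X} {Y} {j} {ℓ} d<X np≤X short Y>0 np≤Yd k≥3
      B : ℕ
      B = D * (Y ^ j * 2 ^ (j + 7 * k) * (D * 2 ^ (ℓ + (6 * ℓ + 6))))
      nonempty : ∀ {xs} → IsCycle H k xs → 0 < length xs
      nonempty c = subst (0 <_) (sym (cyc-length c)) z<s
      through : ∀ {W u} → Unique W → u ∈ W → Low W u → ∃ λ Z → length Z ≤ B ×
        (∀ {xs} → IsCycle H k xs → u ∈ xs → xs ⊆ W → ∃ λ z → z ∈ Z × z ≈ᶜ xs)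
      through {W} {u} uW u∈W lowu = cycles W u
        , ≤-trans (length-cycles W u) (*-mono-≤ lowu (*-monoʳ-≤ (Y ^ j * 2 ^ (j + 7 * k)) (*-monoˡ-≤ _ lowu)))
        , cycles-cover

  -- Lower bounds for the number of copies in K_n.

  falling : ℕ → ℕ → ℕ
  falling n zero = 1
  falling n (suc k) = falling n k * (n ∸ k)

  falling-! : ∀ n k → k ≤ n → falling n k * (n ∸ k) ! ≡ n !
  falling-! n zero _ = *-identityˡ _
  falling-! n (suc k) lt = trans (*-assoc (falling n k) (n ∸ k) _)
    (trans (cong (falling n k *_) (trans (cong (λ m → m * (n ∸ suc k) !) eq) (cong _! (sym eq)))) (falling-! n k (<⇒≤ lt)))
    where
    eq : n ∸ k ≡ suc (n ∸ suc k)
    eq = +-∸-assoc 1 lt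

  !≤^ : ∀ {n} m → m ≤ n → m ! ≤ n ^ m
  !≤^ zero _ = ≤-refl
  !≤^ (suc m) le = *-mono-≤ le (!≤^ m (<⇒≤ le))

  -- If 2k ≤ n, every factor of the falling factorial is at least n/2. Otherwise n^n ≤ n! 4^n, where
  -- n! is the falling factorial times (n - k)! ≤ n^(n-k), and 4^n ≤ 16^k since n < 2k.
  ^≤falling : ∀ n k → k ≤ n → n ^ k ≤ falling n k * 16 ^ k
  ^≤falling n k k≤n with 2 * k ≤? n
  ... | yes 2k≤n = ≤-trans (small k 2k≤n) (*-monoʳ-≤ (falling n k) (^-monoˡ-≤ k (m≤m+n 2 14)))
    where
    open ≤-Reasoning
    open +-*-Solver
    small : ∀ k → 2 * k ≤ n → n ^ k ≤ falling n k * 2 ^ k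
    small zero _ = ≤-refl
    small (suc k) le = begin
      n * n ^ k                           ≤⟨ *-mono-≤ half (small k (≤-trans (*-monoʳ-≤ 2 (n≤1+n k)) le)) ⟩
      (n ∸ k) * 2 * (falling n k * 2 ^ k) ≡⟨ solve 3 (λ a f t → a :* con 2 :* (f :* t) := f :* a :* (con 2 :* t)) refl (n ∸ k) (falling n k) (2 ^ k) ⟩
      falling n (suc k) * 2 ^ suc k       ∎
      where
      half : n ≤ (n ∸ k) * 2
      half = begin
        n                   ≡⟨ m+n∸n≡m n n ⟨
        n + n ∸ n           ≤⟨ ∸-monoʳ-≤ (n + n) (≤-trans (*-monoʳ-≤ 2 (n≤1+n k)) le) ⟩
        n + n ∸ 2 * k       ≡⟨ cong (_∸ 2 * k) (2*≡ n) ⟨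
        2 * n ∸ 2 * k       ≡⟨ *-distribˡ-∸ 2 n k ⟨
        2 * (n ∸ k)         ≡⟨ *-comm 2 (n ∸ k) ⟩
        (n ∸ k) * 2         ∎
  ... | no 2k≰n = *-cancelʳ-≤ (n ^ k) _ (n ^ (n ∸ k)) {{m^n≢0 n (n ∸ k) {{>-nonZero n>0}}}} (begin
    n ^ k * n ^ (n ∸ k)                            ≡⟨ ^-split n k (n ∸ k) ⟨
    n ^ (k + (n ∸ k))                              ≡⟨ cong (n ^_) (m+[n∸m]≡n k≤n) ⟩
    n ^ n                                          ≤⟨ ^≤!*2^ n n ⟩
    n ! * 2 ^ (n + n)                              ≤⟨ *-mono-≤ (≤-trans (≤-reflexive (sym (falling-! n k k≤n))) (*-monoʳ-≤ (falling n k) (!≤^ (n ∸ k) (m∸n≤m n k))))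
                                                        (^-monoʳ-≤ 2 4k) ⟩
    falling n k * n ^ (n ∸ k) * 2 ^ (4 * k)        ≡⟨ cong (falling n k * n ^ (n ∸ k) *_) (^-*-assoc 2 4 k) ⟨
    falling n k * n ^ (n ∸ k) * 16 ^ k             ≡⟨ solve 3 (λ a b c → a :* b :* c := a :* c :* b) refl (falling n k) (n ^ (n ∸ k)) (16 ^ k) ⟩
    falling n k * 16 ^ k * n ^ (n ∸ k)             ∎)
    where
    open ≤-Reasoning
    open +-*-Solver
    n<2k : n < 2 * k
    n<2k = ≰⇒> 2k≰n
    n>0 : 0 < n
    n>0 = ≤-trans (pos k n<2k) k≤n
      where
      pos : ∀ k → n < 2 * k → 0 < k
      pos (suc k) _ = z<s
    4k : n + n ≤ 4 * k
    4k = ≤-trans (+-mono-≤ (<⇒≤ n<2k) (<⇒≤ n<2k)) (≤-reflexive (solve 1 (λ k → con 2 :* k :+ con 2 :* k := con 4 :* k) refl k))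

  module _ {n : ℕ} where

    avoid : ∀ {k} → Vec (Fin n) k → List (Fin n)
    avoid v = filter (λ x → ¬? (x ∈ᵛ? toList v)) (allFin n)

    injections : ∀ k → List (Vec (Fin n) k)
    injections zero = [ [] ]
    injections (suc k) = concatMap (λ v → map (_∷ v) (avoid v)) (injections k)

    injections-unique : ∀ k → Unique (injections k)
    injections-unique zero = [] ∷ []
    injections-unique (suc k) = concatMap-unique _ Vec.tail (injections-unique k)
      (λ v → Uniqueₚ.map⁺ (λ eq → proj₁ (Vecₚ.∷-injective eq)) (Uniqueₚ.filter⁺ _ (Uniqueₚ.allFin⁺ n)))
      (λ v y∈ → let _ , _ , eq = ∈-map⁻ (_∷ v) y∈ in cong Vec.tail eq)

    injections-injective : ∀ k {v} → v ∈ injections k → Unique (toList v)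
    injections-injective zero (here refl) = []
    injections-injective (suc k) {v} v∈ with ∈-concatMap⁻′ _ {injections k} v∈
    ... | w , w∈ , h with ∈-map⁻ (_∷ w) h
    ... | x , x∈ , refl = Allₚ.¬Any⇒All¬ _ (proj₂ (∈-filter⁻ (λ x → ¬? (x ∈ᵛ? toList w)) {xs = allFin n} x∈)) ∷ injections-injective k w∈

    length-injections : ∀ k → falling n k ≤ length (injections k)
    length-injections zero = ≤-refl
    length-injections (suc k) = ≤-trans (*-monoˡ-≤ (n ∸ k) (length-injections k))
      (length-concatMap≥ _ (n ∸ k) (injections k) (λ {v} _ → ≤-trans (many v) (≤-reflexive (sym (length-map (_∷ v) (avoid v))))))
      where
      many : ∀ v → n ∸ k ≤ length (avoid v)
      many v = begin
        n ∸ k                                        ≤⟨ ∸-monoˡ-≤ k (≤-trans (≤-reflexive (sym (length-tabulate {n = n} id))) (length-⊆ (Uniqueₚ.allFin⁺ n) split)) ⟩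
        length (avoid v ++ toList v) ∸ k             ≡⟨ cong (_∸ k) (trans (length-++ (avoid v)) (cong (length (avoid v) +_) (Vecₚ.length-toList v))) ⟩
        length (avoid v) + k ∸ k                     ≡⟨ m+n∸n≡m _ k ⟩
        length (avoid v)                             ∎
        where
        open ≤-Reasoning
        split : allFin n ⊆ avoid v ++ toList v
        split {x} x∈ with x ∈ᵛ? toList v
        ... | yes h = ∈-++⁺ʳ (avoid v) h
        ... | no h = ∈-++⁺ˡ (∈-filter⁺ (λ x → ¬? (x ∈ᵛ? toList v)) x∈ h)

  toList-injective : ∀ {A : Set} {k} {v w : Vec A k} → toList v ≡ toList w → v ≡ w
  toList-injective {v = []} {[]} _ = refl
  toList-injective {v = x ∷ v} {y ∷ w} eq = cong₂ _∷_ (proj₁ (Listₚ.∷-injective eq)) (toList-injective (proj₂ (Listₚ.∷-injective eq)))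

  -- Every injection is a labelling of its image copy, so N(K_n,F) is at least the number of
  -- injections divided by the number of labellings of a single copy.
  module Labellings {m : ℕ} (F : ESet m) (F-sym : ∀ i j → F i j ≡ F j i) (F-irref : ∀ i → F i i ≡ false) {n : ℕ} where
    open Pattern F F-sym F-irref

    complete-embeds : ∀ {f : Vec (Fin n) m} → Unique (toList f) → Embeds (K n) el f
    complete-embeds {f} u = u , All.tabulate λ e∈ → let (i , j) , ij∈ , eq = ∈-map⁻ _ e∈ in
      subst (InGraph (K n)) (sym eq) (inGraph-norm (K n) (not==⁺ (λ eq → <-irrefl (cong toℕ (lookup-injective u eq)) (el-ordered ij∈))))

    -- `decode` sees only the copy and must list all of its labellings among at most `M` candidates;
    -- the lists of all copies together then contain every injection.
    falling≤ : (decode : VSet n → ESet n → List (List (Fin n))) (M : ℕ) →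
      (∀ (f : Vec (Fin n) m) → Unique (toList f) → ∀ S E → (∀ v → S v ≡ memb (toList f) v) → (∀ i j → E i j ≡ closure (edgesOf el f) i j) →
        toList f ∈ decode S E × length (decode S E) ≤ M) →
      falling n m ≤ N (K n) full F * M
    falling≤ decode M h with copies (K n) F
    ... | cs , len , sound , complete = begin
      falling n m                                  ≤⟨ length-injections m ⟩
      length (injections m)                        ≡⟨ length-map toList (injections m) ⟨
      length (map toList (injections {n} m))       ≤⟨ length-⊆ (Uniqueₚ.map⁺ toList-injective (injections-unique m)) covered ⟩
      length (concatMap dec cs)                    ≤⟨ length-concatMap≤ dec M cs bounded ⟩
      length cs * M                                ≡⟨ cong (_* M) len ⟩
      N (K n) full F * M                           ∎
      where
      open ≤-Reasoning
      dec : Vec Bool n × Vec (Vec Bool n) n → List (List (Fin n))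
      dec (S , E) = decode (lookup S) (λ i j → lookup (lookup E i) j)
      bounded : ∀ {x} → x ∈ cs → length (dec x) ≤ M
      bounded x∈ with sound x∈
      ... | f , sub , iso = proj₂ (h f (toList-unique (f-inj iso)) _ _
        (λ v → sym (memb≡ {G = K n} {f = f} sub iso v)) (λ i j → sym (closure≡ {G = K n} {f = f} sub iso i j)))
      covered : map toList (injections {n} m) ⊆ concatMap dec cs
      covered l∈ with ∈-map⁻ toList l∈
      ... | f , f∈ , refl = ∈-concatMap dec (complete S E f (embeds⇒subgraph {G = K n} {f = f} emb) (embeds⇒iso {G = K n} {f = f} emb))
          (proj₁ (h f u _ _ (Vecₚ.lookup∘tabulate S)
            (λ i j → trans (cong (λ r → lookup r j) (Vecₚ.lookup∘tabulate (λ i → Vec.tabulate (E i)) i)) (Vecₚ.lookup∘tabulate (E i) j))))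
        where
        u = injections-injective m f∈
        emb = complete-embeds {f} u
        S = memb (toList f)
        E = closure (edgesOf el f)

  -- All r^r sequences over the vertex set are listed, although only r! of them are labellings: for
  -- cliques this loss is harmless.
  falling≤cliques : ∀ n r → falling n r ≤ N (K n) full (Kr r) * r ^ r
  falling≤cliques n r = falling≤ (λ S E → map toList (allVec (filterᵗ S (allFin n)) r)) (r ^ r) λ f u S E S≡ _ →
    ∈-map⁺ toList (allVec-complete f (λ i → ∈-filterᵗ⁺ S (∈-allFin _) (trans (S≡ _) (dec-true (_ ∈ᵛ? toList f) (∈-toList f i)))))
    , (begin
      length (map toList (allVec (filterᵗ S (allFin n)) r))  ≡⟨ length-map toList (allVec (filterᵗ S (allFin n)) r) ⟩
      length (allVec (filterᵗ S (allFin n)) r)               ≤⟨ length-allVec (filterᵗ S (allFin n)) r ⟩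
      length (filterᵗ S (allFin n)) ^ r                      ≤⟨ ^-monoˡ-≤ r (≤-trans (length-⊆ (filterᵗ-unique S (Uniqueₚ.allFin⁺ n))
          (λ {v} v∈ → does-true⁻ (v ∈ᵛ? toList f) (trans (sym (S≡ v)) (proj₂ (∈-filterᵗ⁻ S {allFin n} v∈))))) (≤-reflexive (Vecₚ.length-toList f))) ⟩
      r ^ r                                                  ∎)
    where
    open Labellings (Kr r) (Graph.sym (K r)) (irref (K r)) {n}
    open ≤-Reasoning

  -- A k-cycle has 2k labellings, but an exponential bound is enough: choose the start among k
  -- vertices and code the remaining walk inside the copy with Y = 1, where the degrees along the
  -- cycle sum to at most 2k.
  falling≤cycles : ∀ n k → 3 ≤ k → falling n k ≤ N (K n) full (Ck k) * (k * 2 ^ (k + 2 * k))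
  falling≤cycles n (suc k′) k≥3 = falling≤ decode (k * 2 ^ (k + 2 * k)) λ f u S E S≡ E≡ → found f u S E S≡ E≡ , small f S E S≡
    where
    k = suc k′
    open CyclePattern k≥3
    open Labellings (Ck k) (Ck-sym k) (Ck-irref k≥3) {n}
    nb : ESet n → List (Fin n) → List (Fin n)
    nb E [] = []
    nb E (v ∷ _) = filterᵗ (E v) (allFin n)
    rest : ESet n → Fin n → List (List (Fin n))
    rest E x = Walks.walks (nb E) 1 (x ∷ []) (nb E (x ∷ [])) k′ (2 * k)
    decode : VSet n → ESet n → List (List (Fin n))
    decode S E = concatMap (λ x → map (x ∷_) (rest E x)) (filterᵗ S (allFin n))
    small : ∀ (f : Vec (Fin n) k) S E → (∀ v → S v ≡ memb (toList f) v) → length (decode S E) ≤ k * 2 ^ (k + 2 * k)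
    small f S E S≡ = ≤-trans (length-concatMap≤ _ (2 ^ (k + 2 * k)) (filterᵗ S (allFin n)) (λ {x} _ →
        ≤-trans (≤-reflexive (length-map (x ∷_) (rest E x))) (≤-trans (Walks.length-walks (nb E) 1 (x ∷ []) (nb E (x ∷ [])) k′ (2 * k))
          (≤-trans (≤-reflexive (trans (cong (_* 2 ^ (k′ + 2 * k)) (^-zeroˡ k′)) (*-identityˡ _))) (^-monoʳ-≤ 2 (n≤1+n (k′ + 2 * k)))))))
      (*-monoˡ-≤ _ (≤-trans (length-⊆ (filterᵗ-unique S (Uniqueₚ.allFin⁺ n))
          (λ {v} v∈ → does-true⁻ (v ∈ᵛ? toList f) (trans (sym (S≡ v)) (proj₂ (∈-filterᵗ⁻ S {allFin n} v∈))))) (≤-reflexive (Vecₚ.length-toList f))))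
    found : ∀ (f : Vec (Fin n) k) → Unique (toList f) → ∀ S E → (∀ v → S v ≡ memb (toList f) v) → (∀ i j → E i j ≡ closure (edgesOf el f) i j) → toList f ∈ decode S E
    found f@(x ∷ g) u S E S≡ E≡ = ∈-concatMap _ (∈-filterᵗ⁺ S (∈-allFin x) (trans (S≡ x) (dec-true (x ∈ᵛ? toList f) (here refl))))
      (∈-map⁺ (x ∷_) (subst (λ l → toList g ∈ Walks.walks (nb E) 1 (x ∷ []) (nb E (x ∷ [])) l (2 * k)) (Vecₚ.length-toList g)
        (Walks.walks-cover (nb E) 1 (x ∷ []) (nb E (x ∷ [])) (toList g) (2 * k)
          (fits [] x (toList g) (λ e∈ → proj₁ (cycEdges≈edgesOf f) (subst (_ ∈_) (sym (pathEdges-snoc x (toList g) x)) (∈-++⁺ˡ e∈))))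
          (≤-trans (cost≤ [] x (toList g)) (≤-trans total (≤-reflexive (sym (*-identityˡ (2 * k)))))))))
      where
      es = edgesOf el f
      δ : Fin n → ℕ
      δ v = length (filterᵗ (E v) (allFin n))
      fits : ∀ hist x ys → pathEdges (x ∷ ys) ⊆ es → Walks.Fits (nb E) 1 (x ∷ hist) (nb E (x ∷ hist)) ys
      fits hist x [] _ = tt
      fits hist x (y ∷ ys) sub = ∈-filterᵗ⁺ (E x) (∈-allFin y) (trans (E≡ x y) (dec-true (norm x y ∈ᵉ? es) (sub (here refl))))
        , fits (x ∷ hist) y ys (sub ∘ there)
      cost≤ : ∀ hist x ys → Walks.cost (nb E) 1 (x ∷ hist) (nb E (x ∷ hist)) ys ≤ sumOver δ (x ∷ ys)
      cost≤ hist x [] = z≤n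
      cost≤ hist x (y ∷ ys) = +-monoʳ-≤ (δ x) (cost≤ (x ∷ hist) y ys)
      total : sumOver δ (toList f) ≤ 2 * k
      total = ≤-trans (handshake {es = es} (λ v → filterᵗ (E v) (allFin n)) (λ v → filterᵗ-unique _ (Uniqueₚ.allFin⁺ n))
          (λ {v} {w} m → does-true⁻ (norm v w ∈ᵉ? es) (trans (sym (E≡ v w)) (proj₂ (∈-filterᵗ⁻ (E v) {allFin n} m)))) u)
        (≤-reflexive (cong (2 *_) (trans (length-map _ el) length-el)))

  N-mono : ∀ {n m} (G : Graph n) (F : ESet m) → N G full F ≤ N (K n) full F
  N-mono {n} G F with copies (K n) F
  ... | cs , len , _ , complete = subst (N G full F ≤_) (trans (length-map _ cs) len)
    (N≤length G F (map (λ x → lookup (proj₁ x) , λ i j → lookup (lookup (proj₂ x) i) j) cs) λ S E f sub iso →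
      _ , ∈-map⁺ _ (complete S E f (inK sub) iso) , Vecₚ.lookup∘tabulate S
      , λ i j → trans (cong (λ r → lookup r j) (Vecₚ.lookup∘tabulate (λ i → Vec.tabulate (E i)) i)) (Vecₚ.lookup∘tabulate (E i) j))
    where
    inK : ∀ {S E} → Subgraph G S E → Subgraph (K n) S E
    inK s = record { E-sym = E-sym s ; E-irref = E-irref s ; E-adj = λ e → not==⁺ (adj⇒≢ G (E-adj s e)) ; E-S = E-S s }

  -- Cliques: the estimates.

  pow-cancel-< : ∀ g {a b} → a ^ g < b ^ g → a < b
  pow-cancel-< g lt = ≰⇒> λ le → <⇒≱ lt (^-monoˡ-≤ g le)

  -- Each of the h factors d/p taken from the left is at least l. A low-degree condition with
  -- exponent r + h thus gains l^h at exponent r, which makes up for losses that are exponential in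
  -- the degree.
  low-ratio : ∀ {p d n r l} h → 0 < p → l * p ≤ d → d ^ (r + h) ≤ n ^ 2 * p ^ (r + h) → d ^ r * l ^ h ≤ n ^ 2 * p ^ r
  low-ratio {p} {d} {n} {r} {l} h p>0 lp≤d low = *-cancelʳ-≤ _ _ (p ^ h) {{m^n≢0 p h {{>-nonZero p>0}}}} (begin
    d ^ r * l ^ h * p ^ h       ≡⟨ trans (*-assoc (d ^ r) _ _) (cong (d ^ r *_) (sym (^-distribʳ-* h l p))) ⟩
    d ^ r * (l * p) ^ h         ≤⟨ *-monoʳ-≤ (d ^ r) (^-monoˡ-≤ h lp≤d) ⟩
    d ^ r * d ^ h               ≡⟨ ^-split d r h ⟨
    d ^ (r + h)                 ≤⟨ low ⟩
    n ^ 2 * p ^ (r + h)         ≡⟨ trans (cong (n ^ 2 *_) (^-split p r h)) (sym (*-assoc (n ^ 2) _ _)) ⟩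
    n ^ 2 * p ^ r * p ^ h       ∎)
    where open ≤-Reasoning

  low-cut : ∀ {p d n} r h → 0 < p → p ≤ d → d ^ (r + h) ≤ n ^ 2 * p ^ (r + h) → d ^ r ≤ n ^ 2 * p ^ r
  low-cut {p} {d} {n} r h p>0 p≤d low = ≤-trans (≤-reflexive (sym (trans (cong (d ^ r *_) (^-zeroˡ h)) (*-identityʳ _))))
    (low-ratio {p} {d} {n} {r} {1} h p>0 (≤-trans (≤-reflexive (*-identityˡ p)) p≤d) low)

  module CliqueArithmetic {n p d r r′ e : ℕ} (p>0 : 0 < p) (p≤d : p ≤ d) (n>0 : 0 < n)
    (r≡ : r ≡ suc r′) (r′>0 : 0 < r′) (2e+r : 2 * e + r ≡ r * r) where

    instance
      d≢0 : NonZero d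
      d≢0 = >-nonZero (<-≤-trans p>0 p≤d)
      p≢0 : NonZero p
      p≢0 = >-nonZero p>0
      n≢0 : NonZero n
      n≢0 = >-nonZero n>0

    2e : 2 * e ≡ r * r′
    2e = +-cancelʳ-≡ r (2 * e) (r * r′) (trans 2e+r (trans (cong (r *_) r≡) (trans (*-suc r r′) (+-comm r (r * r′)))))

    r>0 : 0 < r
    r>0 = subst (0 <_) (sym r≡) z<s

    r≥2 : 2 ≤ r
    r≥2 = subst (2 ≤_) (sym r≡) (s≤s r′>0)

    ^r : ∀ a → a ^ r ≡ a * a ^ r′
    ^r a = cong (a ^_) r≡

    r≤2r′ : r ≤ 2 * r′
    r≤2r′ = ≤-trans (≤-reflexive r≡) (≤-trans (+-monoˡ-≤ r′ r′>0) (≤-reflexive (sym (2*≡ r′))))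

    -- An upper bound for n^r / N(K_n, K_r), obtained from `falling≤cliques` and `^≤falling`.
    R : ℕ
    R = r ^ r * 16 ^ r

    R≤ : R ≤ 2 ^ ((4 + r) * r)
    R≤ = begin
      r ^ r * 16 ^ r         ≡⟨ trans (*-comm (r ^ r) _) (sym (^-distribʳ-* r 16 r)) ⟩
      (16 * r) ^ r           ≤⟨ ^-monoˡ-≤ r (*-monoʳ-≤ 16 (n≤2^n r)) ⟩
      (16 * 2 ^ r) ^ r       ≡⟨ cong (_^ r) (^-split 2 4 r) ⟨
      (2 ^ (4 + r)) ^ r      ≡⟨ ^-*-assoc 2 (4 + r) r ⟩
      2 ^ ((4 + r) * r)      ∎
      where open ≤-Reasoning

    sq : ∀ a x → (a ^ x) ^ 2 ≡ (a ^ 2) ^ x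
    sq a x = trans (^-*-assoc a x 2) (trans (cong (a ^_) (*-comm x 2)) (sym (^-*-assoc a 2 x)))

    ^2e : ∀ a → (a ^ e) ^ 2 ≡ (a ^ r) ^ r′
    ^2e a = trans (^-*-assoc a e 2) (trans (cong (a ^_) (trans (*-comm e 2) 2e)) (sym (^-*-assoc a r r′)))

    -- Put q = p/d and L = 2^Λ, and square both sides, since e = r r′/2. The right side becomes n²
    -- (n² q^r L^r)^r′; `low-ratio` bounds n² q^r below by L^(δ-r), which leaves n² L^(δ r′). The
    -- left side is at most n² 2^(2δ + 6δr), and this exponent is at most 14 δ r′, whence 15 ≤ Λ.
    dense : ∀ {Λ δ a} → 15 ≤ Λ → 2 ^ Λ * p ≤ d → r ≤ δ → d ^ δ ≤ n ^ 2 * p ^ δ → a ≤ n * 2 ^ δ →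
      a * R * d ^ e < n ^ r * (2 ^ Λ * p) ^ e
    dense {Λ} {δ} {a} 15≤Λ lp≤d r≤δ low a≤ = pow-cancel-< 2 (begin-strict
      (a * R * d ^ e) ^ 2
        ≤⟨ ^-monoˡ-≤ 2 (*-monoˡ-≤ (d ^ e) (*-mono-≤ a≤ R≤′)) ⟩
      (n * 2 ^ δ * 2 ^ (3 * δ * r) * d ^ e) ^ 2
        ≡⟨ trans (^-distribʳ-* 2 (n * 2 ^ δ * 2 ^ (3 * δ * r)) (d ^ e)) (cong₂ _*_ (trans (cong (_^ 2) (*-assoc n (2 ^ δ) _)) (^-distribʳ-* 2 n (2 ^ δ * 2 ^ (3 * δ * r)))) (^2e d)) ⟩
      n ^ 2 * (2 ^ δ * 2 ^ (3 * δ * r)) ^ 2 * (d ^ r) ^ r′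
        ≡⟨ cong (λ z → n ^ 2 * z * (d ^ r) ^ r′) (trans (cong (_^ 2) (sym (^-split 2 δ (3 * δ * r)))) (^-*-assoc 2 (δ + 3 * δ * r) 2)) ⟩
      n ^ 2 * 2 ^ ((δ + 3 * δ * r) * 2) * (d ^ r) ^ r′
        <⟨ *-monoˡ-< ((d ^ r) ^ r′) {{m^n≢0 (d ^ r) r′ {{m^n≢0 d r}}}} (*-monoʳ-< (n ^ 2) {{m^n≢0 n 2}} (^-monoʳ-< 2 ≤-refl exponent)) ⟩
      n ^ 2 * 2 ^ (Λ * δ * r′) * (d ^ r) ^ r′
        ≡⟨ cong (λ z → n ^ 2 * z * (d ^ r) ^ r′) (trans (sym (^-*-assoc 2 (Λ * δ) r′)) (cong (_^ r′) (trans (sym (^-*-assoc 2 Λ δ)) (trans (cong (l ^_) (sym h+r)) (^-split l r h))))) ⟩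
      n ^ 2 * (l ^ r * l ^ h) ^ r′ * (d ^ r) ^ r′
        ≡⟨ trans (*-assoc (n ^ 2) _ _) (cong (n ^ 2 *_) (trans (sym (^-distribʳ-* r′ _ (d ^ r))) (cong (_^ r′) (solve 3 (λ x y z → x :* y :* z := z :* y :* x) refl (l ^ r) (l ^ h) (d ^ r))))) ⟩
      n ^ 2 * (d ^ r * l ^ h * l ^ r) ^ r′
        ≤⟨ *-monoʳ-≤ (n ^ 2) (^-monoˡ-≤ r′ (*-monoˡ-≤ (l ^ r) (low-ratio {p} {d} {n} {r} {l} h p>0 lp≤d (subst (λ z → d ^ z ≤ n ^ 2 * p ^ z) (sym h+r) low)))) ⟩
      n ^ 2 * (n ^ 2 * p ^ r * l ^ r) ^ r′
        ≡⟨ cong (n ^ 2 *_) (trans (cong (_^ r′) (*-assoc (n ^ 2) _ _)) (^-distribʳ-* r′ (n ^ 2) (p ^ r * l ^ r))) ⟩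
      n ^ 2 * ((n ^ 2) ^ r′ * (p ^ r * l ^ r) ^ r′)
        ≡⟨ trans (cong (_* (p ^ r * l ^ r) ^ r′) (^r (n ^ 2))) (*-assoc (n ^ 2) _ _) ⟨
      (n ^ 2) ^ r * (p ^ r * l ^ r) ^ r′
        ≡⟨ cong₂ _*_ (sq n r) (trans (^2e (l * p)) (cong (_^ r′) (trans (^-distribʳ-* r l p) (*-comm (l ^ r) (p ^ r))))) ⟨
      (n ^ r) ^ 2 * ((l * p) ^ e) ^ 2
        ≡⟨ ^-distribʳ-* 2 (n ^ r) _ ⟨
      (n ^ r * (l * p) ^ e) ^ 2 ∎)
      where
      open ≤-Reasoning
      open +-*-Solver
      l = 2 ^ Λ
      h = δ ∸ r
      h+r : r + h ≡ δ
      h+r = m+[n∸m]≡n r≤δ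
      2≤δ : 2 ≤ δ
      2≤δ = ≤-trans r≥2 r≤δ
      R≤′ : R ≤ 2 ^ (3 * δ * r)
      R≤′ = ≤-trans R≤ (^-monoʳ-≤ 2 (*-monoˡ-≤ r (≤-trans (+-mono-≤ (*-monoʳ-≤ 2 2≤δ) r≤δ)
        (≤-reflexive (solve 1 (λ x → con 2 :* x :+ x := con 3 :* x) refl δ)))))
      exponent : (δ + 3 * δ * r) * 2 < Λ * δ * r′
      exponent = begin-strict
        (δ + 3 * δ * r) * 2                ≤⟨ *-monoˡ-≤ 2 (+-mono-≤ (≤-trans (≤-reflexive (sym (*-identityʳ δ))) (*-monoʳ-≤ δ r′>0)) (*-monoʳ-≤ (3 * δ) r≤2r′)) ⟩
        (δ * r′ + 3 * δ * (2 * r′)) * 2    ≡⟨ solve 2 (λ x y → (x :* y :+ con 3 :* x :* (con 2 :* y)) :* con 2 := con 14 :* (x :* y)) refl δ r′ ⟩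
        14 * (δ * r′)                      <⟨ *-monoˡ-< (δ * r′) {{m*n≢0 δ r′ {{>-nonZero (<-≤-trans z<s 2≤δ)}} {{>-nonZero r′>0}}}} 15≤Λ ⟩
        Λ * (δ * r′)                       ≡⟨ *-assoc Λ δ r′ ⟨
        Λ * δ * r′                         ∎

    e>0 : 0 < e
    e>0 = pos e (subst (0 <_) (sym 2e) (*-mono-≤ {1} {r} {1} {r′} r>0 r′>0))
      where
      pos : ∀ e → 0 < 2 * e → 0 < e
      pos (suc e) _ = z<s

    -- Here `w` stands for the number of covered vertices. The losses are 2^D ≤ 2^r, `R` ≤
    -- 2^((4+r)r) and 4r(r + 1) ≤ 2^(3r) from the sweep, altogether 2^(8r + r²); since 8r + r² ≤ 10
    -- r r′ = 20e, any Λ > 20 will do.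
    sparse-case : ∀ {Λ a w D} → 21 ≤ Λ → D ≤ r → a ≤ w * 2 ^ D → w * d ^ e ≤ r * suc r * (4 * (n ^ r * p ^ e)) →
      a * R * d ^ e < n ^ r * (2 ^ Λ * p) ^ e
    sparse-case {Λ} {a} {w} {D} 21≤Λ D≤r a≤ w≤ = begin-strict
      a * R * d ^ e
        ≤⟨ *-monoˡ-≤ (d ^ e) (*-mono-≤ (≤-trans a≤ (*-monoʳ-≤ w (^-monoʳ-≤ 2 D≤r))) R≤) ⟩
      w * 2 ^ r * 2 ^ ((4 + r) * r) * d ^ e
        ≡⟨ solve 4 (λ w x y z → w :* x :* y :* z := x :* y :* (w :* z)) refl w (2 ^ r) (2 ^ ((4 + r) * r)) (d ^ e) ⟩
      2 ^ r * 2 ^ ((4 + r) * r) * (w * d ^ e)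
        ≤⟨ *-monoʳ-≤ (2 ^ r * 2 ^ ((4 + r) * r)) w≤ ⟩
      2 ^ r * 2 ^ ((4 + r) * r) * (r * suc r * (4 * (n ^ r * p ^ e)))
        ≤⟨ *-monoʳ-≤ (2 ^ r * 2 ^ ((4 + r) * r)) (*-monoˡ-≤ (4 * (n ^ r * p ^ e)) (*-mono-≤ (n≤2^n r) (n<2^n r))) ⟩
      2 ^ r * 2 ^ ((4 + r) * r) * (2 ^ r * 2 ^ r * (4 * (n ^ r * p ^ e)))
        ≤⟨ *-monoʳ-≤ (2 ^ r * 2 ^ ((4 + r) * r)) (*-monoʳ-≤ (2 ^ r * 2 ^ r) (*-monoˡ-≤ (n ^ r * p ^ e) (^-monoʳ-≤ 2 r≥2))) ⟩
      2 ^ r * 2 ^ ((4 + r) * r) * (2 ^ r * 2 ^ r * (2 ^ r * (n ^ r * p ^ e)))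
        ≡⟨ solve 3 (λ x y z → x :* y :* (x :* x :* (x :* z)) := x :* (x :* (x :* (x :* y))) :* z) refl (2 ^ r) (2 ^ ((4 + r) * r)) (n ^ r * p ^ e) ⟩
      2 ^ r * (2 ^ r * (2 ^ r * (2 ^ r * 2 ^ ((4 + r) * r)))) * (n ^ r * p ^ e)
        ≡⟨ cong (_* (n ^ r * p ^ e)) (trans (^-split 2 r _) (cong (2 ^ r *_) (trans (^-split 2 r _) (cong (2 ^ r *_) (trans (^-split 2 r _) (cong (2 ^ r *_) (^-split 2 r _))))))) ⟨
      2 ^ (r + (r + (r + (r + (4 + r) * r)))) * (n ^ r * p ^ e)
        <⟨ *-monoˡ-< (n ^ r * p ^ e) {{m*n≢0 _ _ {{m^n≢0 n r}} {{m^n≢0 p e}}}} (^-monoʳ-< 2 ≤-refl exponent) ⟩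
      2 ^ (Λ * e) * (n ^ r * p ^ e)
        ≡⟨ cong (_* (n ^ r * p ^ e)) (^-*-assoc 2 Λ e) ⟨
      (2 ^ Λ) ^ e * (n ^ r * p ^ e)
        ≡⟨ solve 3 (λ x y z → x :* (y :* z) := y :* (x :* z)) refl ((2 ^ Λ) ^ e) (n ^ r) (p ^ e) ⟩
      n ^ r * ((2 ^ Λ) ^ e * p ^ e)
        ≡⟨ cong (n ^ r *_) (^-distribʳ-* e (2 ^ Λ) p) ⟨
      n ^ r * (2 ^ Λ * p) ^ e ∎
      where
      open ≤-Reasoning
      open +-*-Solver
      s = r * r′
      r≤s : r ≤ s
      r≤s = ≤-trans (≤-reflexive (sym (*-identityʳ r))) (*-monoʳ-≤ r r′>0)
      exponent : r + (r + (r + (r + (4 + r) * r))) < Λ * e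
      exponent = begin-strict
        r + (r + (r + (r + (4 + r) * r)))  ≡⟨ solve 1 (λ r → r :+ (r :+ (r :+ (r :+ (con 4 :+ r) :* r))) := con 8 :* r :+ r :* r) refl r ⟩
        8 * r + r * r                   ≤⟨ +-mono-≤ (*-monoʳ-≤ 8 r≤s) (≤-trans (*-monoʳ-≤ r r≤2r′) (≤-reflexive (solve 2 (λ x y → x :* (con 2 :* y) := con 2 :* (x :* y)) refl r r′))) ⟩
        8 * s + 2 * s                   ≡⟨ solve 1 (λ s → con 8 :* s :+ con 2 :* s := con 10 :* s) refl s ⟩
        10 * s                          ≡⟨ cong (10 *_) 2e ⟨
        10 * (2 * e)                    ≡⟨ *-assoc 10 2 e ⟨
        20 * e                          <⟨ *-monoˡ-< e {{>-nonZero e>0}} 21≤Λ ⟩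
        Λ * e                           ∎

    -- Squaring turns n^r q^e into n² (n² q^r)^r′, because 2e = r r′.
    good-weight : n ^ 2 * p ^ r ≤ d ^ r → n ^ r * p ^ e ≤ n * d ^ e
    good-weight le = pow-cancel-≤ 2 z<s (begin
      (n ^ r * p ^ e) ^ 2               ≡⟨ trans (^-distribʳ-* 2 (n ^ r) (p ^ e)) (cong₂ _*_ (sq n r) (^2e p)) ⟩
      (n ^ 2) ^ r * (p ^ r) ^ r′        ≡⟨ trans (cong (_* (p ^ r) ^ r′) (^r (n ^ 2))) (trans (*-assoc (n ^ 2) _ _) (cong (n ^ 2 *_) (sym (^-distribʳ-* r′ (n ^ 2) (p ^ r))))) ⟩
      n ^ 2 * (n ^ 2 * p ^ r) ^ r′      ≤⟨ *-monoʳ-≤ (n ^ 2) (^-monoˡ-≤ r′ le) ⟩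
      n ^ 2 * (d ^ r) ^ r′              ≡⟨ trans (^-distribʳ-* 2 n (d ^ e)) (cong (n ^ 2 *_) (^2e d)) ⟨
      (n * d ^ e) ^ 2                   ∎)
      where open ≤-Reasoning

    -- With a marked and c₁ + 1 ≥ 2 unmarked vertices, 2t = a r + a c₁. Squaring leaves (n² q^r)^(r
    -- a) times n² q^(r a c₁). The first factor is at most 1, and so is the second, as a c₁ ≥ 1
    -- reduces it to n² q^r. The second unmarked vertex is what makes c₁ positive.
    bad-weight : n ^ 2 * p ^ r ≤ d ^ r → ∀ {a c t} → 1 ≤ a → 2 + a ≤ r → a + c ≡ r → 2 * t + a ≡ a * a + 2 * (a * c) →
      n ^ (1 + r * a) * p ^ (r * t) ≤ d ^ (r * t)
    bad-weight le {a} {zero} 1≤a 2+a≤r a+c _ = ⊥-elim (<⇒≱ (≤-trans (n≤1+n (suc a)) 2+a≤r) (≤-reflexive (trans (sym a+c) (+-identityʳ a))))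
    bad-weight le {a} {suc zero} 1≤a 2+a≤r a+c _ = ⊥-elim (<⇒≱ 2+a≤r (≤-reflexive (trans (sym a+c) (+-comm a 1))))
    bad-weight le {a} {suc c₁@(suc _)} {t} 1≤a 2+a≤r a+c eq = pow-cancel-≤ 2 z<s (begin
      (n ^ (1 + r * a) * p ^ (r * t)) ^ 2
        ≡⟨ trans (^-distribʳ-* 2 (n ^ (1 + r * a)) (p ^ (r * t))) (cong₂ _*_ (sq n (1 + r * a)) (double p)) ⟩
      n ^ 2 * (n ^ 2) ^ (r * a) * (p ^ (r * (r * a)) * p ^ s)
        ≡⟨ solve 4 (λ x y z w → x :* y :* (z :* w) := (y :* z) :* (x :* w)) refl (n ^ 2) ((n ^ 2) ^ (r * a)) (p ^ (r * (r * a))) (p ^ s) ⟩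
      (n ^ 2) ^ (r * a) * p ^ (r * (r * a)) * (n ^ 2 * p ^ s)
        ≡⟨ cong (_* (n ^ 2 * p ^ s)) (trans (cong ((n ^ 2) ^ (r * a) *_) (sym (^-*-assoc p r (r * a)))) (sym (^-distribʳ-* (r * a) (n ^ 2) (p ^ r)))) ⟩
      (n ^ 2 * p ^ r) ^ (r * a) * (n ^ 2 * p ^ s)
        ≤⟨ *-mono-≤ (^-monoˡ-≤ (r * a) le) rest ⟩
      (d ^ r) ^ (r * a) * d ^ s
        ≡⟨ cong (_* d ^ s) (^-*-assoc d r (r * a)) ⟩
      d ^ (r * (r * a)) * d ^ s
        ≡⟨ double d ⟨
      (d ^ (r * t)) ^ 2 ∎)
      where
      open ≤-Reasoning
      open +-*-Solver
      s = r * (a * c₁)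
      2t : 2 * t ≡ a * r + a * c₁
      2t = +-cancelʳ-≡ a (2 * t) (a * r + a * c₁) (trans eq (trans
        (solve 2 (λ a c → a :* a :+ con 2 :* (a :* (con 1 :+ c)) := a :* (a :+ (con 1 :+ c)) :+ a :* c :+ a) refl a c₁)
        (cong (λ z → a * z + a * c₁ + a) a+c)))
      double : ∀ x → (x ^ (r * t)) ^ 2 ≡ x ^ (r * (r * a)) * x ^ s
      double x = trans (^-*-assoc x (r * t) 2) (trans (cong (x ^_) (trans (solve 2 (λ r t → r :* t :* con 2 := r :* (con 2 :* t)) refl r t)
        (trans (cong (r *_) 2t) (solve 3 (λ r a c → r :* (a :* r :+ a :* c) := r :* (r :* a) :+ r :* (a :* c)) refl r a c₁)))) (^-split x (r * (r * a)) s))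
      r≤s : r ≤ s
      r≤s = ≤-trans (≤-reflexive (sym (*-identityʳ r))) (*-monoʳ-≤ r (*-mono-≤ 1≤a (s≤s z≤n)))
      rest : n ^ 2 * p ^ s ≤ d ^ s
      rest = begin
        n ^ 2 * p ^ s                       ≡⟨ cong (λ z → n ^ 2 * p ^ z) (m+[n∸m]≡n r≤s) ⟨
        n ^ 2 * p ^ (r + (s ∸ r))           ≡⟨ trans (cong (n ^ 2 *_) (^-split p r (s ∸ r))) (sym (*-assoc (n ^ 2) _ _)) ⟩
        n ^ 2 * p ^ r * p ^ (s ∸ r)         ≤⟨ *-mono-≤ le (^-monoˡ-≤ (s ∸ r) p≤d) ⟩
        d ^ r * d ^ (s ∸ r)                 ≡⟨ ^-split d r (s ∸ r) ⟨
        d ^ (r + (s ∸ r))                   ≡⟨ cong (d ^_) (m+[n∸m]≡n r≤s) ⟩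
        d ^ s                               ∎

  -- When l p > d the claim follows from N(H,F) ≤ N(K_n,F) alone.
  trivial-case : ∀ {a b d p e} l → 0 < b → 0 < d → 0 < e → a ≤ b → d < l * p → a * d ^ e < b * (l * p) ^ e
  trivial-case {a} {b} {d} {p} {e} l b>0 d>0 e>0 a≤b lt = ≤-<-trans (*-monoˡ-≤ (d ^ e) a≤b)
    (*-monoʳ-< b {{>-nonZero b>0}} (^-monoˡ-< e {{>-nonZero e>0}} lt))

  falling>0 : ∀ n k → k ≤ n → 0 < falling n k
  falling>0 n zero _ = z<s
  falling>0 n (suc k) lt = *-mono-≤ (falling>0 n k (<⇒≤ lt)) (m<n⇒0<n∸m lt)

  -- Passes from n^|F| to N(K_n, F): when f ≤ b R, it is enough to win against f after giving away
  -- the factor R.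
  cancel-factor : ∀ {f b R} a y z → f ≤ b * R → a * R * z < f * y → a * z < b * y
  cancel-factor {f} {b} {R} a y z f≤ lt = *-cancelʳ-< R (a * z) (b * y) (begin-strict
    a * z * R     ≡⟨ solve 3 (λ a z r → a :* z :* r := a :* r :* z) refl a z R ⟩
    a * R * z     <⟨ lt ⟩
    f * y         ≤⟨ *-monoˡ-≤ y f≤ ⟩
    b * R * y     ≡⟨ solve 3 (λ b r y → b :* r :* y := b :* y :* r) refl b R y ⟩
    b * y * R     ∎)
    where
    open ≤-Reasoning
    open +-*-Solver

  cliques : ∀ {n Λ} {H : Graph n} {p d} → 30 ≤ Λ → 0 < p → p ≤ d → Sparseᴺ H p d → ∀ r r′ → r ≡ suc r′ → 2 ≤ r → r ≤ n →
    N H full (Kr r) * d ^ numEdges (Kr r) < N (K n) full (Kr r) * (2 ^ Λ * p) ^ numEdges (Kr r)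
  cliques {n} {Λ} {H} {p} {d} 30≤Λ p>0 p≤d sp r r′ r≡ r≥2 r≤n = subst (λ e → N H full (Kr r) * d ^ e < b * (2 ^ Λ * p) ^ e) (sym (numEdges≡ (Kr r))) main
    where
    open CliquePattern r
    n>0 : 0 < n
    n>0 = <-≤-trans (≤-trans (s≤s z≤n) r≥2) r≤n
    a b : ℕ
    a = N H full (Kr r)
    b = N (K n) full (Kr r)
    e = length el
    open CliqueArithmetic {n} {p} {d} {r} {r′} {e} p>0 p≤d n>0 r≡ (≤-pred (subst (2 ≤_) r≡ r≥2)) length-el using (R; e>0; dense; sparse-case; good-weight; bad-weight)
    open Degeneracy H p d p>0 p≤d sp n>0
    n^r≤ : n ^ r ≤ b * R
    n^r≤ = ≤-trans (^≤falling n r r≤n) (≤-trans (*-monoˡ-≤ (16 ^ r) (falling≤cliques n r)) (≤-reflexive (*-assoc b _ _)))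
    b>0 : 0 < b
    b>0 = n≢0⇒n>0 λ eq → <⇒≱ (falling>0 n r r≤n) (≤-trans (falling≤cliques n r) (≤-reflexive (cong (_* r ^ r) eq)))
    count : ∀ {W} → Unique W → (∀ {f : Vec (Fin n) r} → Embeds H el f → ∀ i → lookup f i ∈ W) → a ≤ length W * 2 ^ D
    count = clique-count (≤-trans (s≤s z≤n) r≥2)
    count-all : a ≤ n * 2 ^ D
    count-all = ≤-trans (count (Uniqueₚ.allFin⁺ n) (λ _ _ → ∈-allFin _)) (≤-reflexive (cong (_* 2 ^ D) (length-tabulate {n = n} id)))
    main : a * d ^ e < b * (2 ^ Λ * p) ^ e
    main = cases (2 ^ Λ * p ≤? d) (n ^ 2 * p ^ r <? d ^ r) (r ≤? D)
      where
      B-case : 2 ^ Λ * p ≤ d → n ^ 2 * p ^ r < d ^ r → a * R * d ^ e < n ^ r * (2 ^ Λ * p) ^ e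
      B-case lp≤d B = let W , uW , inW , small = Sweep.swept H p d p>0 p≤d sp (≤-trans r≥2 r≤n) el (edgeList-unique (Kr r)) el-ordered (good-weight (<⇒≤ B))
                                                   (λ m lo hi → let c , a+c , eq = touched-clique m in bad-weight (<⇒≤ B) lo hi a+c eq) in
        sparse-case {Λ} {a} {length W} {D} (≤-trans (m≤m+n 21 9) 30≤Λ) D≤r (count uW inW) small
        where
        -- If r ≤ D, then `D-low` cut down to exponent r gives n² q^r ≥ 1, against this case.
        D≤r : D ≤ r
        D≤r = <⇒≤ (≰⇒> λ r≤D → <⇒≱ B (low-cut {p} {d} {n} r (D ∸ r) p>0 p≤d (subst (λ z → d ^ z ≤ n ^ 2 * p ^ z) (sym (m+[n∸m]≡n r≤D)) D-low)))
      cases : Dec (2 ^ Λ * p ≤ d) → Dec (n ^ 2 * p ^ r < d ^ r) → Dec (r ≤ D) → a * d ^ e < b * (2 ^ Λ * p) ^ e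
      cases (no big) _ _ = trivial-case {a} {b} {d} {p} {e} (2 ^ Λ) b>0 (<-≤-trans p>0 p≤d) e>0 (N-mono H (Kr r)) (≰⇒> big)
      cases (yes lp≤d) (yes B) _ = cancel-factor {n ^ r} {b} {R} a ((2 ^ Λ * p) ^ e) (d ^ e) n^r≤ (B-case lp≤d B)
      -- `dense` is applied with δ the larger of D and r. For δ = D its low-degree hypothesis is
      -- `D-low`; for δ = r it is the failure of the sparse case.
      cases (yes lp≤d) (no A) (yes r≤D) = cancel-factor {n ^ r} {b} {R} a ((2 ^ Λ * p) ^ e) (d ^ e) n^r≤
        (dense {Λ} {D} {a} (≤-trans (m≤m+n 15 15) 30≤Λ) lp≤d r≤D D-low count-all)
      cases (yes lp≤d) (no A) (no r≰D) = cancel-factor {n ^ r} {b} {R} a ((2 ^ Λ * p) ^ e) (d ^ e) n^r≤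
        (dense {Λ} {r} {a} (≤-trans (m≤m+n 15 15) 30≤Λ) lp≤d ≤-refl (≮⇒≥ A) (≤-trans count-all (*-monoʳ-≤ n (^-monoʳ-≤ 2 (<⇒≤ (≰⇒> r≰D))))))

  -- Cycles: the estimates.

  module CycleArithmetic {n p d : ℕ} (p>0 : 0 < p) (p≤d : p ≤ d) (n>0 : 0 < n) (d≤np : d ≤ n * p) where

    d>0 : 0 < d
    d>0 = <-≤-trans p>0 p≤d

    instance
      d≢0 : NonZero d
      d≢0 = >-nonZero d>0
      p≢0 : NonZero p
      p≢0 = >-nonZero p>0
      n≢0 : NonZero n
      n≢0 = >-nonZero n>0

    -- `X`/d is the y = 2nq of the overview, and `Y` is nq rounded up to an integer above it, since
    -- candidates are read in whole numbers. From nq ≥ 1 follow y > 1 and nq ≤ Y ≤ y; the factor 2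
    -- in `X` makes the first strict and leaves room for the rounding.
    z X Y : ℕ
    z = n * p
    X = 2 * z
    Y = suc (z / d)

    np≤X : z ≤ X
    np≤X = m≤m+n z _

    d<X : d < X
    d<X = <-≤-trans (s≤s d≤np) (≤-trans (+-monoˡ-≤ z (<-≤-trans d>0 d≤np)) (≤-reflexive (sym (2*≡ z))))

    X≢0 : NonZero X
    X≢0 = >-nonZero (<-trans d>0 d<X)

    np≤Yd : z ≤ Y * d
    np≤Yd = ≤-trans (≤-reflexive (m≡m%n+[m/n]*n z d)) (+-monoˡ-≤ (z / d * d) (<⇒≤ (m%n<n z d)))

    Yd≤X : Y * d ≤ X
    Yd≤X = ≤-trans (+-mono-≤ d≤np (m/n*n≤m z d)) (≤-reflexive (sym (2*≡ z)))

    Short : ℕ → Set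
    Short ℓ = X ^ ℓ * p ≤ d ^ suc ℓ

    short-pred : ∀ {ℓ} → Short (suc ℓ) → Short ℓ
    short-pred {ℓ} h = *-cancelˡ-≤ d (≤-trans (*-monoˡ-≤ (X ^ ℓ * p) (<⇒≤ d<X)) (≤-trans (≤-reflexive (sym (*-assoc X (X ^ ℓ) p))) h))

    short-1 : ∀ ℓ → Short (suc ℓ) → Short 1
    short-1 zero h = h
    short-1 (suc ℓ) h = short-1 ℓ (short-pred {suc ℓ} h)

    -- `Short 0` is p ≤ d. The search upwards from there either reaches t + 1 or stops at the last ℓ
    -- before the first failure.
    longest : ∀ t → Short (suc t) ⊎ ∃ λ ℓ → ℓ ≤ t × Short ℓ × d ^ suc (suc ℓ) < X ^ suc ℓ * p
    longest zero with X ^ 1 * p ≤? d ^ 2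
    ... | yes h = inj₁ h
    ... | no h = inj₂ (0 , z≤n , ≤-trans (≤-reflexive (*-identityˡ p)) (≤-trans p≤d (≤-reflexive (sym (*-identityʳ d)))) , ≰⇒> h)
    longest (suc t) with longest t | X ^ suc (suc t) * p ≤? d ^ suc (suc (suc t))
    ... | inj₁ _ | yes h = inj₁ h
    ... | inj₁ h′ | no h = inj₂ (suc t , ≤-refl , h′ , ≰⇒> h)
    ... | inj₂ (ℓ , ℓ≤ , s , l) | _ = inj₂ (ℓ , m≤n⇒m≤1+n ℓ≤ , s , l)

    Low : ℕ → Set
    Low δ = d ^ δ ≤ n ^ 2 * p ^ δ

    -- `Short 1` says 2nq² ≤ 1, so n² q⁴ ≤ 1/4 and the low-degree condition fails at 4; by `low-cut`
    -- it fails beyond 4 as well.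
    degree≤3 : Short 1 → ∀ {D} → Low D → D ≤ 3
    degree≤3 s {D} low = ≮⇒≥ λ 4≤D → <⇒≱ small (≤-trans (^-monoˡ-≤ 2 s′) (≤-trans (≤-reflexive (^-*-assoc d 2 2))
        (low-cut {p} {d} {n} 4 (D ∸ 4) p>0 p≤d (subst Low (sym (m+[n∸m]≡n 4≤D)) low))))
      where
      open ≤-Reasoning
      open +-*-Solver
      s′ : X * p ≤ d ^ 2
      s′ = ≤-trans (≤-reflexive (cong (_* p) (sym (*-identityʳ X)))) s
      small : n ^ 2 * p ^ 4 < (X * p) ^ 2
      small = begin-strict
        n ^ 2 * p ^ 4             ≡⟨ *-identityˡ _ ⟨
        1 * (n ^ 2 * p ^ 4)       <⟨ *-monoˡ-< (n ^ 2 * p ^ 4) {{m*n≢0 _ _ {{m^n≢0 n 2}} {{m^n≢0 p 4}}}} {1} {4} (s≤s (s≤s z≤n)) ⟩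
        4 * (n ^ 2 * p ^ 4)       ≡⟨ trans (^-distribʳ-* 2 X p) (trans (cong (_* p ^ 2) (trans (^-distribʳ-* 2 2 z) (cong (4 *_) (^-distribʳ-* 2 n p))))
                                       (trans (*-assoc 4 (n ^ 2 * p ^ 2) (p ^ 2)) (cong (4 *_) (trans (*-assoc (n ^ 2) (p ^ 2) (p ^ 2)) (cong (n ^ 2 *_) (sym (^-split p 2 2))))))) ⟨
        (X * p) ^ 2               ∎

    -- Since `Short 1` fails, 2nq² > 1, which settles D ≤ 4. For D = 4 + h, `low-ratio` gives n² q⁴
    -- ≥ l^h ≥ 16^h, whereas D⁴ ≤ (t 2^h)⁴ = t⁴ 16^h. So D² = O(nq²) even when D is unbounded.
    degree-square : ∀ {t l} → (∀ h → 4 + h ≤ t * 2 ^ h) → 16 * 2 ≤ t ^ 2 → 16 ≤ l → l * p ≤ d → d ^ 2 < X ^ 1 * p →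
      ∀ {D} → Low D → D ^ 2 * d ^ 2 ≤ t ^ 2 * (z * p)
    degree-square {t} {l} 4+h≤ 32≤t² 16≤l lp≤d long {D} low = by (D ≤? 4)
      where
      open ≤-Reasoning
      open +-*-Solver
      by : Dec (D ≤ 4) → D ^ 2 * d ^ 2 ≤ t ^ 2 * (z * p)
      by (yes D≤4) = begin
        D ^ 2 * d ^ 2              ≤⟨ *-mono-≤ (^-monoˡ-≤ 2 D≤4) (<⇒≤ long) ⟩
        16 * (X ^ 1 * p)           ≡⟨ cong (16 *_) (trans (cong (_* p) (*-identityʳ X)) (*-assoc 2 z p)) ⟩
        16 * (2 * (z * p))         ≡⟨ *-assoc 16 2 (z * p) ⟨
        16 * 2 * (z * p)           ≤⟨ *-monoˡ-≤ (z * p) 32≤t² ⟩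
        t ^ 2 * (z * p)            ∎
      by (no D≰4) = pow-cancel-≤ 2 z<s (begin
        (D ^ 2 * d ^ 2) ^ 2        ≡⟨ trans (^-distribʳ-* 2 (D ^ 2) (d ^ 2)) (cong₂ _*_ (^-*-assoc D 2 2) (^-*-assoc d 2 2)) ⟩
        D ^ 4 * d ^ 4              ≤⟨ *-monoˡ-≤ (d ^ 4) D^4≤ ⟩
        t ^ 4 * l ^ h * d ^ 4      ≡⟨ trans (*-assoc (t ^ 4) (l ^ h) (d ^ 4)) (cong (t ^ 4 *_) (*-comm (l ^ h) (d ^ 4))) ⟩
        t ^ 4 * (d ^ 4 * l ^ h)    ≤⟨ *-monoʳ-≤ (t ^ 4) (low-ratio {p} {d} {n} {4} {l} h p>0 lp≤d (subst Low (sym h+4) low)) ⟩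
        t ^ 4 * (n ^ 2 * p ^ 4)    ≡⟨ cong₂ _*_ (^-*-assoc t 2 2) (trans (^-distribʳ-* 2 z p) (trans (cong (_* p ^ 2) (^-distribʳ-* 2 n p)) (trans (*-assoc (n ^ 2) (p ^ 2) (p ^ 2)) (cong (n ^ 2 *_) (sym (^-split p 2 2)))))) ⟨
        (t ^ 2) ^ 2 * (z * p) ^ 2  ≡⟨ ^-distribʳ-* 2 (t ^ 2) (z * p) ⟨
        (t ^ 2 * (z * p)) ^ 2      ∎)
        where
        h = D ∸ 4
        h+4 : 4 + h ≡ D
        h+4 = m+[n∸m]≡n (<⇒≤ (≰⇒> D≰4))
        D^4≤ : D ^ 4 ≤ t ^ 4 * l ^ h
        D^4≤ = begin
          D ^ 4                   ≤⟨ ^-monoˡ-≤ 4 (≤-trans (≤-reflexive (sym h+4)) (4+h≤ h)) ⟩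
          (t * 2 ^ h) ^ 4         ≡⟨ trans (^-distribʳ-* 4 t (2 ^ h)) (cong (t ^ 4 *_) (trans (^-*-assoc 2 h 4) (trans (cong (2 ^_) (*-comm h 4)) (sym (^-*-assoc 2 4 h))))) ⟩
          t ^ 4 * 16 ^ h          ≤⟨ *-monoʳ-≤ (t ^ 4) (^-monoˡ-≤ h 16≤l) ⟩
          t ^ 4 * l ^ h           ∎

    good-weight : ∀ {k k′} → k ≡ suc k′ → Short k′ → n ^ k * p ^ k ≤ n * d ^ k
    good-weight {k} {k′} refl s = begin
      n ^ k * p ^ k          ≡⟨ ^-distribʳ-* k n p ⟨
      z * z ^ k′             ≡⟨ solve 3 (λ n p x → n :* p :* x := n :* (x :* p)) refl n p (z ^ k′) ⟩
      n * (z ^ k′ * p)       ≤⟨ *-monoʳ-≤ n (≤-trans (*-monoˡ-≤ p (^-monoˡ-≤ k′ np≤X)) s) ⟩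
      n * d ^ k              ∎
      where
      open ≤-Reasoning
      open +-*-Solver

    -- For t = a + 1 the ratio of the two sides is (nq)^(1 + k a) q^k′, since k (a + 1) = (1 + k a)
    -- + k′; further touched edges only help. Multiplying by (nq)^(k c) ≥ 1 with c = k - 2 - a
    -- completes the exponent to k′², because k (k - 2) + 1 = (k - 1)². The result ((nq)^k′ q)^k′ is
    -- at most 1 by `Short k′`.
    bad-weight : ∀ {k k′} → k ≡ suc k′ → Short k′ → ∀ {a t} → 2 + a ≤ k → suc a ≤ t →
      n ^ (1 + k * a) * p ^ (k * t) ≤ d ^ (k * t)
    bad-weight {k} {k′} k≡ s {a} {t} 2+a≤k a<t = begin
      n ^ (1 + k * a) * p ^ (k * t)
        ≡⟨ trans (cong (n ^ (1 + k * a) *_) (split p)) (sym (*-assoc (n ^ (1 + k * a)) _ _)) ⟩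
      n ^ (1 + k * a) * p ^ (k * suc a) * p ^ (k * (t ∸ suc a))
        ≤⟨ *-mono-≤ core (^-monoˡ-≤ (k * (t ∸ suc a)) p≤d) ⟩
      d ^ (k * suc a) * d ^ (k * (t ∸ suc a))
        ≡⟨ split d ⟨
      d ^ (k * t) ∎
      where
      open ≤-Reasoning
      open +-*-Solver
      split : ∀ x → x ^ (k * t) ≡ x ^ (k * suc a) * x ^ (k * (t ∸ suc a))
      split x = trans (cong (x ^_) (trans (cong (k *_) (sym (m+[n∸m]≡n a<t))) (*-distribˡ-+ k (suc a) (t ∸ suc a)))) (^-split x (k * suc a) _)
      c = k ∸ (2 + a)
      k′≡ : k′ ≡ suc a + c
      k′≡ = suc-injective (trans (sym k≡) (sym (m+[n∸m]≡n 2+a≤k)))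
      zk : z ^ k′ * p ≤ d ^ k
      zk = ≤-trans (*-monoˡ-≤ p (^-monoˡ-≤ k′ np≤X)) (≤-trans s (≤-reflexive (cong (d ^_) (sym k≡))))
      core : n ^ (1 + k * a) * p ^ (k * suc a) ≤ d ^ (k * suc a)
      core = *-cancelʳ-≤ _ _ (d ^ (k * c)) {{m^n≢0 d (k * c)}} (begin
        n ^ (1 + k * a) * p ^ (k * suc a) * d ^ (k * c)
          ≡⟨ cong (λ x → n ^ (1 + k * a) * x * d ^ (k * c)) (trans (cong (p ^_) (trans (trans (*-suc k a) (cong (_+ k * a) k≡)) (solve 2 (λ x y → con 1 :+ x :+ y := con 1 :+ y :+ x) refl k′ (k * a)))) (^-split p (1 + k * a) k′)) ⟩
        n ^ (1 + k * a) * (p ^ (1 + k * a) * p ^ k′) * d ^ (k * c)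
          ≡⟨ cong (_* d ^ (k * c)) (trans (sym (*-assoc (n ^ (1 + k * a)) _ _)) (cong (_* p ^ k′) (sym (^-distribʳ-* (1 + k * a) n p)))) ⟩
        z ^ (1 + k * a) * p ^ k′ * d ^ (k * c)
          ≤⟨ *-monoʳ-≤ (z ^ (1 + k * a) * p ^ k′) (^-monoˡ-≤ (k * c) d≤np) ⟩
        z ^ (1 + k * a) * p ^ k′ * z ^ (k * c)
          ≡⟨ solve 3 (λ x y w → x :* y :* w := x :* w :* y) refl (z ^ (1 + k * a)) (p ^ k′) (z ^ (k * c)) ⟩
        z ^ (1 + k * a) * z ^ (k * c) * p ^ k′
          ≡⟨ cong (_* p ^ k′) (trans (sym (^-split z (1 + k * a) (k * c))) (trans (cong (z ^_) square) (sym (^-*-assoc z k′ k′)))) ⟩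
        (z ^ k′) ^ k′ * p ^ k′
          ≡⟨ ^-distribʳ-* k′ (z ^ k′) p ⟨
        (z ^ k′ * p) ^ k′
          ≤⟨ ^-monoˡ-≤ k′ zk ⟩
        (d ^ k) ^ k′
          ≡⟨ trans (^-*-assoc d k k′) (trans (cong (d ^_) (trans (cong (k *_) k′≡) (*-distribˡ-+ k (suc a) c))) (^-split d (k * suc a) (k * c))) ⟩
        d ^ (k * suc a) * d ^ (k * c) ∎)
        where
        square : 1 + k * a + k * c ≡ k′ * k′
        square = trans (cong (λ x → 1 + x * a + x * c) (trans k≡ (cong suc k′≡)))
          (trans (solve 2 (λ a c → con 1 :+ (con 2 :+ a :+ c) :* a :+ (con 2 :+ a :+ c) :* c := (con 1 :+ a :+ c) :* (con 1 :+ a :+ c)) refl a c)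
            (cong₂ _*_ (sym k′≡) (sym k′≡)))

    -- As k = 2 + j + ℓ, the exponents j + 7k of the free walk and 7ℓ + 6 of the closing path add up
    -- to at most 14k. The two factors `D` come from the two neighbours of the peeled vertex.
    counted≤ : ∀ {j ℓ k w D D² a} → k ≡ 2 + (j + ℓ) → D * D ≤ D² →
      a ≤ w * (D * (Y ^ j * 2 ^ (j + 7 * k) * (D * 2 ^ (ℓ + (6 * ℓ + 6))))) → a ≤ w * D² * Y ^ j * 2 ^ (14 * k)
    counted≤ {j} {ℓ} {k} {w} {D} {D²} {a} k≡ D²≤ a≤ = begin
      a
        ≤⟨ a≤ ⟩
      w * (D * (Y ^ j * 2 ^ (j + 7 * k) * (D * 2 ^ (ℓ + (6 * ℓ + 6)))))
        ≡⟨ solve 5 (λ w D y s t → w :* (D :* (y :* s :* (D :* t))) := w :* (D :* D) :* y :* (s :* t)) refl w D (Y ^ j) (2 ^ (j + 7 * k)) (2 ^ (ℓ + (6 * ℓ + 6))) ⟩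
      w * (D * D) * Y ^ j * (2 ^ (j + 7 * k) * 2 ^ (ℓ + (6 * ℓ + 6)))
        ≤⟨ *-mono-≤ (*-monoˡ-≤ (Y ^ j) (*-monoʳ-≤ w D²≤)) (≤-trans (≤-reflexive (sym (^-split 2 (j + 7 * k) _))) (^-monoʳ-≤ 2 exponent)) ⟩
      w * D² * Y ^ j * 2 ^ (14 * k) ∎
      where
      open ≤-Reasoning
      open +-*-Solver
      exponent : j + 7 * k + (ℓ + (6 * ℓ + 6)) ≤ 14 * k
      exponent = begin
        j + 7 * k + (ℓ + (6 * ℓ + 6))           ≤⟨ m≤m+n _ (6 * j + 8) ⟩
        j + 7 * k + (ℓ + (6 * ℓ + 6)) + (6 * j + 8) ≡⟨ solve 3 (λ j l k → j :+ con 7 :* k :+ (l :+ (con 6 :* l :+ con 6)) :+ (con 6 :* j :+ con 8) := con 7 :* k :+ con 7 :* (con 2 :+ (j :+ l))) refl j ℓ k ⟩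
        7 * k + 7 * (2 + (j + ℓ))               ≡⟨ cong (λ x → 7 * k + 7 * x) k≡ ⟨
        7 * k + 7 * k                           ≡⟨ *-distribʳ-+ k 7 7 ⟨
        14 * k                                  ∎

    final : ∀ {Λ k s} → 27 ≤ Λ → 1 ≤ k → s ≤ 2 ^ (26 * k) * z ^ k → s < n ^ k * (2 ^ Λ * p) ^ k
    final {Λ} {k} {s} 27≤Λ 1≤k s≤ = begin-strict
      s                            ≤⟨ s≤ ⟩
      2 ^ (26 * k) * z ^ k         <⟨ *-monoˡ-< (z ^ k) {{m^n≢0 z k {{m*n≢0 n p}}}} (^-monoʳ-< 2 ≤-refl (*-monoˡ-< k {{>-nonZero 1≤k}} 27≤Λ)) ⟩
      2 ^ (Λ * k) * z ^ k          ≡⟨ cong₂ _*_ (sym (^-*-assoc 2 Λ k)) (^-distribʳ-* k n p) ⟩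
      (2 ^ Λ) ^ k * (n ^ k * p ^ k) ≡⟨ solve 3 (λ x y w → x :* (y :* w) := y :* (x :* w)) refl ((2 ^ Λ) ^ k) (n ^ k) (p ^ k) ⟩
      n ^ k * ((2 ^ Λ) ^ k * p ^ k) ≡⟨ cong (n ^ k *_) (^-distribʳ-* k (2 ^ Λ) p) ⟨
      n ^ k * (2 ^ Λ * p) ^ k      ∎
      where
      open ≤-Reasoning
      open +-*-Solver

    -- By `key`, the factor n D² is at most T y^(2+ℓ), paid for by the vertices outside the free
    -- walk. With Y ≤ y the product is at most T y^k = T 2^k (nq)^k, and 26 = 3 + 14 + 8 + 1
    -- collects `T`, the codes, the loss between n^k and N(K_n, C_k), and 2^k.
    dense : ∀ {j ℓ k D² T a} → k ≡ 2 + (j + ℓ) → T ≤ 2 ^ (3 * k) → a ≤ n * D² * Y ^ j * 2 ^ (14 * k) →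
      D² * (n * d ^ (2 + ℓ)) ≤ T * X ^ (2 + ℓ) → a * 2 ^ (8 * k) * d ^ k ≤ 2 ^ (26 * k) * z ^ k
    dense {j} {ℓ} {k} {D²} {T} {a} k≡ T≤ a≤ key = begin
      a * 2 ^ (8 * k) * d ^ k
        ≤⟨ *-monoˡ-≤ (d ^ k) (*-monoˡ-≤ (2 ^ (8 * k)) a≤) ⟩
      n * D² * Y ^ j * 2 ^ (14 * k) * 2 ^ (8 * k) * d ^ k
        ≡⟨ cong (n * D² * Y ^ j * 2 ^ (14 * k) * 2 ^ (8 * k) *_) (powk d) ⟩
      n * D² * Y ^ j * 2 ^ (14 * k) * 2 ^ (8 * k) * (d ^ j * d ^ (2 + ℓ))
        ≡⟨ solve 7 (λ n D y s t u v → n :* D :* y :* s :* t :* (u :* v) := y :* u :* (D :* (n :* v)) :* (s :* t)) refl n D² (Y ^ j) (2 ^ (14 * k)) (2 ^ (8 * k)) (d ^ j) (d ^ (2 + ℓ)) ⟩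
      Y ^ j * d ^ j * (D² * (n * d ^ (2 + ℓ))) * (2 ^ (14 * k) * 2 ^ (8 * k))
        ≤⟨ *-monoˡ-≤ (2 ^ (14 * k) * 2 ^ (8 * k)) (*-mono-≤ (≤-trans (≤-reflexive (sym (^-distribʳ-* j Y d))) (^-monoˡ-≤ j Yd≤X)) key) ⟩
      X ^ j * (T * X ^ (2 + ℓ)) * (2 ^ (14 * k) * 2 ^ (8 * k))
        ≤⟨ *-monoˡ-≤ (2 ^ (14 * k) * 2 ^ (8 * k)) (*-monoʳ-≤ (X ^ j) (*-monoˡ-≤ (X ^ (2 + ℓ)) T≤)) ⟩
      X ^ j * (2 ^ (3 * k) * X ^ (2 + ℓ)) * (2 ^ (14 * k) * 2 ^ (8 * k))
        ≡⟨ solve 5 (λ x t y s u → x :* (t :* y) :* (s :* u) := t :* (s :* u) :* (x :* y)) refl (X ^ j) (2 ^ (3 * k)) (X ^ (2 + ℓ)) (2 ^ (14 * k)) (2 ^ (8 * k)) ⟩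
      2 ^ (3 * k) * (2 ^ (14 * k) * 2 ^ (8 * k)) * (X ^ j * X ^ (2 + ℓ))
        ≡⟨ cong₂ _*_ (trans (cong (2 ^ (3 * k) *_) (sym (^-split 2 (14 * k) (8 * k)))) (sym (^-split 2 (3 * k) (14 * k + 8 * k)))) (trans (sym (powk X)) (^-distribʳ-* k 2 z)) ⟩
      2 ^ (3 * k + (14 * k + 8 * k)) * (2 ^ k * z ^ k)
        ≡⟨ *-assoc (2 ^ (3 * k + (14 * k + 8 * k))) _ _ ⟨
      2 ^ (3 * k + (14 * k + 8 * k)) * 2 ^ k * z ^ k
        ≡⟨ cong (_* z ^ k) (trans (sym (^-split 2 (3 * k + (14 * k + 8 * k)) k)) (cong (2 ^_) (solve 1 (λ k → con 3 :* k :+ (con 14 :* k :+ con 8 :* k) :+ k := con 26 :* k) refl k))) ⟩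
      2 ^ (26 * k) * z ^ k ∎
      where
      open ≤-Reasoning
      open +-*-Solver
      powk : ∀ x → x ^ k ≡ x ^ j * x ^ (2 + ℓ)
      powk x = trans (cong (x ^_) (trans k≡ (solve 2 (λ j l → con 2 :+ (j :+ l) := j :+ (con 2 :+ l)) refl j ℓ))) (^-split x j (2 + ℓ))

    -- Write n = nq/q: the failure of `Short` at ℓ + 1 bounds 1/q by y^(ℓ+1), and nq ≤ y.
    key-long : ∀ {ℓ} → d ^ suc (suc ℓ) < X ^ suc ℓ * p → n * d ^ (2 + ℓ) ≤ X ^ (2 + ℓ)
    key-long {ℓ} long = begin
      n * d ^ (2 + ℓ)           ≤⟨ *-monoʳ-≤ n (<⇒≤ long) ⟩
      n * (X ^ suc ℓ * p)       ≡⟨ solve 3 (λ n x p → n :* (x :* p) := n :* p :* x) refl n (X ^ suc ℓ) p ⟩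
      z * X ^ suc ℓ             ≤⟨ *-monoˡ-≤ (X ^ suc ℓ) np≤X ⟩
      X ^ (2 + ℓ)               ∎
      where
      open ≤-Reasoning
      open +-*-Solver

    -- The factor 1 is Y^0, there being no free walk when the closing path has length k - 2. The
    -- exponent is 26 = 2 + 1 + 1 + 14 + 8, with 2k for four times the squared degree bound and k
    -- each for the factors k and k + 1 of the sweep.
    sparse-case : ∀ {k w D² a} → D² * 4 ≤ 2 ^ (2 * k) → a ≤ w * D² * 1 * 2 ^ (14 * k) → w * d ^ k ≤ k * suc k * (4 * (n ^ k * p ^ k)) →
      a * 2 ^ (8 * k) * d ^ k ≤ 2 ^ (26 * k) * z ^ k
    sparse-case {k} {w} {D²} {a} D²≤ a≤ w≤ = begin
      a * 2 ^ (8 * k) * d ^ k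
        ≤⟨ *-monoˡ-≤ (d ^ k) (*-monoˡ-≤ (2 ^ (8 * k)) a≤) ⟩
      w * D² * 1 * 2 ^ (14 * k) * 2 ^ (8 * k) * d ^ k
        ≡⟨ solve 5 (λ w c s t u → w :* c :* con 1 :* s :* t :* u := w :* u :* c :* (s :* t)) refl w D² (2 ^ (14 * k)) (2 ^ (8 * k)) (d ^ k) ⟩
      w * d ^ k * D² * (2 ^ (14 * k) * 2 ^ (8 * k))
        ≤⟨ *-monoˡ-≤ (2 ^ (14 * k) * 2 ^ (8 * k)) (*-monoˡ-≤ D² w≤) ⟩
      k * suc k * (4 * (n ^ k * p ^ k)) * D² * (2 ^ (14 * k) * 2 ^ (8 * k))
        ≤⟨ *-monoˡ-≤ (2 ^ (14 * k) * 2 ^ (8 * k)) (*-monoˡ-≤ D² (*-monoˡ-≤ (4 * (n ^ k * p ^ k)) (*-mono-≤ (n≤2^n k) (n<2^n k)))) ⟩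
      2 ^ k * 2 ^ k * (4 * (n ^ k * p ^ k)) * D² * (2 ^ (14 * k) * 2 ^ (8 * k))
        ≡⟨ solve 6 (λ x y c f s t → x :* x :* (f :* y) :* c :* (s :* t) := c :* f :* (x :* (x :* (s :* t))) :* y) refl (2 ^ k) (n ^ k * p ^ k) D² 4 (2 ^ (14 * k)) (2 ^ (8 * k)) ⟩
      D² * 4 * (2 ^ k * (2 ^ k * (2 ^ (14 * k) * 2 ^ (8 * k)))) * (n ^ k * p ^ k)
        ≤⟨ *-monoˡ-≤ (n ^ k * p ^ k) (*-monoˡ-≤ (2 ^ k * (2 ^ k * (2 ^ (14 * k) * 2 ^ (8 * k)))) D²≤) ⟩
      2 ^ (2 * k) * (2 ^ k * (2 ^ k * (2 ^ (14 * k) * 2 ^ (8 * k)))) * (n ^ k * p ^ k)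
        ≡⟨ cong₂ _*_ (trans (cong (2 ^ (2 * k) *_) (trans (cong (2 ^ k *_) (trans (cong (2 ^ k *_) (sym (^-split 2 (14 * k) (8 * k)))) (sym (^-split 2 k _)))) (sym (^-split 2 k _)))) (sym (^-split 2 (2 * k) _))) (sym (^-distribʳ-* k n p)) ⟩
      2 ^ (2 * k + (k + (k + (14 * k + 8 * k)))) * z ^ k
        ≡⟨ cong (λ x → 2 ^ x * z ^ k) (solve 1 (λ k → con 2 :* k :+ (k :+ (k :+ (con 14 :* k :+ con 8 :* k))) := con 26 :* k) refl k) ⟩
      2 ^ (26 * k) * z ^ k ∎
      where
      open ≤-Reasoning
      open +-*-Solver

    -- If ℓ ≥ 1, then `Short 1` holds and D ≤ 3. If ℓ = 0, degrees may be large, but D² = O(nq²) by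
    -- `degree-square`, and n times nq² is (nq)², just what y^2 can pay for.
    key-case : ∀ {t l ℓ D} → (∀ h → 4 + h ≤ t * 2 ^ h) → 16 * 2 ≤ t ^ 2 → 16 ≤ l → l * p ≤ d → Low D →
      Short ℓ → d ^ suc (suc ℓ) < X ^ suc ℓ * p → D * D * (n * d ^ (2 + ℓ)) ≤ t ^ 2 * X ^ (2 + ℓ)
    key-case {t} {l} {suc ℓ} {D} _ 32≤t² _ _ low short long = *-mono-≤
      (≤-trans (*-mono-≤ D≤3 D≤3) (≤-trans (m≤m+n 9 23) 32≤t²)) (key-long {suc ℓ} long)
      where
      D≤3 : D ≤ 3
      D≤3 = degree≤3 (short-1 ℓ short) low
    key-case {t} {l} {zero} {D} 4+h≤ 32≤t² 16≤l lp≤d low _ long = begin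
      D * D * (n * d ^ 2)             ≡⟨ solve 3 (λ D n x → D :* D :* (n :* x) := n :* (D :* (D :* con 1) :* x)) refl D n (d ^ 2) ⟩
      n * (D ^ 2 * d ^ 2)             ≤⟨ *-monoʳ-≤ n (degree-square {t} {l} 4+h≤ 32≤t² 16≤l lp≤d long {D} low) ⟩
      n * (t ^ 2 * (z * p))           ≡⟨ solve 4 (λ n t z p → n :* (t :* (z :* p)) := t :* (n :* p :* z)) refl n (t ^ 2) z p ⟩
      t ^ 2 * (z * z)                 ≤⟨ *-monoʳ-≤ (t ^ 2) (*-mono-≤ np≤X (≤-trans np≤X (≤-reflexive (sym (*-identityʳ X))))) ⟩
      t ^ 2 * X ^ 2                   ∎
      where
      open ≤-Reasoning
      open +-*-Solver

  cycles : ∀ {n Λ} {H : Graph n} {p d} → 30 ≤ Λ → 0 < p → p ≤ d → Sparseᴺ H p d → ∀ k k′ → k ≡ suc k′ → 3 ≤ k → k ≤ n →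
    N H full (Ck k) * d ^ numEdges (Ck k) < N (K n) full (Ck k) * (2 ^ Λ * p) ^ numEdges (Ck k)
  cycles {n} {Λ} {H} {p} {d} 30≤Λ p>0 p≤d sp k k′ k≡ k≥3 k≤n =
    subst (λ e → a * d ^ e < b * (2 ^ Λ * p) ^ e) (sym (trans (numEdges≡ (Ck k)) length-el)) (cases (2 ^ Λ * p ≤? d) (d ≤? n * p))
    where
    open CyclePattern k≥3
    a b : ℕ
    a = N H full (Ck k)
    b = N (K n) full (Ck k)
    k>0 : 0 < k
    k>0 = ≤-trans (s≤s z≤n) k≥3
    n>0 : 0 < n
    n>0 = ≤-trans k>0 k≤n
    open Degeneracy H p d p>0 p≤d sp n>0
    -- The exponent 8 collects k ≤ 2^k starting points, 2^(3k) walks and the 16^k of `^≤falling`.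
    n^k≤ : n ^ k ≤ b * 2 ^ (8 * k)
    n^k≤ = begin
      n ^ k                                      ≤⟨ ^≤falling n k k≤n ⟩
      falling n k * 16 ^ k                       ≤⟨ *-monoˡ-≤ (16 ^ k) (falling≤cycles n k k≥3) ⟩
      b * (k * 2 ^ (k + 2 * k)) * 16 ^ k         ≤⟨ *-monoˡ-≤ (16 ^ k) (*-monoʳ-≤ b (*-monoˡ-≤ (2 ^ (k + 2 * k)) (n≤2^n k))) ⟩
      b * (2 ^ k * 2 ^ (k + 2 * k)) * 16 ^ k     ≡⟨ cong₂ (λ x y → b * x * y) (sym (^-split 2 k (k + 2 * k))) (^-*-assoc 2 4 k) ⟩
      b * 2 ^ (k + (k + 2 * k)) * 2 ^ (4 * k)    ≡⟨ trans (*-assoc b _ _) (cong (b *_) (trans (sym (^-split 2 (k + (k + 2 * k)) (4 * k))) (cong (2 ^_) exponent))) ⟩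
      b * 2 ^ (8 * k)                            ∎
      where
      open ≤-Reasoning
      open +-*-Solver
      exponent : k + (k + 2 * k) + 4 * k ≡ 8 * k
      exponent = solve 1 (λ k → k :+ (k :+ con 2 :* k) :+ con 4 :* k := con 8 :* k) refl k
    b>0 : 0 < b
    b>0 = n≢0⇒n>0 λ eq → <⇒≱ (falling>0 n k k≤n) (≤-trans (falling≤cycles n k k≥3) (≤-reflexive (cong (_* (k * 2 ^ (k + 2 * k))) eq)))
    t : ℕ
    t = k ∸ 2
    k≡2+t : k ≡ 2 + t
    k≡2+t = sym (m+[n∸m]≡n (≤-trans (n≤1+n 2) k≥3))

    -- A single k-cycle in H already needs (nq)^k ≥ 1, by sparsity applied to the cycle itself.
    acyclic : n * p < d → a ≤ 0
    acyclic np<d = N≤covering H {List (Fin n)} [] id cycEdges λ {f} emb → ⊥-elim (<⇒≱ (^-monoˡ-< k {{>-nonZero k>0}} np<d) (begin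
      d ^ k               ≡⟨ cong (d ^_) (length-cyc f) ⟨
      d ^ length (cycEdges (toList f))  ≤⟨ Host.sparse-within H p d p>0 p≤d sp (cycEdges-unique (subst (3 ≤_) (sym (Vecₚ.length-toList f)) k≥3) (proj₁ emb))
                                             (cyc-graph (embeds⇒cycle emb)) (cycEdges-within (toList f)) ⟩
      n ^ length (toList f) * p ^ length (cycEdges (toList f)) ≡⟨ cong₂ (λ x y → n ^ x * p ^ y) (Vecₚ.length-toList f) (length-cyc f) ⟩
      n ^ k * p ^ k       ≡⟨ ^-distribʳ-* k n p ⟨
      (n * p) ^ k         ∎))
      where
      open ≤-Reasoning
      length-cyc : ∀ (f : Vec (Fin n) k) → length (cycEdges (toList f)) ≡ k
      length-cyc f = trans (length-cycEdges (toList f)) (Vecₚ.length-toList f)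

    module _ (lp≤d : 2 ^ Λ * p ≤ d) (d≤np : d ≤ n * p) where
      open CycleArithmetic p>0 p≤d n>0 d≤np using (X; Y; z; Short; d<X; np≤X; np≤Yd; short-pred; short-1; longest; degree≤3; counted≤; sparse-case; dense; key-case; final; good-weight; bad-weight)

      count : ∀ {j ℓ} → k ≡ 2 + (j + ℓ) → Short ℓ → ∀ {W} → Unique W → (∀ {f : Vec (Fin n) k} → Embeds H el f → ∀ i → lookup f i ∈ W) →
        ∀ {D²} → D * D ≤ D² → a ≤ length W * D² * Y ^ j * 2 ^ (14 * k)
      count {j} {ℓ} eq short {W} uW inW {D²} D²≤ = counted≤ {j} {ℓ} {k} {length W} {D} {D²} {a} eq D²≤
        (cycle-count {k} {X} {Y} {j} {ℓ} eq d<X np≤X short z<s np≤Yd k≥3 uW inW)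

      -- `Short` at k - 1 supplies both weight conditions of the sweep, and at k - 2 the path count:
      -- all vertices except the peeled one and a neighbour form one closing path, so j = 0.
      sparse : Short (suc t) → a * 2 ^ (8 * k) * d ^ k ≤ 2 ^ (26 * k) * z ^ k
      sparse short =
        let W , uW , inW , small = Sweep.swept H p d p>0 p≤d sp (≤-trans (≤-trans (n≤1+n 2) k≥3) k≤n) el (edgeList-unique (Ck k)) el-ordered
              (subst (λ e → n ^ k * p ^ e ≤ n * d ^ e) (sym length-el) (good-weight k≡ short′))
              (λ m lo hi → bad-weight k≡ short′ hi (touched-cycle m lo hi)) in
        sparse-case {k} {length W} {16} {a} (^-monoʳ-≤ 2 {6} {2 * k} (*-monoʳ-≤ 2 k≥3))
          (count {0} {t} k≡2+t (short-pred {t} short) uW inW (≤-trans (*-mono-≤ D≤3 D≤3) (m≤m+n 9 7)))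
          (subst (λ e → length W * d ^ e ≤ k * suc k * (4 * (n ^ k * p ^ e))) length-el small)
        where
        D≤3 : D ≤ 3
        D≤3 = degree≤3 (short-1 t short) D-low
        short′ : Short k′
        short′ = subst Short (suc-injective (trans (sym k≡2+t) k≡)) short

      long : ∀ {ℓ} → ℓ ≤ t → Short ℓ → d ^ suc (suc ℓ) < X ^ suc ℓ * p → a * 2 ^ (8 * k) * d ^ k ≤ 2 ^ (26 * k) * z ^ k
      long {ℓ} ℓ≤t short lg = dense {t ∸ ℓ} {ℓ} {k} {D * D} {16 ^ 2} {a} k≡′ (^-monoʳ-≤ 2 {8} {3 * k} (≤-trans (n≤1+n 8) (*-monoʳ-≤ 3 k≥3)))
        (subst (λ w → a ≤ w * (D * D) * Y ^ (t ∸ ℓ) * 2 ^ (14 * k)) (length-tabulate {n = n} id)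
          (count {t ∸ ℓ} {ℓ} k≡′ short (Uniqueₚ.allFin⁺ n) (λ _ _ → ∈-allFin _) ≤-refl))
        (key-case {16} {2 ^ Λ} {ℓ} {D} (λ h → ≤-trans (n≤2^n (4 + h)) (≤-reflexive (^-split 2 4 h))) (m≤m+n 32 224)
          (^-monoʳ-≤ 2 {4} {Λ} (≤-trans (m≤m+n 4 26) 30≤Λ)) lp≤d D-low short lg)
        where
        k≡′ : k ≡ 2 + (t ∸ ℓ + ℓ)
        k≡′ = trans k≡2+t (cong (2 +_) (sym (m∸n+n≡m ℓ≤t)))

      main : a * d ^ k < b * (2 ^ Λ * p) ^ k
      main = cancel-factor {n ^ k} {b} {2 ^ (8 * k)} a ((2 ^ Λ * p) ^ k) (d ^ k) n^k≤
        (final {Λ} {k} (≤-trans (m≤m+n 27 3) 30≤Λ) k>0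
          ([ sparse , (λ (ℓ , ℓ≤t , short , lg) → long ℓ≤t short lg) ]′ (longest t)))

    cases : Dec (2 ^ Λ * p ≤ d) → Dec (d ≤ n * p) → a * d ^ k < b * (2 ^ Λ * p) ^ k
    cases (no big) _ = trivial-case {a} {b} {d} {p} {k} (2 ^ Λ) b>0 (<-≤-trans p>0 p≤d) k>0 (N-mono H (Ck k)) (≰⇒> big)
    cases (yes lp≤d) (yes d≤np) = main lp≤d d≤np
    cases (yes lp≤d) (no d≰np) = ≤-<-trans (*-monoˡ-≤ (d ^ k) (acyclic (≰⇒> d≰np)))
      (*-mono-≤ b>0 (m^n>0 (2 ^ Λ * p) {{m*n≢0 (2 ^ Λ) p {{m^n≢0 2 Λ}} {{>-nonZero p>0}}}} k))

  -- Conclusion over the rationals.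

  bounds : ∀ Λ → 30 ≤ Λ → ∀ n q (H : Graph n) → 0ℚ ℚ.< q → q ℚ.≤ 1ℚ → Sparse q H →
    (∀ r → 2 ≤ r → r ≤ n → fromℕ (N H full (Kr r)) ℚ.< 𝔼 n (fromℕ (2 ^ Λ) ℚ.* q) full (Kr r)) ×
    (∀ k → 3 ≤ k → k ≤ n → fromℕ (N H full (Ck k)) ℚ.< 𝔼 n (fromℕ (2 ^ Λ) ℚ.* q) full (Ck k))
  bounds Λ 30≤Λ n q H q>0 q≤1 sparse =
      (λ r r≥2 r≤n → *<⇒< {q} {num} {den} fraction (2 ^ Λ) (N H full (Kr r)) (N (K n) full (Kr r)) (numEdges (Kr r))
        (cliques 30≤Λ num>0 num≤den sparseᴺ r (pred r) (sym (suc-pred r {{>-nonZero (≤-trans (s≤s z≤n) r≥2)}})) r≥2 r≤n))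
    , (λ k k≥3 k≤n → *<⇒< {q} {num} {den} fraction (2 ^ Λ) (N H full (Ck k)) (N (K n) full (Ck k)) (numEdges (Ck k))
        (cycles 30≤Λ num>0 num≤den sparseᴺ k (pred k) (sym (suc-pred k {{>-nonZero (≤-trans (s≤s z≤n) k≥3)}})) k≥3 k≤n))
    where
    open Fraction (toFraction q>0 q≤1)
    sparseᴺ : Sparseᴺ H num den
    sparseᴺ = sparse⇒sparseᴺ fraction num>0 num≤den sparse

open import Defs
open import Data.Nat using (ℕ; _≤_)
open import Data.Rational using (ℚ; 0ℚ; 1ℚ; _*_; _<_)
open import Data.Product using (Σ; _×_)
open import Data.Fin using (Fin)
open import Data.Nat.Properties using (≤-refl)
open import Data.Product using (_,_)

theorem1p4 : Σ ℚ λ L → (n : ℕ) (q : ℚ) (H : Graph n) →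
    0ℚ < q → q Data.Rational.≤ 1ℚ → Sparse q H →
    ((r : ℕ) → 2 ≤ r → r ≤ n → fromℕ (N H full (Kr r)) < 𝔼 n (L * q) full (Kr r)) ×
    ((k : ℕ) → 3 ≤ k → k ≤ n → fromℕ (N H full (Ck k)) < 𝔼 n (L * q) full (Ck k))
theorem1p4 = fromℕ (2 Data.Nat.^ 30) , CopyCounts.bounds 30 ≤-refl
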